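{- Let $q>6.3\cdot 3^{13/3}$ be a prime power and let $f_1,f_2,f_3\in\mathbb{F}_q[X,Y,Z]$ be polynomials of degree $2$ with $f_i(0,0,0)=0$. If \[ \mathcal{O}_7(f_1,f_2,f_3)=\{(1,x,y,z,f_1(x,y,z),f_2(x,y,z),f_3(x,y,z),-zf_1(x,y,z)-yf_2(x,y,z)-xf_3(x,y,z)) : x,y,z\in\mathbb{F}_q\}\cup\{(0,0,0,0,0,0,0,1)\} \] is an ovoid of the hyperbolic quadric $Q: X_0X_7+X_1X_6+X_2X_5+X_3X_4=0$ of $\mathrm{PG}(7,q)$, then $q$ is even and $\mathcal{O}_7(f_1,f_2,f_3)$ is the Kantor ovoid.
   Context: An ovoid of $Q$ is a set of points of $Q$ meeting every generator (maximal totally singular subspace) of $Q$ in exactly one point. For $q=2^h$, the Kantor ovoid is defined as follows: on the $8$-dimensional $\mathbb{F}_q$-space $\mathbb{V}=\mathbb{F}_q\oplus\mathbb{F}_{q^3}\oplus\mathbb{F}_{q^3}\oplus\mathbb{F}_q$ with quadratic form $Q((a,\gamma,\delta,d))=ad+\mathrm{Tr}_{q^3/q}(\gamma\delta)$ (a hyperbolic quadric $Q^+(7,q)$), it is the set $\{(0,0,0,1)\}\cup\{(1,t,t^{q+q^2},\mathrm{N}_{q^3/q}(t)) : t\in\mathbb{F}_{q^3}\}$; it is transported to the quadric $Q$ above by writing $t=x+y\alpha+z\beta$ for an $\mathbb{F}_q$-basis $\{1,\alpha,\beta\}$ of $\mathbb{F}_{q^3}$ and expressing $t^{q+q^2}=xf_3(x,y,z)+yf_2(x,y,z)+zf_1(x,y,z)$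 for suitable quadratic forms $f_1,f_2,f_3$ with coefficients in $\mathbb{F}_q$ depending on $\alpha,\beta$. -}

module Defs where

open import Level using (0ℓ)
open import Algebra.Bundles using (CommutativeRing)
open import Data.Nat as ℕ using (ℕ; zero; suc)
open import Data.Nat.Primality using (Prime)
open import Data.Fin using (Fin; #_)
open import Data.Vec using (_∷_; []; lookup)
open import Data.Product using (Σ; ∃; _×_; _,_)
open import Data.Sum using (_⊎_; inj₁; inj₂)
open import Data.Unit using (⊤; tt)
open import Relation.Nullary using (¬_)
open import Relation.Binary.PropositionalEquality as ≡ using (_≡_)
open import Function.Bundles using (Bijection)

IsPrimePower : ℕ → Set
IsPrimePower q = Σ ℕ λ p → Σ ℕ λ k → Prime p × q ≡ p ℕ.^ suc k

-- q > 6.3 · 3^(13/3)  ⇔  q^3 > 6.3^3 · 3^13  ⇔  1000 q^3 > 250047 · 3^13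
BoundHolds : ℕ → Set
BoundHolds q = 250047 ℕ.* 3 ℕ.^ 13 ℕ.< 1000 ℕ.* q ℕ.^ 3

record FiniteField (n : ℕ) : Set₁ where
  field
    ring : CommutativeRing 0ℓ 0ℓ
  open CommutativeRing ring
  field
    1≉0     : ¬ (1# ≈ 0#)
    inverse : ∀ x → ¬ (x ≈ 0#) → ∃ λ y → x * y ≈ 1#
    card    : Bijection setoid (≡.setoid (Fin n))

module Geometry (R : CommutativeRing 0ℓ 0ℓ) where
  open CommutativeRing R renaming (Carrier to F)

  V8 : Set
  V8 = Fin 8 → F

  _≈v_ : V8 → V8 → Set
  u ≈v v = ∀ i → u i ≈ v i

  _+v_ : V8 → V8 → V8
  (u +v v) i = u i + v i

  _·v_ : F → V8 → V8
  (c ·v v) i = c * v i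

  0v : V8
  0v i = 0#

  Qform : V8 → F
  Qform v = v (# 0) * v (# 7) + v (# 1) * v (# 6) + v (# 2) * v (# 5) + v (# 3) * v (# 4)

  -- u and v span the same projective point (v nonzero assumed where relevant)
  _∼_ : V8 → V8 → Set
  u ∼ v = ∃ λ c → ¬ (c ≈ 0#) × u ≈v (c ·v v)

  record Subspace : Set₁ where
    field
      mem   : V8 → Set
      resp  : ∀ {u v} → u ≈v v → mem u → mem v
      zero∈ : mem 0v
      +∈    : ∀ {u v} → mem u → mem v → mem (u +v v)
      ·∈    : ∀ c {u} → mem u → mem (c ·v u)
  open Subspace public

  _⊆_ : Subspace → Subspace → Set
  W ⊆ W' = ∀ v → mem W v → mem W' v

  TotallySingular : Subspace → Set
  TotallySingular W = ∀ v → mem W v → Qform v ≈ 0#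

  Generator : Subspace → Set₁
  Generator W = TotallySingular W × (∀ W' → TotallySingular W' → W ⊆ W' → W' ⊆ W)

  -- A point set given by a family of (nonzero) representative vectors is an
  -- ovoid: all its points lie on Q, and every generator contains exactly one
  -- of its (projective) points.
  IsOvoid : {I : Set} → (I → V8) → Set₁
  IsOvoid {I} o =
    (∀ i → Qform (o i) ≈ 0# × ¬ (o i ≈v 0v)) ×
    (∀ W → Generator W →
       Σ I λ i → mem W (o i) × (∀ j → mem W (o j) → o j ∼ o i))

  -- polynomials in F[X,Y,Z] of degree ≤ 2 with zero constant term
  record Poly2 : Set where
    field
      cX cY cZ cXX cYY cZZ cXY cXZ cYZ : F

  eval : Poly2 → F → F → F → F
  eval f x y z =
    cX * x + cY * y + cZ * z + cXX * (x * x) + cYY * (y * y) + cZZ * (z * z)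
      + cXY * (x * y) + cXZ * (x * z) + cYZ * (y * z)
    where open Poly2 f

  HasDegree2 : Poly2 → Set
  HasDegree2 f =
    ¬ (cXX ≈ 0# × cYY ≈ 0# × cZZ ≈ 0# × cXY ≈ 0# × cXZ ≈ 0# × cYZ ≈ 0#)
    where open Poly2 f

  O7 : Poly2 → Poly2 → Poly2 → (F × F × F) ⊎ ⊤ → V8
  O7 f1 f2 f3 (inj₁ (x , y , z)) = lookup
    (1# ∷ x ∷ y ∷ z ∷ eval f1 x y z ∷ eval f2 x y z ∷ eval f3 x y z
      ∷ (- (z * eval f1 x y z) - y * eval f2 x y z - x * eval f3 x y z) ∷ [])
  O7 f1 f2 f3 (inj₂ tt) = lookup (0# ∷ 0# ∷ 0# ∷ 0# ∷ 0# ∷ 0# ∷ 0# ∷ 1# ∷ []) 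

-- The Kantor ovoid in V = F_q ⊕ F_{q^3} ⊕ F_{q^3} ⊕ F_q,
-- Q(a,γ,δ,d) = ad + Tr(γδ), for a cubic extension ι : F → K.

module Kantor (R S : CommutativeRing 0ℓ 0ℓ) where
  open Geometry R
  module R = CommutativeRing R
  module S = CommutativeRing S
  F = R.Carrier
  K = S.Carrier

  record RingHom : Set where
    field
      ι      : F → K
      ι-cong : ∀ {a b} → a R.≈ b → ι a S.≈ ι b
      ι-+    : ∀ a b → ι (a R.+ b) S.≈ ι a S.+ ι b
      ι-*    : ∀ a b → ι (a R.* b) S.≈ ι a S.* ι b
      ι-1    : ι R.1# S.≈ S.1#

  pow : K → ℕ → K
  pow t zero    = S.1#
  pow t (suc n) = t S.* pow t n

  module WithHom (h : RingHom) (q : ℕ) where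
    open RingHom h

    VK : Set
    VK = F × K × K × F

    _≈k_ : VK → VK → Set
    (a , γ , δ , d) ≈k (a' , γ' , δ' , d') =
      a R.≈ a' × γ S.≈ γ' × δ S.≈ δ' × d R.≈ d'

    _+k_ : VK → VK → VK
    (a , γ , δ , d) +k (a' , γ' , δ' , d') =
      (a R.+ a' , γ S.+ γ' , δ S.+ δ' , d R.+ d')

    _·k_ : F → VK → VK
    c ·k (a , γ , δ , d) = (c R.* a , ι c S.* γ , ι c S.* δ , c R.* d)

    Tr : K → K
    Tr t = t S.+ pow t q S.+ pow t (q ℕ.* q)

    Nm : K → K
    Nm t = t S.* pow t q S.* pow t (q ℕ.* q)

    tqq : K → K
    tqq t = pow t q S.* pow t (q ℕ.* q)

    QK : VK → K
    QK (a , γ , δ , d) = ι (a R.* d) S.+ Tr (γ S.* δ)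

    KantorRep : VK → Set
    KantorRep (a , γ , δ , d) =
      (∃ λ t → a R.≈ R.1# × γ S.≈ t × δ S.≈ tqq t × ι d S.≈ Nm t)
      ⊎ (a R.≈ R.0# × γ S.≈ S.0# × δ S.≈ S.0# × d R.≈ R.1#)

    _∼k_ : VK → VK → Set
    u ∼k w = ∃ λ c → ¬ (c R.≈ R.0#) × u ≈k (c ·k w)

    record Similitude : Set where
      field
        φ         : V8 → VK
        φ-cong    : ∀ {u v} → u ≈v v → φ u ≈k φ v
        φ-+       : ∀ u v → φ (u +v v) ≈k (φ u +k φ v)
        φ-·       : ∀ c v → φ (c ·v v) ≈k (c ·k φ v)
        φ-inj     : ∀ {u v} → φ u ≈k φ v → u ≈v v
        φ-surj    : ∀ w → ∃ λ v → φ v ≈k w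
        λ₀        : F
        λ₀≉0      : ¬ (λ₀ R.≈ R.0#)
        φ-sim     : ∀ v → QK (φ v) S.≈ ι (λ₀ R.* Qform v)

    MapsOntoKantor : {I : Set} → Similitude → (I → V8) → Set
    MapsOntoKantor {I} s o =
      (∀ i → ∃ λ w → KantorRep w × (Similitude.φ s (o i) ∼k w)) ×
      (∀ w → KantorRep w → Σ I λ i → Similitude.φ s (o i) ∼k w)

-- o (a point set of PG(7,q) over the field 𝔽 with q elements) is
-- projectively equivalent to the Kantor ovoid
IsKantorOvoid : (q : ℕ) (𝔽 : FiniteField q) {I : Set} →
  (I → Geometry.V8 (FiniteField.ring 𝔽)) → Set₁
IsKantorOvoid q 𝔽 o =
  Σ (FiniteField (q ℕ.^ 3)) λ 𝕂 →
  Σ (Kantor.RingHom (FiniteField.ring 𝔽) (FiniteField.ring 𝕂)) λ h →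
  Σ (Kantor.WithHom.Similitude (FiniteField.ring 𝔽) (FiniteField.ring 𝕂) h q) λ s →
  Kantor.WithHom.MapsOntoKantor (FiniteField.ring 𝔽) (FiniteField.ring 𝕂) h q s o

{-# OPTIONS --safe #-}

-- Put v = (x , y , z) and f = (f₃ , f₂ , f₁). Points of 𝒪₇ over v ≠ v + w lie on a common generator as
-- soon as w · (f (v + w) - f v) = 0, so this expression, which is affine in v, never vanishes for w ≠ 0.
-- Hence it does not depend on v. In odd characteristic this kills the quadratic parts of the fᵢ; in
-- characteristic 2 it makes f the sum of an alternating linear map and the gradient of a cubic form c
-- without nontrivial zeros.
--
-- Such a c is a norm form: after scaling and a change of basis it is x³ + x P (y , z) + E (y , z) with
-- E irreducible, and x³ + P x + E is irreducible for all (y , z) ≠ 0. Its resolvent then splits, so P³/E² + 1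
-- has absolute trace 0 for all y (at z = 1). Expanding P³/E² in partial fractions over the roots θ of E and
-- summing this trace against E⁴ yᵐ for m ≤ 2 over all y leaves only the eighth powers of the poles; the
-- resulting Vandermonde system gives P (θ) in terms of E′ (θ), which is exactly what makes
-- x³ + x P + E split into three conjugate linear forms over F (θ).
module Submission where

open import Algebra.Bundles using (CommutativeRing; RawRing; CommutativeMonoid; AbelianGroup)
import Algebra.Construct.DirectProduct as DirectProduct
import Algebra.Properties.AbelianGroup
import Algebra.Properties.CommutativeMonoid.Sum
import Algebra.Properties.CommutativeSemigroup
import Algebra.Properties.CommutativeSemiring.Exp
import Algebra.Properties.Group
import Algebra.Properties.Monoid.Mult
import Algebra.Properties.Monoid.Mult.TCOptimised
import Algebra.Properties.Ring
import Algebra.Properties.Semiring.Exp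
import Algebra.Properties.Semiring.Mult
import Algebra.Properties.Semiring.Mult.TCOptimised
import Algebra.Solver.Ring
open import Algebra.Solver.Ring.AlmostCommutativeRing using (AlmostCommutativeRing; fromCommutativeRing; _-Raw-AlmostCommutative⟶_; Induced-equivalence)
open import Data.Bool using (Bool; true; false; _xor_; _∧_; T)
import Data.Bool.Properties as Bool
open import Data.Empty using (⊥; ⊥-elim)
open import Data.Fin as Fin using (Fin; #_; combine)
open import Data.Fin.Permutation using (Permutation; permutation)
import Data.Fin.Properties as Fin
open import Data.Maybe using (Maybe; just; nothing; is-just)
open import Data.Nat as ℕ using (ℕ; zero; suc; _≤_; _<_; z≤n; s≤s)
open import Data.Nat.DivMod using (_%_; _/_; m≡m%n+[m/n]*n; m%n<n)
open import Data.Nat.Divisibility using (_∣_; divides; ∣1⇒≡1)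
open import Data.Nat.Primality using (Prime; prime[2]; prime⇒irreducible; euclidsLemma)
import Data.Nat.Properties as ℕ
open import Data.Product using (_×_; proj₁; proj₂; Σ; ∃; _,_)
open import Data.Product.Properties using (≡-dec)
open import Data.Sum using (_⊎_; inj₁; inj₂)
open import Data.Unit using (⊤; tt)
import Data.Vec as Vec
open import Data.Vec using (Vec; []; _∷_; lookup)
open import Data.Vec.N-ary using (N-ary; Eq; curryⁿ; curryⁿ-cong; _$ⁿ_)
open import Data.Vec.Relation.Unary.All using (All; []; _∷_)
open import Function using (id; _∘_)
open import Function.Bundles using (Bijection)
open import Level using (0ℓ)
open import Relation.Binary.Definitions using (WeaklyDecidable)
open import Relation.Binary.PropositionalEquality as ≡ using (_≡_)
import Relation.Binary.Reasoning.Setoid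
open import Relation.Nullary using (yes; no; ¬_; Dec; contradiction)
open import Relation.Nullary.Decidable using (decidable-stable; map′)
open import Defs

-- An absolutely irreducible plane cubic over a finite field has a rational point, by Hasse-Weil;
-- this is the usual reason why an anisotropic ternary cubic splits into conjugate lines. Exact sums
-- take the place of that estimate here. They rest on a residue rule: for θ outside `F` and m < k ≤
-- q, the sum over y in `F` of yᵐ / (y + θ)ᵏ is the value of this fraction at y = θ^q. The weight E⁴
-- is chosen to isolate one exponent. It cancels the poles in the powers 1, 2 and 4 and leaves
-- polynomials of low degree, whose sums vanish; in the powers 16, 32, ... the fractions are proper
-- and E⁴ vanishes at θ^q. Only the eighth power lies between. The weights E⁴ yᵐ have degree at most
-- 14, and sums of powers vanish up to exponent q - 2, so the bound on q enters as q ≥ 16. The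
-- comparison at θ divides by the coefficient of y z in P. If that coefficient is 0, the same sums
-- force P (θ) = 0, hence P = 0 as 1, θ, θ² are independent, and a second choice of basis leads to a
-- contradiction.

-- Polynomial identities in characteristic 2 and over the integers

-- Deciding the equality of normal forms keeps them, which can be large, out of the proof terms.
module DecidedSolver {c ℓ} (Coeff : RawRing 0ℓ 0ℓ) (R : AlmostCommutativeRing c ℓ)
  (morphism : Coeff -Raw-AlmostCommutative⟶ R) (dec : WeaklyDecidable (Induced-equivalence morphism)) where
  open AlmostCommutativeRing R using (_≈_)
  open Algebra.Solver.Ring Coeff R morphism dec public using (Polynomial; con; _:+_; _:*_; _:-_; :-_; _:=_)
  open Algebra.Solver.Ring Coeff R morphism dec using (var; ⟦_⟧; normalise; _≟N_; ⟦_⟧N-cong; prove)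

  private
    agree : ∀ {n} (e₁ e₂ : Polynomial n) → T (is-just (normalise e₁ ≟N normalise e₂)) → ∀ ρ → ⟦ e₁ ⟧ ρ ≈ ⟦ e₂ ⟧ ρ
    agree e₁ e₂ ok ρ with normalise e₁ ≟N normalise e₂
    ... | just eq = prove ρ e₁ e₂ (⟦ eq ⟧N-cong ρ)

    close : ∀ n → N-ary n (Polynomial n) (Polynomial n × Polynomial n) → Polynomial n × Polynomial n
    close n f = f $ⁿ Vec.map var (Vec.allFin n)

  -- For a valid identity the premise computes to the unit type, which is why every call passes `_`
  -- in that place.
  solve : ∀ n (f : N-ary n (Polynomial n) (Polynomial n × Polynomial n)) →
    T (is-just (normalise (proj₁ (close n f)) ≟N normalise (proj₂ (close n f)))) →
    Eq n _≈_ (curryⁿ ⟦ proj₁ (close n f) ⟧) (curryⁿ ⟦ proj₂ (close n f) ⟧)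
  solve n f ok = curryⁿ-cong _≈_ ⟦ proj₁ (close n f) ⟧ ⟦ proj₂ (close n f) ⟧ (agree (proj₁ (close n f)) (proj₂ (close n f)) ok)

TwoIsZero : CommutativeRing 0ℓ 0ℓ → Set
TwoIsZero R = 1# + 1# ≈ 0#
  where open CommutativeRing R

module CharTwo (R : CommutativeRing 0ℓ 0ℓ)
  (2≈0 : TwoIsZero R) where
  open CommutativeRing R

  x+x≈0 : ∀ x → x + x ≈ 0#
  x+x≈0 x = trans (+-cong (sym (*-identityʳ x)) (sym (*-identityʳ x)))
    (trans (sym (distribˡ x 1# 1#)) (trans (*-congˡ 2≈0) (zeroʳ x)))

  -x≈x : ∀ x → - x ≈ x
  -x≈x x = trans (sym (+-identityʳ (- x))) (trans (+-congˡ (sym (x+x≈0 x)))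
    (trans (sym (+-assoc (- x) x x)) (trans (+-congʳ (-‿inverseˡ x)) (+-identityˡ x))))

  private
    -- With the two-element field as coefficients, doubled terms and signs disappear during
    -- normalisation, so identities in characteristic 2 need no separate use of `2≈0`.
    𝔹 : RawRing 0ℓ 0ℓ
    𝔹 = record { Carrier = Bool ; _≈_ = _≡_ ; _+_ = _xor_ ; _*_ = _∧_ ; -_ = id ; 0# = false ; 1# = true }

    ⟦_⟧₂ : Bool → Carrier
    ⟦ false ⟧₂ = 0#
    ⟦ true ⟧₂ = 1#

    morphism : 𝔹 -Raw-AlmostCommutative⟶ fromCommutativeRing R
    morphism = record
      { ⟦_⟧ = ⟦_⟧₂
      ; +-homo = λ { false y → sym (+-identityˡ _) ; true false → sym (+-identityʳ _) ; true true → sym 2≈0 }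
      ; *-homo = λ { false y → sym (zeroˡ _) ; true y → sym (*-identityˡ _) }
      ; -‿homo = λ x → sym (-x≈x _)
      ; 0-homo = refl
      ; 1-homo = refl
      }

    dec : ∀ x y → Maybe (⟦ x ⟧₂ ≈ ⟦ y ⟧₂)
    dec x y with x Bool.≟ y
    ... | yes eq = just (reflexive (≡.cong ⟦_⟧₂ eq))
    ... | no _ = nothing

  open DecidedSolver 𝔹 (fromCommutativeRing R) morphism dec public

module Integral (R : CommutativeRing 0ℓ 0ℓ) where
  open CommutativeRing R hiding (zero)
  open Algebra.Properties.Ring ring using (x[y-z]≈xy-xz; [y-z]x≈yx-zx)
  open Algebra.Properties.AbelianGroup +-abelianGroup using (⁻¹-∙-comm; ⁻¹-anti-homo‿-; ε⁻¹≈ε)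
  open Algebra.Properties.CommutativeSemigroup +-commutativeSemigroup using (interchange)
  open Algebra.Properties.Semiring.Mult semiring using (×-homo-+; ×1-homo-*) renaming (_×_ to _⋅_)
  open Algebra.Properties.Semiring.Mult.TCOptimised semiring using () renaming (_×_ to _⋅′_)
  open Algebra.Properties.Monoid.Mult.TCOptimised +-monoid using (×ᵤ≈×)
  open Relation.Binary.Reasoning.Setoid setoid

  -- Integers as reduced differences: one component of a pair is 0.
  private
    cancel : ℕ → ℕ → ℕ × ℕ
    cancel zero b = zero , b
    cancel (suc a) zero = suc a , zero
    cancel (suc a) (suc b) = cancel a b

    ℤ : RawRing 0ℓ 0ℓ
    ℤ = record
      { Carrier = ℕ × ℕ ; _≈_ = _≡_
      ; _+_ = λ (a , b) (c , d) → cancel (a ℕ.+ c) (b ℕ.+ d)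
      ; _*_ = λ (a , b) (c , d) → cancel (a ℕ.* c ℕ.+ b ℕ.* d) (a ℕ.* d ℕ.+ b ℕ.* c)
      ; -_ = λ (a , b) → b , a ; 0# = 0 , 0 ; 1# = 1 , 0 }

    diff : ℕ × ℕ → Carrier
    diff (a , b) = a ⋅ 1# - b ⋅ 1#

    +-diff : ∀ u v w z → (u - v) + (w - z) ≈ (u + w) - (v + z)
    +-diff u v w z = trans (interchange u (- v) w (- z)) (+-congˡ (⁻¹-∙-comm v z))

    *-diff : ∀ u v w z → (u - v) * (w - z) ≈ (u * w + v * z) - (u * z + v * w)
    *-diff u v w z = begin
      (u - v) * (w - z)                     ≈⟨ [y-z]x≈yx-zx (w - z) u v ⟩
      u * (w - z) - v * (w - z)             ≈⟨ +-cong (x[y-z]≈xy-xz u w z) (-‿cong (x[y-z]≈xy-xz v w z)) ⟩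
      (u * w - u * z) - (v * w - v * z)     ≈⟨ +-congˡ (⁻¹-anti-homo‿- _ _) ⟩
      (u * w - u * z) + (v * z - v * w)     ≈⟨ +-diff _ _ _ _ ⟩
      (u * w + v * z) - (u * z + v * w)     ∎

    diff-cancel : ∀ a b → diff (cancel a b) ≈ diff (a , b)
    diff-cancel zero b = refl
    diff-cancel (suc a) zero = refl
    diff-cancel (suc a) (suc b) = begin
      diff (cancel a b)               ≈⟨ diff-cancel a b ⟩
      a ⋅ 1# - b ⋅ 1#                 ≈⟨ +-identityˡ _ ⟨
      0# + (a ⋅ 1# - b ⋅ 1#)          ≈⟨ +-congʳ (-‿inverseʳ 1#) ⟨
      (1# - 1#) + (a ⋅ 1# - b ⋅ 1#)   ≈⟨ +-diff _ _ _ _ ⟩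
      (1# + a ⋅ 1#) - (1# + b ⋅ 1#)   ∎

    -- Definitionally 0# and 1# at 0 and 1, so that the solver's constants can be used in statements.
    ⟦_⟧ℤ : ℕ × ℕ → Carrier
    ⟦ a , zero ⟧ℤ = a ⋅′ 1#
    ⟦ a , suc b ⟧ℤ = diff (a , suc b)

    ⟦⟧≈diff : ∀ x → ⟦ x ⟧ℤ ≈ diff x
    ⟦⟧≈diff (a , zero) = trans (sym (×ᵤ≈× a 1#)) (trans (sym (+-identityʳ _)) (+-congˡ (sym ε⁻¹≈ε)))
    ⟦⟧≈diff (a , suc b) = refl

    morphism : ℤ -Raw-AlmostCommutative⟶ fromCommutativeRing R
    morphism = record
      { ⟦_⟧ = ⟦_⟧ℤ
      ; +-homo = λ x@(a , b) y@(c , d) → begin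
          ⟦ cancel (a ℕ.+ c) (b ℕ.+ d) ⟧ℤ                   ≈⟨ ⟦⟧≈diff (cancel (a ℕ.+ c) (b ℕ.+ d)) ⟩
          diff (cancel (a ℕ.+ c) (b ℕ.+ d))                 ≈⟨ diff-cancel (a ℕ.+ c) (b ℕ.+ d) ⟩
          (a ℕ.+ c) ⋅ 1# - (b ℕ.+ d) ⋅ 1#                   ≈⟨ +-cong (×-homo-+ 1# a c) (-‿cong (×-homo-+ 1# b d)) ⟩
          (a ⋅ 1# + c ⋅ 1#) - (b ⋅ 1# + d ⋅ 1#)             ≈⟨ +-diff _ _ _ _ ⟨
          diff x + diff y                                   ≈⟨ +-cong (⟦⟧≈diff x) (⟦⟧≈diff y) ⟨
          ⟦ x ⟧ℤ + ⟦ y ⟧ℤ                                   ∎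
      ; *-homo = λ x@(a , b) y@(c , d) → begin
          ⟦ cancel (a ℕ.* c ℕ.+ b ℕ.* d) (a ℕ.* d ℕ.+ b ℕ.* c) ⟧ℤ      ≈⟨ ⟦⟧≈diff (cancel (a ℕ.* c ℕ.+ b ℕ.* d) (a ℕ.* d ℕ.+ b ℕ.* c)) ⟩
          diff (cancel (a ℕ.* c ℕ.+ b ℕ.* d) (a ℕ.* d ℕ.+ b ℕ.* c))    ≈⟨ diff-cancel (a ℕ.* c ℕ.+ b ℕ.* d) _ ⟩
          (a ℕ.* c ℕ.+ b ℕ.* d) ⋅ 1# - (a ℕ.* d ℕ.+ b ℕ.* c) ⋅ 1#      ≈⟨ +-cong (products a c b d) (-‿cong (products a d b c)) ⟩
          ((a ⋅ 1#) * (c ⋅ 1#) + (b ⋅ 1#) * (d ⋅ 1#)) - ((a ⋅ 1#) * (d ⋅ 1#) + (b ⋅ 1#) * (c ⋅ 1#))  ≈⟨ *-diff _ _ _ _ ⟨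
          diff x * diff y                                              ≈⟨ *-cong (⟦⟧≈diff x) (⟦⟧≈diff y) ⟨
          ⟦ x ⟧ℤ * ⟦ y ⟧ℤ                                              ∎
      ; -‿homo = λ x → trans (⟦⟧≈diff (proj₂ x , proj₁ x)) (trans (sym (⁻¹-anti-homo‿- _ _)) (-‿cong (sym (⟦⟧≈diff x))))
      ; 0-homo = refl
      ; 1-homo = refl
      }
      where
      products : ∀ a c b d → (a ℕ.* c ℕ.+ b ℕ.* d) ⋅ 1# ≈ (a ⋅ 1#) * (c ⋅ 1#) + (b ⋅ 1#) * (d ⋅ 1#)
      products a c b d = trans (×-homo-+ 1# (a ℕ.* c) (b ℕ.* d)) (+-cong (×1-homo-* a c) (×1-homo-* b d))

    dec : ∀ x y → Maybe (⟦ x ⟧ℤ ≈ ⟦ y ⟧ℤ)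
    dec x y with ≡-dec ℕ._≟_ ℕ._≟_ x y
    ... | yes eq = just (reflexive (≡.cong ⟦_⟧ℤ eq))
    ... | no _ = nothing

  open DecidedSolver ℤ (fromCommutativeRing R) morphism dec public

-- Finite fields: zeros of polynomials, sums over all elements, Fermat's theorem

module Field {n : ℕ} (𝔽 : FiniteField n) where
  open FiniteField 𝔽 using (1≉0; inverse; card) public
  R = FiniteField.ring 𝔽
  open CommutativeRing R hiding (zero) public renaming (Carrier to F)
  open Integral R
  open Algebra.Properties.Group +-group using (x∙y⁻¹≈ε⇒x≈y)
  open Algebra.Properties.Semiring.Exp semiring public using (_^_; ^-congˡ; ^-homo-*; ^-assocʳ)
  open Algebra.Properties.CommutativeSemiring.Exp commutativeSemiring public using (^-distrib-*)
  open Relation.Binary.Reasoning.Setoid setoid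
  private module card = Bijection card

  infix 4 _≟_

  _≟_ : ∀ x y → Dec (x ≈ y)
  x ≟ y = map′ card.injective card.cong (card.to x Fin.≟ card.to y)

  inv : F → F
  inv x with x ≟ 0#
  ... | yes _  = 0#
  ... | no x≉0 = proj₁ (inverse x x≉0)

  inv-right : ∀ {x} → x ≉ 0# → x * inv x ≈ 1#
  inv-right {x} x≉0 with x ≟ 0#
  ... | yes x≈0 = contradiction x≈0 x≉0
  ... | no x≉0′ = proj₂ (inverse x x≉0′)

  *-cancelˡ-nonzero : ∀ {x y z} → x ≉ 0# → x * y ≈ x * z → y ≈ z
  *-cancelˡ-nonzero {x} {y} {z} x≉0 xy≈xz = begin
    y              ≈⟨ lemma y ⟨
    inv x * (x * y) ≈⟨ *-congˡ xy≈xz ⟩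
    inv x * (x * z) ≈⟨ lemma z ⟩
    z              ∎
    where
    lemma : ∀ w → inv x * (x * w) ≈ w
    lemma w = trans (sym (*-assoc (inv x) x w))
      (trans (*-congʳ (trans (*-comm (inv x) x) (inv-right x≉0))) (*-identityˡ w))

  *-zero-cancelˡ : ∀ {x y} → x ≉ 0# → x * y ≈ 0# → y ≈ 0#
  *-zero-cancelˡ {x} x≉0 xy≈0 = *-cancelˡ-nonzero x≉0 (trans xy≈0 (sym (zeroʳ x)))

  *-nonzero : ∀ {x y} → x ≉ 0# → y ≉ 0# → x * y ≉ 0#
  *-nonzero x≉0 y≉0 xy≈0 = y≉0 (*-zero-cancelˡ x≉0 xy≈0)

  inv-nonzero : ∀ {x} → x ≉ 0# → inv x ≉ 0#
  inv-nonzero {x} x≉0 inv≈0 = 1≉0 (trans (sym (inv-right x≉0)) (trans (*-congˡ inv≈0) (zeroʳ x)))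

  inv-unique : ∀ {x y} → x * y ≈ 1# → y ≈ inv x
  inv-unique {x} {y} xy≈1 = *-cancelˡ-nonzero x≉0 (trans xy≈1 (sym (inv-right x≉0)))
    where
    x≉0 : x ≉ 0#
    x≉0 x≈0 = 1≉0 (trans (sym xy≈1) (trans (*-congʳ x≈0) (zeroˡ y)))

  ^-nonzero : ∀ {x} → x ≉ 0# → ∀ k → x ^ k ≉ 0#
  ^-nonzero x≉0 zero    = 1≉0
  ^-nonzero x≉0 (suc k) = *-nonzero x≉0 (^-nonzero x≉0 k)

  ^-zero-root : ∀ {x} k → x ^ k ≈ 0# → x ≈ 0#
  ^-zero-root {x} k eq = decidable-stable (x ≟ 0#) λ x≉0 → ^-nonzero x≉0 k eq

  enum : Fin n → F
  enum = card.to⁻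

  to-enum : ∀ i → card.to (enum i) ≡ i
  to-enum i = proj₂ (card.surjective i) refl

  enum-to : ∀ x → enum (card.to x) ≈ x
  enum-to x = card.injective (to-enum (card.to x))

  enum-injective : ∀ {i j} → enum i ≈ enum j → i ≡ j
  enum-injective {i} {j} eq = ≡.trans (≡.sym (to-enum i)) (≡.trans (card.cong eq) (to-enum j))


  -- Polynomials as coefficient vectors, constant term first.
  evalₚ : ∀ {k} → Vec F k → F → F
  evalₚ []       x = 0#
  evalₚ (c ∷ cs) x = c + x * evalₚ cs x

  private
    -- Horner's scheme: the coefficients of the quotient by x - a are the values at a of the
    -- successive tails.
    quotient : ∀ {k} → F → Vec F (suc k) → Vec F k
    quotient a (c ∷ [])          = []
    quotient a (c ∷ cs@(_ ∷ _)) = evalₚ cs a ∷ quotient a cs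

    quotient-correct : ∀ {k} a (cs : Vec F (suc k)) x →
      evalₚ cs x - evalₚ cs a ≈ (x - a) * evalₚ (quotient a cs) x
    quotient-correct a (c ∷ []) x =
      solve 3 (λ c x a → (c :+ x :* con (0 , 0)) :- (c :+ a :* con (0 , 0)) := (x :- a) :* con (0 , 0)) _ c x a
    quotient-correct a (c ∷ cs@(_ ∷ _)) x = begin
      (c + x * g x) - (c + a * g a)
        ≈⟨ solve 5 (λ c x a g h → (c :+ x :* g) :- (c :+ a :* h) := (x :- a) :* h :+ x :* (g :- h)) _ c x a (g x) (g a) ⟩
      (x - a) * g a + x * (g x - g a)
        ≈⟨ +-congˡ (*-congˡ (quotient-correct a cs x)) ⟩
      (x - a) * g a + x * ((x - a) * evalₚ (quotient a cs) x)
        ≈⟨ solve 4 (λ x a h w → (x :- a) :* h :+ x :* ((x :- a) :* w) := (x :- a) :* (h :+ x :* w)) _ x a (g a) _ ⟩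
      (x - a) * (g a + x * evalₚ (quotient a cs) x) ∎
      where g = evalₚ cs

    head-zero : ∀ {c a w} → c + a * w ≈ 0# → w ≈ 0# → c ≈ 0#
    head-zero {c} {a} {w} eq w≈0 = begin
      c          ≈⟨ solve 2 (λ c a → c := c :+ a :* con (0 , 0)) _ c a ⟩
      c + a * 0# ≈⟨ +-congˡ (*-congˡ w≈0) ⟨
      c + a * w  ≈⟨ eq ⟩
      0#         ∎

    quotient-zero : ∀ {k} a (cs : Vec F (suc k)) → evalₚ cs a ≈ 0# →
      All (_≈ 0#) (quotient a cs) → All (_≈ 0#) cs
    quotient-zero a (c ∷ []) eq [] = head-zero eq refl ∷ []
    quotient-zero a (c ∷ cs@(_ ∷ _)) eq (eq′ ∷ rest) = head-zero eq eq′ ∷ quotient-zero a cs eq′ rest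

    distinct-roots⇒zero : ∀ {k} (cs : Vec F k) (xs : Fin k → F) →
      (∀ {i j} → xs i ≈ xs j → i ≡ j) → (∀ i → evalₚ cs (xs i) ≈ 0#) → All (_≈ 0#) cs
    distinct-roots⇒zero [] xs xs-inj roots = []
    distinct-roots⇒zero {suc k} cs@(_ ∷ _) xs xs-inj roots =
      quotient-zero a cs (roots Fin.zero)
        (distinct-roots⇒zero (quotient a cs) (xs ∘ Fin.suc) (Fin.suc-injective ∘ xs-inj) λ i →
          *-zero-cancelˡ (distinct i) (trans (sym (quotient-correct a cs (xs (Fin.suc i))))
            (trans (+-cong (roots (Fin.suc i)) (-‿cong (roots Fin.zero))) (-‿inverseʳ 0#))))
      where
      a = xs Fin.zero
      distinct : ∀ i → xs (Fin.suc i) - a ≉ 0#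
      distinct i eq with xs-inj (x∙y⁻¹≈ε⇒x≈y _ _ eq)
      ... | ()

  vanishing⇒zero : ∀ {k} → k ≤ n → (cs : Vec F k) → (∀ x → evalₚ cs x ≈ 0#) → All (_≈ 0#) cs
  vanishing⇒zero k≤n cs van = distinct-roots⇒zero cs (λ i → enum (Fin.inject≤ i k≤n))
    (λ eq → Fin.inject≤-injective k≤n k≤n _ _ (enum-injective eq)) (λ i → van _)

  monomial : ∀ k → Vec F (suc k)
  monomial zero    = 1# ∷ []
  monomial (suc k) = 0# ∷ monomial k

  eval-monomial : ∀ k x → evalₚ (monomial k) x ≈ x ^ k
  eval-monomial zero    x = solve 1 (λ x → con (1 , 0) :+ x :* con (0 , 0) := con (1 , 0)) _ x
  eval-monomial (suc k) x = trans (+-identityˡ _) (*-congˡ (eval-monomial k x))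

  monomial-nonzero : ∀ k → ¬ All (_≈ 0#) (monomial k)
  monomial-nonzero zero    (1≈0 ∷ []) = 1≉0 1≈0
  monomial-nonzero (suc k) (_ ∷ zs)   = monomial-nonzero k zs

  -- The polynomial x^(k+2) - x has k + 3 coefficients, hence fewer than n roots. This is used
  -- twice: to see that the Frobenius map of an extension is not the identity, and to find a g with
  -- g^b ≠ 1 when summing b-th powers.
  power≉id : ∀ k → 2 ℕ.+ suc k ≤ n → ¬ (∀ x → x * (x * x ^ k) ≈ x)
  power≉id k k<n eq = leading (vanishing⇒zero k<n (0# ∷ - 1# ∷ monomial k) van)
    where
    leading : ¬ All (_≈ 0#) (0# ∷ - 1# ∷ monomial k)
    leading (_ ∷ _ ∷ zs) = monomial-nonzero k zs
    van : ∀ x → 0# + x * (- 1# + x * evalₚ (monomial k) x) ≈ 0#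
    van x = begin
      0# + x * (- 1# + x * evalₚ (monomial k) x) ≈⟨ +-congˡ (*-congˡ (+-congˡ (*-congˡ (eval-monomial k x)))) ⟩
      0# + x * (- 1# + x * x ^ k)
        ≈⟨ solve 2 (λ x w → con (0 , 0) :+ x :* (:- con (1 , 0) :+ x :* w) := x :* (x :* w) :- x) _ x (x ^ k) ⟩
      x * (x * x ^ k) - x ≈⟨ +-congʳ (eq x) ⟩
      x - x ≈⟨ -‿inverseʳ x ⟩
      0# ∎

  -- An arbitrary commutative monoid serves both uses: products in the field for `fermat`, and sums
  -- with values in an extension field for the power sums.
  module Sum (M : CommutativeMonoid 0ℓ 0ℓ) where
    private module M = CommutativeMonoid M
    open Algebra.Properties.CommutativeMonoid.Sum M
    open Algebra.Properties.Monoid.Mult M.monoid using () renaming (_×_ to _⋅_)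

    opaque
      ∑ : (F → M.Carrier) → M.Carrier
      ∑ f = sum (f ∘ enum)

      ∑-cong : ∀ {f g} → (∀ x → f x M.≈ g x) → ∑ f M.≈ ∑ g
      ∑-cong eq = sum-cong-≋ (λ i → eq (enum i))

      ∑-+ : ∀ f g → ∑ (λ x → f x M.∙ g x) M.≈ ∑ f M.∙ ∑ g
      ∑-+ f g = ∑-distrib-+ (f ∘ enum) (g ∘ enum)

      ∑-const : ∀ c → ∑ (λ _ → c) M.≈ n ⋅ c
      ∑-const c = sum-replicate n

      ∑-reindex : ∀ {f} → (∀ {x y} → x ≈ y → f x M.≈ f y) →
        (g h : F → F) → (∀ {x y} → x ≈ y → g x ≈ g y) → (∀ {x y} → x ≈ y → h x ≈ h y) →
        (∀ x → g (h x) ≈ x) → (∀ x → h (g x) ≈ x) → ∑ (f ∘ g) M.≈ ∑ f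
      ∑-reindex {f} f-cong g h g-cong h-cong gh hg =
        M.trans (sum-cong-≋ (λ i → f-cong (sym (enum-to (g (enum i))))))
          (M.sym (sum-permute (f ∘ enum) π))
        where
        inverses : (g h : F → F) → (∀ {x y} → x ≈ y → g x ≈ g y) → (∀ x → g (h x) ≈ x) →
          ∀ i → card.to (g (enum (card.to (h (enum i))))) ≡ i
        inverses g h g-cong gh i =
          ≡.trans (card.cong (trans (g-cong (enum-to _)) (gh (enum i)))) (to-enum i)
        π : Permutation n n
        π = permutation (card.to ∘ g ∘ enum) (card.to ∘ h ∘ enum) (inverses g h g-cong gh) (inverses h g h-cong hg)

      -- If f is constantly c away from 0, its sum is f 0 + (n - 1) c; adding c avoids the subtraction.
      ∑-constant-off-zero : ∀ {f c} → (∀ {x y} → x ≈ y → f x M.≈ f y) → (∀ x → x ≉ 0# → f x M.≈ c) →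
        ∑ f M.∙ c M.≈ f 0# M.∙ n ⋅ c
      ∑-constant-off-zero {f} {c} f-cong f≈c =
        go (f ∘ enum) (card.to 0#) (f-cong (enum-to 0#)) λ i i≢ → f≈c (enum i) λ eq → i≢ (≡.trans (≡.sym (to-enum i)) (card.cong eq))
        where
        go : ∀ {m} (t : Fin m → M.Carrier) (i : Fin m) → t i M.≈ f 0# → (∀ j → ¬ j ≡ i → t j M.≈ c) →
          sum t M.∙ c M.≈ f 0# M.∙ m ⋅ c
        go {suc m} t i ti tj = M.trans (M.∙-congʳ (M.trans (sum-remove {i = i} t)
            (M.∙-cong ti (M.trans (sum-cong-≋ (λ j → tj _ (Fin.punchInᵢ≢i i j))) (sum-replicate m)))))
          (M.trans (M.assoc _ _ _) (M.∙-congˡ (M.comm _ _)))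

      ∑-preserves : ∀ {f} (P : M.Carrier → Set) → P M.ε → (∀ {x y} → P x → P y → P (x M.∙ y)) → (∀ x → P (f x)) → P (∑ f)
      ∑-preserves {f} P P-ε P-∙ Pf = go (f ∘ enum) (λ i → Pf (enum i))
        where
        go : ∀ {m} (t : Fin m → M.Carrier) → (∀ i → P (t i)) → P (sum t)
        go {zero}  t Pt = P-ε
        go {suc m} t Pt = P-∙ (Pt Fin.zero) (go (t ∘ Fin.suc) (Pt ∘ Fin.suc))

      ∑-homo : ∀ (φ : M.Carrier → M.Carrier) → φ M.ε M.≈ M.ε → (∀ x y → φ (x M.∙ y) M.≈ φ x M.∙ φ y) →
        ∀ f → ∑ (φ ∘ f) M.≈ φ (∑ f)
      ∑-homo φ φ-ε φ-∙ f = go (f ∘ enum)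
        where
        go : ∀ {m} (t : Fin m → M.Carrier) → sum (φ ∘ t) M.≈ φ (sum t)
        go {zero}  t = M.sym φ-ε
        go {suc m} t = M.trans (M.∙-congˡ (go (t ∘ Fin.suc))) (M.sym (φ-∙ _ _))


  module Prod = Sum *-commutativeMonoid

  private
    -- Replacing 0 by 1 lets the product of the nonzero elements run over all of `F`.
    unit : F → F
    unit x with x ≟ 0#
    ... | yes _ = 1#
    ... | no _  = x

    unit-nonzero : ∀ x → unit x ≉ 0#
    unit-nonzero x with x ≟ 0#
    ... | yes _  = 1≉0
    ... | no x≉0 = x≉0

    unit-cong : ∀ {x y} → x ≈ y → unit x ≈ unit y
    unit-cong {x} {y} x≈y with x ≟ 0# | y ≟ 0#
    ... | yes _   | yes _   = refl
    ... | yes x≈0 | no y≉0  = contradiction (trans (sym x≈y) x≈0) y≉0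
    ... | no x≉0  | yes y≈0 = contradiction (trans x≈y y≈0) x≉0
    ... | no _    | no _    = x≈y

  -- Multiplication by a permutes F; compare the products of the nonzero elements.
  fermat : ∀ a → a ^ n ≈ a
  fermat a with a ≟ 0#
  ... | yes a≈0 = zero-power n (card.to 0#)
    where
    zero-power : ∀ m → Fin m → a ^ m ≈ a
    zero-power (suc m) _ = trans (*-congʳ a≈0) (trans (zeroˡ _) (sym a≈0))
  ... | no a≉0 = begin
      a ^ n              ≈⟨ *-identityˡ _ ⟨
      1# * a ^ n         ≈⟨ *-congʳ scale-zero ⟨
      scale 0# * a ^ n   ≈⟨ Prod.∑-constant-off-zero scale-cong scale-off-zero ⟨
      Prod.∑ scale * a   ≈⟨ *-congʳ ∏scale≈1 ⟩
      1# * a             ≈⟨ *-identityˡ a ⟩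
      a                  ∎
    where
    scale : F → F
    scale x with x ≟ 0#
    ... | yes _ = 1#
    ... | no _  = a

    scale-zero : scale 0# ≈ 1#
    scale-zero with 0# ≟ 0#
    ... | yes _  = refl
    ... | no 0≉0 = contradiction refl 0≉0

    scale-off-zero : ∀ x → x ≉ 0# → scale x ≈ a
    scale-off-zero x x≉0 with x ≟ 0#
    ... | yes x≈0 = contradiction x≈0 x≉0
    ... | no _    = refl

    scale-cong : ∀ {x y} → x ≈ y → scale x ≈ scale y
    scale-cong {x} {y} x≈y with x ≟ 0# | y ≟ 0#
    ... | yes _   | yes _   = refl
    ... | yes x≈0 | no y≉0  = contradiction (trans (sym x≈y) x≈0) y≉0
    ... | no x≉0  | yes y≈0 = contradiction (trans x≈y y≈0) x≉0
    ... | no _    | no _    = refl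

    unit-scale : ∀ x → unit (a * x) ≈ scale x * unit x
    unit-scale x with x ≟ 0# | a * x ≟ 0#
    ... | yes _   | yes _    = sym (*-identityˡ 1#)
    ... | yes x≈0 | no ax≉0  = contradiction (trans (*-congˡ x≈0) (zeroʳ a)) ax≉0
    ... | no x≉0  | yes ax≈0 = contradiction ax≈0 (*-nonzero a≉0 x≉0)
    ... | no _    | no _     = refl

    ∏scale≈1 : Prod.∑ scale ≈ 1#
    ∏scale≈1 = *-cancelˡ-nonzero (Prod.∑-preserves (_≉ 0#) 1≉0 *-nonzero unit-nonzero) (begin
      Prod.∑ unit * Prod.∑ scale         ≈⟨ *-comm _ _ ⟩
      Prod.∑ scale * Prod.∑ unit         ≈⟨ Prod.∑-+ scale unit ⟨
      Prod.∑ (λ x → scale x * unit x)    ≈⟨ Prod.∑-cong unit-scale ⟨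
      Prod.∑ (λ x → unit (a * x))        ≈⟨ Prod.∑-reindex unit-cong (a *_) (inv a *_) *-congˡ *-congˡ
         (λ x → trans (sym (*-assoc a _ x)) (trans (*-congʳ (inv-right a≉0)) (*-identityˡ x)))
         (λ x → trans (sym (*-assoc _ a x)) (trans (*-congʳ (trans (*-comm _ a) (inv-right a≉0))) (*-identityˡ x))) ⟩
      Prod.∑ unit                        ≈⟨ *-identityʳ _ ⟨
      Prod.∑ unit * 1#                   ∎)

-- Generators of the quadric as graphs of alternating matrices

module Generators {n : ℕ} (𝔽 : FiniteField n) where
  open Field 𝔽
  open Integral R
  open Geometry R
  open Relation.Binary.Reasoning.Setoid setoid
  open Algebra.Properties.Group +-group using (x∙y⁻¹≈ε⇒x≈y)

  -- The maximal totally singular subspaces disjoint from X₀ = X₁ = X₂ = X₃ = 0 are the graphs of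
  -- alternating 4 × 4 matrices; (m , k) are the six entries of such a matrix.
  module Graph (m₁ m₂ m₃ k₁ k₂ k₃ : F) where
    row₇ row₆ row₅ row₄ : F → F → F → F → F
    row₇ a b c d = - (m₁ * b + m₂ * c + m₃ * d)
    row₆ a b c d = a * m₁ + (k₂ * d - k₃ * c)
    row₅ a b c d = a * m₂ + (k₃ * b - k₁ * d)
    row₄ a b c d = a * m₃ + (k₁ * c - k₂ * b)

    graph : F → F → F → F → V8
    graph a b c d = lookup (a ∷ b ∷ c ∷ d ∷ row₄ a b c d ∷ row₅ a b c d ∷ row₆ a b c d ∷ row₇ a b c d ∷ [])

    onGraph : V8 → Set
    onGraph v = (v (# 4) ≈ row₄ (v (# 0)) (v (# 1)) (v (# 2)) (v (# 3)))
              × (v (# 5) ≈ row₅ (v (# 0)) (v (# 1)) (v (# 2)) (v (# 3)))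
              × (v (# 6) ≈ row₆ (v (# 0)) (v (# 1)) (v (# 2)) (v (# 3)))
              × (v (# 7) ≈ row₇ (v (# 0)) (v (# 1)) (v (# 2)) (v (# 3)))

    private
      entry-cong : ∀ {a a′ b b′ c c′ m k l} → a ≈ a′ → b ≈ b′ → c ≈ c′ →
        a * m + (k * c - l * b) ≈ a′ * m + (k * c′ - l * b′)
      entry-cong a b c = +-cong (*-congʳ a) (+-cong (*-congˡ c) (-‿cong (*-congˡ b)))

      row₇-cong : ∀ {a a′ b b′ c c′ d d′} → b ≈ b′ → c ≈ c′ → d ≈ d′ → row₇ a b c d ≈ row₇ a′ b′ c′ d′
      row₇-cong b c d = -‿cong (+-cong (+-cong (*-congˡ b) (*-congˡ c)) (*-congˡ d))

      entry-+ : ∀ m k l a b c a′ b′ c′ →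
        (a * m + (k * c - l * b)) + (a′ * m + (k * c′ - l * b′)) ≈ (a + a′) * m + (k * (c + c′) - l * (b + b′))
      entry-+ = solve 9 (λ m k l a b c a′ b′ c′ →
        (a :* m :+ (k :* c :- l :* b)) :+ (a′ :* m :+ (k :* c′ :- l :* b′))
          := (a :+ a′) :* m :+ (k :* (c :+ c′) :- l :* (b :+ b′))) _

      row₇-+ : ∀ m₁ m₂ m₃ b c d b′ c′ d′ →
        - (m₁ * b + m₂ * c + m₃ * d) + - (m₁ * b′ + m₂ * c′ + m₃ * d′)
          ≈ - (m₁ * (b + b′) + m₂ * (c + c′) + m₃ * (d + d′))
      row₇-+ = solve 9 (λ m₁ m₂ m₃ b c d b′ c′ d′ →
        :- (m₁ :* b :+ m₂ :* c :+ m₃ :* d) :+ :- (m₁ :* b′ :+ m₂ :* c′ :+ m₃ :* d′)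
          := :- (m₁ :* (b :+ b′) :+ m₂ :* (c :+ c′) :+ m₃ :* (d :+ d′))) _

      entry-· : ∀ t m k l a b c → t * (a * m + (k * c - l * b)) ≈ (t * a) * m + (k * (t * c) - l * (t * b))
      entry-· = solve 7 (λ t m k l a b c → t :* (a :* m :+ (k :* c :- l :* b))
        := (t :* a) :* m :+ (k :* (t :* c) :- l :* (t :* b))) _

      row₇-· : ∀ t m₁ m₂ m₃ b c d →
        t * - (m₁ * b + m₂ * c + m₃ * d) ≈ - (m₁ * (t * b) + m₂ * (t * c) + m₃ * (t * d))
      row₇-· = solve 7 (λ t m₁ m₂ m₃ b c d → t :* :- (m₁ :* b :+ m₂ :* c :+ m₃ :* d)
        := :- (m₁ :* (t :* b) :+ m₂ :* (t :* c) :+ m₃ :* (t :* d))) _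

    W : Subspace
    W = record
      { mem = onGraph
      ; resp = λ {u} {v} u≈v (e₄ , e₅ , e₆ , e₇) →
          let 0≈ = u≈v (# 0) ; 1≈ = u≈v (# 1) ; 2≈ = u≈v (# 2) ; 3≈ = u≈v (# 3) in
          trans (sym (u≈v (# 4))) (trans e₄ (entry-cong 0≈ 1≈ 2≈)) ,
          trans (sym (u≈v (# 5))) (trans e₅ (entry-cong 0≈ 3≈ 1≈)) ,
          trans (sym (u≈v (# 6))) (trans e₆ (entry-cong 0≈ 2≈ 3≈)) ,
          trans (sym (u≈v (# 7))) (trans e₇ (row₇-cong {u (# 0)} {v (# 0)} 1≈ 2≈ 3≈))
      ; zero∈ = entry-0 m₃ k₁ k₂ , entry-0 m₂ k₃ k₁ , entry-0 m₁ k₂ k₃ ,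
          solve 3 (λ m₁ m₂ m₃ → con (0 , 0) := :- (m₁ :* con (0 , 0) :+ m₂ :* con (0 , 0) :+ m₃ :* con (0 , 0))) _ m₁ m₂ m₃
      ; +∈ = λ (e₄ , e₅ , e₆ , e₇) (e₄′ , e₅′ , e₆′ , e₇′) →
          trans (+-cong e₄ e₄′) (entry-+ m₃ k₁ k₂ _ _ _ _ _ _) , trans (+-cong e₅ e₅′) (entry-+ m₂ k₃ k₁ _ _ _ _ _ _) ,
          trans (+-cong e₆ e₆′) (entry-+ m₁ k₂ k₃ _ _ _ _ _ _) , trans (+-cong e₇ e₇′) (row₇-+ m₁ m₂ m₃ _ _ _ _ _ _)
      ; ·∈ = λ t (e₄ , e₅ , e₆ , e₇) →
          trans (*-congˡ e₄) (entry-· t m₃ k₁ k₂ _ _ _) , trans (*-congˡ e₅) (entry-· t m₂ k₃ k₁ _ _ _) ,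
          trans (*-congˡ e₆) (entry-· t m₁ k₂ k₃ _ _ _) , trans (*-congˡ e₇) (row₇-· t m₁ m₂ m₃ _ _ _)
      }
      where
      entry-0 : ∀ m k l → 0# ≈ 0# * m + (k * 0# - l * 0#)
      entry-0 = solve 3 (λ m k l → con (0 , 0) := con (0 , 0) :* m :+ (k :* con (0 , 0) :- l :* con (0 , 0))) _

    graph∈W : ∀ a b c d → mem W (graph a b c d)
    graph∈W a b c d = refl , refl , refl , refl

    private
      quadric-cong : ∀ {v₀ v₁ v₂ v₃ v₄ v₅ v₆ v₇ w₀ w₁ w₂ w₃ w₄ w₅ w₆ w₇} →
        v₀ ≈ w₀ → v₁ ≈ w₁ → v₂ ≈ w₂ → v₃ ≈ w₃ → v₄ ≈ w₄ → v₅ ≈ w₅ → v₆ ≈ w₆ → v₇ ≈ w₇ →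
        v₀ * v₇ + v₁ * v₆ + v₂ * v₅ + v₃ * v₄ ≈ w₀ * w₇ + w₁ * w₆ + w₂ * w₅ + w₃ * w₄
      quadric-cong e₀ e₁ e₂ e₃ e₄ e₅ e₆ e₇ =
        +-cong (+-cong (+-cong (*-cong e₀ e₇) (*-cong e₁ e₆)) (*-cong e₂ e₅)) (*-cong e₃ e₄)

    W-singular : TotallySingular W
    W-singular v (e₄ , e₅ , e₆ , e₇) = trans (quadric-cong refl refl refl refl e₄ e₅ e₆ e₇)
      (solve 10 (λ a b c d m₁ m₂ m₃ k₁ k₂ k₃ →
         a :* :- (m₁ :* b :+ m₂ :* c :+ m₃ :* d) :+ b :* (a :* m₁ :+ (k₂ :* d :- k₃ :* c))
           :+ c :* (a :* m₂ :+ (k₃ :* b :- k₁ :* d)) :+ d :* (a :* m₃ :+ (k₁ :* c :- k₂ :* b)) := con (0 , 0))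
         _ (v (# 0)) (v (# 1)) (v (# 2)) (v (# 3)) m₁ m₂ m₃ k₁ k₂ k₃)

    W-generator : Generator W
    W-generator = W-singular , maximal
      where
      -- u ∈ W′ minus the element of W over the same (X₀ , X₁ , X₂ , X₃) is orthogonal to all of W.
      maximal : ∀ W′ → TotallySingular W′ → W ⊆ W′ → W′ ⊆ W
      maximal W′ singular W⊆W′ u u∈W′ =
        equal (# 4) δ₄≈0 , equal (# 5) δ₅≈0 , equal (# 6) δ₆≈0 , equal (# 7) δ₇≈0
        where
        w δ : V8
        w = graph (u (# 0)) (u (# 1)) (u (# 2)) (u (# 3))
        δ = u +v ((- 1#) ·v w)

        δ∈W′ : mem W′ δ
        δ∈W′ = +∈ W′ {u} {(- 1#) ·v w} u∈W′ (·∈ W′ (- 1#) {w} (W⊆W′ w (graph∈W _ _ _ _)))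

        equal : ∀ i → δ i ≈ 0# → u i ≈ w i
        equal i δᵢ≈0 = x∙y⁻¹≈ε⇒x≈y (u i) (w i)
          (trans (solve 2 (λ x y → x :- y := x :+ :- con (1 , 0) :* y) _ (u i) (w i)) δᵢ≈0)

        orthogonal : ∀ a b c d → a * δ (# 7) + b * δ (# 6) + c * δ (# 5) + d * δ (# 4) ≈ 0#
        orthogonal a b c d = begin
          a * δ (# 7) + b * δ (# 6) + c * δ (# 5) + d * δ (# 4)
            ≈⟨ +-identityʳ _ ⟨
          a * δ (# 7) + b * δ (# 6) + c * δ (# 5) + d * δ (# 4) + 0#
            ≈⟨ +-congˡ (W-singular (graph a b c d) (graph∈W a b c d)) ⟨
          a * δ (# 7) + b * δ (# 6) + c * δ (# 5) + d * δ (# 4) + Qform (graph a b c d)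
            ≈⟨ solve 12 (λ a b c d e₄ e₅ e₆ e₇ r₄ r₅ r₆ r₇ →
                 a :* e₇ :+ b :* e₆ :+ c :* e₅ :+ d :* e₄ :+ (a :* r₇ :+ b :* r₆ :+ c :* r₅ :+ d :* r₄)
                   := a :* (e₇ :+ r₇) :+ b :* (e₆ :+ r₆) :+ c :* (e₅ :+ r₅) :+ d :* (e₄ :+ r₄))
                 _ a b c d (δ (# 4)) (δ (# 5)) (δ (# 6)) (δ (# 7)) (row₄ a b c d) (row₅ a b c d) (row₆ a b c d) (row₇ a b c d) ⟩
          a * (δ (# 7) + row₇ a b c d) + b * (δ (# 6) + row₆ a b c d)
            + c * (δ (# 5) + row₅ a b c d) + d * (δ (# 4) + row₄ a b c d)
            ≈⟨ quadric-cong (lead (u (# 0)) a) (lead (u (# 1)) b) (lead (u (# 2)) c) (lead (u (# 3)) d) refl refl refl refl ⟩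
          Qform (δ +v graph a b c d)
            ≈⟨ singular (δ +v graph a b c d) (+∈ W′ {δ} {graph a b c d} δ∈W′ (W⊆W′ (graph a b c d) (graph∈W a b c d))) ⟩
          0# ∎
          where
          lead : ∀ x y → y ≈ (x + (- 1#) * x) + y
          lead = solve 2 (λ x y → y := (x :+ :- con (1 , 0) :* x) :+ y) _

        pick : (a b c d : F) → ∀ {x} → x ≈ a * δ (# 7) + b * δ (# 6) + c * δ (# 5) + d * δ (# 4) → x ≈ 0#
        pick a b c d eq = trans eq (orthogonal a b c d)

        δ₇≈0 = pick 1# 0# 0# 0# (solve 4 (λ x y z w → x := con (1 , 0) :* x :+ con (0 , 0) :* y :+ con (0 , 0) :* z :+ con (0 , 0) :* w) _ (δ (# 7)) (δ (# 6)) (δ (# 5)) (δ (# 4)))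
        δ₆≈0 = pick 0# 1# 0# 0# (solve 4 (λ x y z w → y := con (0 , 0) :* x :+ con (1 , 0) :* y :+ con (0 , 0) :* z :+ con (0 , 0) :* w) _ (δ (# 7)) (δ (# 6)) (δ (# 5)) (δ (# 4)))
        δ₅≈0 = pick 0# 0# 1# 0# (solve 4 (λ x y z w → z := con (0 , 0) :* x :+ con (0 , 0) :* y :+ con (1 , 0) :* z :+ con (0 , 0) :* w) _ (δ (# 7)) (δ (# 6)) (δ (# 5)) (δ (# 4)))
        δ₄≈0 = pick 0# 0# 0# 1# (solve 4 (λ x y z w → w := con (0 , 0) :* x :+ con (0 , 0) :* y :+ con (0 , 0) :* z :+ con (1 , 0) :* w) _ (δ (# 7)) (δ (# 6)) (δ (# 5)) (δ (# 4)))

-- The ovoid condition as a condition on increments; even characteristic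

module Ovoid {n : ℕ} (𝔽 : FiniteField n)
  (f₁ f₂ f₃ : Geometry.Poly2 (FiniteField.ring 𝔽))
  (ovoid : Geometry.IsOvoid (FiniteField.ring 𝔽) (Geometry.O7 (FiniteField.ring 𝔽) f₁ f₂ f₃)) where
  open Field 𝔽
  open Integral R
  open Geometry R
  open Generators 𝔽
  open Relation.Binary.Reasoning.Setoid setoid
  open Poly2

  point : F → F → F → V8
  point x y z = O7 f₁ f₂ f₃ (inj₁ (x , y , z))

  -- Up to sign this is the polar form of `Qform` at the points over v and v + w, so it vanishes
  -- exactly when the two points are perpendicular.
  increment : F → F → F → F → F → F → F
  increment x y z a b c =
      a * (eval f₃ (x + a) (y + b) (z + c) - eval f₃ x y z)
    + b * (eval f₂ (x + a) (y + b) (z + c) - eval f₂ x y z)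
    + c * (eval f₁ (x + a) (y + b) (z + c) - eval f₁ x y z)

  private
    module _ (m₁ m₂ m₃ k₁ k₂ k₃ : F) where
      open Graph m₁ m₂ m₃ k₁ k₂ k₃
      -- In vector notation the hypotheses say f v = m + k × v. The last coordinate then agrees
      -- because v · (k × v) = 0.
      point∈W : ∀ x y z →
        eval f₃ x y z ≈ m₁ + (k₂ * z - k₃ * y) →
        eval f₂ x y z ≈ m₂ + (k₃ * x - k₁ * z) →
        eval f₁ x y z ≈ m₃ + (k₁ * y - k₂ * x) → mem W (point x y z)
      point∈W x y z e₃ e₂ e₁ = entry e₁ , entry e₂ , entry e₃ ,
        trans (+-cong (+-cong (-‿cong (*-congˡ e₁)) (-‿cong (*-congˡ e₂))) (-‿cong (*-congˡ e₃)))
          (solve 9 (λ x y z m₁ m₂ m₃ k₁ k₂ k₃ →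
            :- (z :* (m₃ :+ (k₁ :* y :- k₂ :* x))) :- y :* (m₂ :+ (k₃ :* x :- k₁ :* z)) :- x :* (m₁ :+ (k₂ :* z :- k₃ :* y))
              := :- (m₁ :* x :+ m₂ :* y :+ m₃ :* z)) _ x y z m₁ m₂ m₃ k₁ k₂ k₃)
        where
        entry : ∀ {w m r} → w ≈ m + r → w ≈ 1# * m + r
        entry eq = trans eq (+-congʳ (sym (*-identityˡ _)))

    Common : F → F → F → F → F → F → Set₁
    Common x y z x′ y′ z′ = Σ Subspace λ W → Generator W × mem W (point x y z) × mem W (point x′ y′ z′)

    -- Both points are multiples of the single ovoid point on `W`, and their leading coordinates are
    -- both 1, so the two factors coincide.
    common⇒equal : ∀ {x y z x′ y′ z′} → Common x y z x′ y′ z′ → x ≈ x′ × y ≈ y′ × z ≈ z′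
    common⇒equal {x} {y} {z} {x′} {y′} {z′} (W , gen , ∈W , ∈W′) with proj₂ ovoid W gen
    ... | i , _ , unique with unique (inj₁ (x , y , z)) ∈W | unique (inj₁ (x′ , y′ , z′)) ∈W′
    ... | s , s≉0 , es | t , t≉0 , et = coordinate (# 1) , coordinate (# 2) , coordinate (# 3)
      where
      s≈t : s ≈ t
      s≈t = begin
        s                                  ≈⟨ *-identityʳ s ⟨
        s * 1#                             ≈⟨ *-congˡ (et (# 0)) ⟩
        s * (t * O7 f₁ f₂ f₃ i (# 0))      ≈⟨ solve 3 (λ s t o → s :* (t :* o) := t :* (s :* o)) _ s t _ ⟩
        t * (s * O7 f₁ f₂ f₃ i (# 0))      ≈⟨ *-congˡ (es (# 0)) ⟨
        t * 1#                             ≈⟨ *-identityʳ t ⟩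
        t                                  ∎
      coordinate : ∀ j → point x y z j ≈ point x′ y′ z′ j
      coordinate j = trans (es j) (trans (*-congʳ s≈t) (sym (et j)))

    module _ {x y z a b c : F} where
      private
        g₁ g₂ g₃ h₁ h₂ h₃ : F
        g₁ = eval f₃ x y z
        g₂ = eval f₂ x y z
        g₃ = eval f₁ x y z
        h₁ = eval f₃ (x + a) (y + b) (z + c)
        h₂ = eval f₂ (x + a) (y + b) (z + c)
        h₃ = eval f₁ (x + a) (y + b) (z + c)

      -- Taking m = f v - k × v puts the point over v on the graph of (m , k); the hypotheses f (v +
      -- w) - f v = k × w then do the same for v + w.
      common : ∀ k₁ k₂ k₃ → h₁ - g₁ ≈ k₂ * c - k₃ * b → h₂ - g₂ ≈ k₃ * a - k₁ * c → h₃ - g₃ ≈ k₁ * b - k₂ * a →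
        Common x y z (x + a) (y + b) (z + c)
      common k₁ k₂ k₃ e₁ e₂ e₃ =
        Graph.W m₁ m₂ m₃ k₁ k₂ k₃ , Graph.W-generator m₁ m₂ m₃ k₁ k₂ k₃ ,
        point∈W m₁ m₂ m₃ k₁ k₂ k₃ x y z (at-start g₁ _) (at-start g₂ _) (at-start g₃ _) ,
        point∈W m₁ m₂ m₃ k₁ k₂ k₃ (x + a) (y + b) (z + c)
          (at-end k₂ z c k₃ y b e₁) (at-end k₃ x a k₁ z c e₂) (at-end k₁ y b k₂ x a e₃)
        where
        m₁ = g₁ - (k₂ * z - k₃ * y)
        m₂ = g₂ - (k₃ * x - k₁ * z)
        m₃ = g₃ - (k₁ * y - k₂ * x)
        at-start : ∀ g r → g ≈ (g - r) + r
        at-start = solve 2 (λ g r → g := (g :- r) :+ r) _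
        at-end : ∀ {g h} k z c l y b → h - g ≈ k * c - l * b → h ≈ (g - (k * z - l * y)) + (k * (z + c) - l * (y + b))
        at-end {g} {h} k z c l y b e = begin
          h             ≈⟨ solve 2 (λ g h → h := g :+ (h :- g)) _ g h ⟩
          g + (h - g)   ≈⟨ +-congˡ e ⟩
          g + (k * c - l * b)
            ≈⟨ solve 7 (λ g k z c l y b → g :+ (k :* c :- l :* b) := (g :- (k :* z :- l :* y)) :+ (k :* (z :+ c) :- l :* (y :+ b)))
                 _ g k z c l y b ⟩
          (g - (k * z - l * y)) + (k * (z + c) - l * (y + b)) ∎

  -- A zero increment along w puts the points over v and v + w on a common generator:
  -- solve k × w = f (v + w) - f v, which is possible because w is orthogonal to the right-hand side.
  increment-nonzero : ∀ x y z a b c → ¬ (a ≈ 0# × b ≈ 0# × c ≈ 0#) → increment x y z a b c ≉ 0#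
  increment-nonzero x y z a b c w≉0 inc≈0 = w≉0 (shift (proj₁ same) , shift (proj₁ (proj₂ same)) , shift (proj₂ (proj₂ same)))
    where
    shift : ∀ {x a} → x ≈ x + a → a ≈ 0#
    shift {x} {a} eq = trans (solve 2 (λ x a → a := (x :+ a) :- x) _ x a) (trans (+-congʳ (sym eq)) (-‿inverseʳ x))

    u₁ u₂ u₃ : F
    u₁ = eval f₃ (x + a) (y + b) (z + c) - eval f₃ x y z
    u₂ = eval f₂ (x + a) (y + b) (z + c) - eval f₂ x y z
    u₃ = eval f₁ (x + a) (y + b) (z + c) - eval f₁ x y z

    -- This solves k × (a , b , c) = (u , v , w). A solution may be changed by multiples of (a , b ,
    -- c), so for a ≠ 0 its first entry can be taken to be 0. The last two equations then determine
    -- k, and the orthogonality hypothesis yields the first.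
    cross : ∀ {a b c u v w} → a ≉ 0# → a * u + b * v + c * w ≈ 0# →
      (u ≈ - (inv a * w) * c - (inv a * v) * b) × (v ≈ (inv a * v) * a - 0# * c) × (w ≈ 0# * b - - (inv a * w) * a)
    cross {a} {b} {c} {u} {v} {w} a≉0 orth = first , second v c , third
      where
      i = inv a
      second : ∀ v c → v ≈ (i * v) * a - 0# * c
      second v c = begin
        v                     ≈⟨ *-identityˡ v ⟨
        1# * v                ≈⟨ *-congʳ (inv-right a≉0) ⟨
        (a * i) * v           ≈⟨ solve 4 (λ a i v c → (a :* i) :* v := (i :* v) :* a :- con (0 , 0) :* c) _ a i v c ⟩
        (i * v) * a - 0# * c  ∎
      third : w ≈ 0# * b - - (i * w) * a
      third = trans (second w b) (solve 4 (λ i w a b → (i :* w) :* a :- con (0 , 0) :* b := con (0 , 0) :* b :- :- (i :* w) :* a) _ i w a b)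
      first : u ≈ - (i * w) * c - (i * v) * b
      first = *-cancelˡ-nonzero a≉0 (begin
        a * u ≈⟨ solve 6 (λ a b c u v w → a :* u := (a :* u :+ b :* v :+ c :* w) :- (b :* v :+ c :* w)) _ a b c u v w ⟩
        (a * u + b * v + c * w) - (b * v + c * w) ≈⟨ +-congʳ orth ⟩
        0# - (b * v + c * w)
          ≈⟨ solve 4 (λ b c v w → con (0 , 0) :- (b :* v :+ c :* w) := con (1 , 0) :* (:- w :* c :- v :* b)) _ b c v w ⟩
        1# * (- w * c - v * b) ≈⟨ *-congʳ (inv-right a≉0) ⟨
        (a * i) * (- w * c - v * b)
          ≈⟨ solve 6 (λ a i b c v w → (a :* i) :* (:- w :* c :- v :* b) := a :* (:- (i :* w) :* c :- (i :* v) :* b)) _ a i b c v w ⟩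
        a * (- (i * w) * c - (i * v) * b) ∎)

    swap : ∀ {x y z} → x + y + z ≈ 0# → y + z + x ≈ 0#
    swap {x} {y} {z} eq = trans (solve 3 (λ x y z → y :+ z :+ x := x :+ y :+ z) _ x y z) eq

    equal : Dec (a ≈ 0#) → Dec (b ≈ 0#) → Dec (c ≈ 0#) → Common x y z (x + a) (y + b) (z + c)
    equal (no a≉0) _ _ = let (e₁ , e₂ , e₃) = cross {a} {b} {c} {u₁} {u₂} {u₃} a≉0 inc≈0 in
      common 0# (- (inv a * u₃)) (inv a * u₂) e₁ e₂ e₃
    equal (yes _) (no b≉0) _ = let (e₂ , e₃ , e₁) = cross {b} {c} {a} {u₂} {u₃} {u₁} b≉0 (swap inc≈0) in
      common (inv b * u₃) 0# (- (inv b * u₁)) e₁ e₂ e₃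
    equal (yes _) (yes _) (no c≉0) = let (e₃ , e₁ , e₂) = cross {c} {a} {b} {u₃} {u₁} {u₂} c≉0 (swap (swap inc≈0)) in
      common (- (inv c * u₂)) (inv c * u₁) 0# e₁ e₂ e₃
    equal (yes a≈0) (yes b≈0) (yes c≈0) = ⊥-elim (w≉0 (a≈0 , b≈0 , c≈0))

    same : x ≈ x + a × y ≈ y + b × z ≈ z + c
    same = common⇒equal (equal (a ≟ 0#) (b ≟ 0#) (c ≟ 0#))

  lin quad : Poly2 → F → F → F → F
  lin f x y z = cX f * x + cY f * y + cZ f * z
  quad f x y z = cXX f * (x * x) + cYY f * (y * y) + cZZ f * (z * z) + cXY f * (x * y) + cXZ f * (x * z) + cYZ f * (y * z)

  polar : Poly2 → F → F → F → F → F → F → F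
  polar f x y z a b c = cXX f * (x * a + x * a) + cYY f * (y * b + y * b) + cZZ f * (z * c + z * c)
    + cXY f * (x * b + a * y) + cXZ f * (x * c + a * z) + cYZ f * (y * c + b * z)

  self : F → F → F → F
  self a b c = a * (lin f₃ a b c + quad f₃ a b c) + b * (lin f₂ a b c + quad f₂ a b c) + c * (lin f₁ a b c + quad f₁ a b c)

  Λ : F → F → F → F → F → F → F
  Λ x y z a b c = a * polar f₃ x y z a b c + b * polar f₂ x y z a b c + c * polar f₁ x y z a b c

  private
    eval-shift : ∀ f t x y z a b c → eval f (t * x + a) (t * y + b) (t * z + c) - eval f (t * x) (t * y) (t * z)
      ≈ (lin f a b c + quad f a b c) + t * polar f x y z a b c
    eval-shift f t x y z a b c = solve 16 (λ cx cy cz cxx cyy czz cxy cxz cyz t x y z a b c →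
      let ev = λ x y z → cx :* x :+ cy :* y :+ cz :* z :+ cxx :* (x :* x) :+ cyy :* (y :* y) :+ czz :* (z :* z)
                 :+ cxy :* (x :* y) :+ cxz :* (x :* z) :+ cyz :* (y :* z) in
      ev (t :* x :+ a) (t :* y :+ b) (t :* z :+ c) :- ev (t :* x) (t :* y) (t :* z)
        := ((cx :* a :+ cy :* b :+ cz :* c)
             :+ (cxx :* (a :* a) :+ cyy :* (b :* b) :+ czz :* (c :* c) :+ cxy :* (a :* b) :+ cxz :* (a :* c) :+ cyz :* (b :* c)))
           :+ t :* (cxx :* (x :* a :+ x :* a) :+ cyy :* (y :* b :+ y :* b) :+ czz :* (z :* c :+ z :* c)
             :+ cxy :* (x :* b :+ a :* y) :+ cxz :* (x :* c :+ a :* z) :+ cyz :* (y :* c :+ b :* z)))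
      _ (cX f) (cY f) (cZ f) (cXX f) (cYY f) (cZZ f) (cXY f) (cXZ f) (cYZ f) t x y z a b c

    increment-affine : ∀ t x y z a b c → increment (t * x) (t * y) (t * z) a b c ≈ self a b c + t * Λ x y z a b c
    increment-affine t x y z a b c =
      trans (+-cong (+-cong (*-congˡ (eval-shift f₃ t x y z a b c)) (*-congˡ (eval-shift f₂ t x y z a b c))) (*-congˡ (eval-shift f₁ t x y z a b c)))
        (solve 10 (λ a b c s₃ s₂ s₁ t p₃ p₂ p₁ → a :* (s₃ :+ t :* p₃) :+ b :* (s₂ :+ t :* p₂) :+ c :* (s₁ :+ t :* p₁)
          := (a :* s₃ :+ b :* s₂ :+ c :* s₁) :+ t :* (a :* p₃ :+ b :* p₂ :+ c :* p₁)) _ a b c _ _ _ t _ _ _)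

  -- The increment along w is affine in v, so it can avoid 0 only if it does not depend on v.
  Λ≈0 : ∀ x y z a b c → ¬ (a ≈ 0# × b ≈ 0# × c ≈ 0#) → Λ x y z a b c ≈ 0#
  Λ≈0 x y z a b c w≉0 = decidable-stable (Λ x y z a b c ≟ 0#) λ Λ≉0 →
    let s = self a b c ; l = Λ x y z a b c ; t = - (s * inv l) in
    increment-nonzero (t * x) (t * y) (t * z) a b c w≉0 (begin
      increment (t * x) (t * y) (t * z) a b c ≈⟨ increment-affine t x y z a b c ⟩
      s + - (s * inv l) * l                   ≈⟨ solve 3 (λ s i l → s :+ :- (s :* i) :* l := s :- s :* (l :* i)) _ s (inv l) l ⟩
      s - s * (l * inv l)                     ≈⟨ +-congˡ (-‿cong (*-congˡ (inv-right Λ≉0))) ⟩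
      s - s * 1#                              ≈⟨ solve 1 (λ s → s :- s :* con (1 , 0) := con (0 , 0)) _ s ⟩
      0#                                      ∎)

  self-nonzero : ∀ a b c → ¬ (a ≈ 0# × b ≈ 0# × c ≈ 0#) → self a b c ≉ 0#
  self-nonzero a b c w≉0 eq = increment-nonzero (0# * 0#) (0# * 0#) (0# * 0#) a b c w≉0
    (trans (increment-affine 0# 0# 0# 0# a b c) (trans (+-cong eq (zeroˡ _)) (+-identityʳ 0#)))

  private
    value : ∀ (x y z a b c : F) → ¬ (a ≈ 0# × b ≈ 0# × c ≈ 0#) → ∀ {w} → Λ x y z a b c ≈ w → w ≈ 0#
    value x y z a b c w≉0 eq = trans (sym eq) (Λ≈0 x y z a b c w≉0)

    polarₚ : ∀ {m} (xx yy zz xy xz yz x y z a b c : Polynomial m) → Polynomial m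
    polarₚ xx yy zz xy xz yz x y z a b c = xx :* (x :* a :+ x :* a) :+ yy :* (y :* b :+ y :* b) :+ zz :* (z :* c :+ z :* c)
      :+ xy :* (x :* b :+ a :* y) :+ xz :* (x :* c :+ a :* z) :+ yz :* (y :* c :+ b :* z)

    𝟘 𝟙 : ∀ {m} → Polynomial m
    𝟘 = con (0 , 0)
    𝟙 = con (1 , 0)

    Λ₁ : ∀ x y z → Λ x y z 1# 0# 0# ≈ (cXX f₃ + cXX f₃) * x + cXY f₃ * y + cXZ f₃ * z
    Λ₁ x y z = trans (solve 3 (λ p q r → 𝟙 :* p :+ 𝟘 :* q :+ 𝟘 :* r := p) _ _ _ _)
      (solve 9 (λ xx yy zz xy xz yz x y z → polarₚ xx yy zz xy xz yz x y z 𝟙 𝟘 𝟘 := (xx :+ xx) :* x :+ xy :* y :+ xz :* z)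
        _ (cXX f₃) (cYY f₃) (cZZ f₃) (cXY f₃) (cXZ f₃) (cYZ f₃) x y z)

    Λ₂ : ∀ x y z → Λ x y z 0# 1# 0# ≈ (cYY f₂ + cYY f₂) * y + cXY f₂ * x + cYZ f₂ * z
    Λ₂ x y z = trans (solve 3 (λ p q r → 𝟘 :* p :+ 𝟙 :* q :+ 𝟘 :* r := q) _ _ _ _)
      (solve 9 (λ xx yy zz xy xz yz x y z → polarₚ xx yy zz xy xz yz x y z 𝟘 𝟙 𝟘 := (yy :+ yy) :* y :+ xy :* x :+ yz :* z)
        _ (cXX f₂) (cYY f₂) (cZZ f₂) (cXY f₂) (cXZ f₂) (cYZ f₂) x y z)

    Λ₃ : ∀ x y z → Λ x y z 0# 0# 1# ≈ (cZZ f₁ + cZZ f₁) * z + cXZ f₁ * x + cYZ f₁ * y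
    Λ₃ x y z = trans (solve 3 (λ p q r → 𝟘 :* p :+ 𝟘 :* q :+ 𝟙 :* r := r) _ _ _ _)
      (solve 9 (λ xx yy zz xy xz yz x y z → polarₚ xx yy zz xy xz yz x y z 𝟘 𝟘 𝟙 := (zz :+ zz) :* z :+ xz :* x :+ yz :* y)
        _ (cXX f₁) (cYY f₁) (cZZ f₁) (cXY f₁) (cXZ f₁) (cYZ f₁) x y z)

    Λ₁₂ : ∀ x y z → Λ x y z 1# 1# 0# ≈
      ((cXX f₃ + cXX f₃) * x + (cYY f₃ + cYY f₃) * y + cXY f₃ * (x + y) + (cXZ f₃ + cYZ f₃) * z)
      + ((cXX f₂ + cXX f₂) * x + (cYY f₂ + cYY f₂) * y + cXY f₂ * (x + y) + (cXZ f₂ + cYZ f₂) * z)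
    Λ₁₂ x y z = trans (solve 3 (λ p q r → 𝟙 :* p :+ 𝟙 :* q :+ 𝟘 :* r := p :+ q) _ _ _ _) (+-cong (go f₃) (go f₂))
      where
      go : ∀ f → polar f x y z 1# 1# 0# ≈ (cXX f + cXX f) * x + (cYY f + cYY f) * y + cXY f * (x + y) + (cXZ f + cYZ f) * z
      go f = solve 9 (λ xx yy zz xy xz yz x y z → polarₚ xx yy zz xy xz yz x y z 𝟙 𝟙 𝟘
          := (xx :+ xx) :* x :+ (yy :+ yy) :* y :+ xy :* (x :+ y) :+ (xz :+ yz) :* z)
        _ (cXX f) (cYY f) (cZZ f) (cXY f) (cXZ f) (cYZ f) x y z

    Λ₁₃ : ∀ x y z → Λ x y z 1# 0# 1# ≈
      ((cXX f₃ + cXX f₃) * x + (cZZ f₃ + cZZ f₃) * z + cXZ f₃ * (x + z) + (cXY f₃ + cYZ f₃) * y)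
      + ((cXX f₁ + cXX f₁) * x + (cZZ f₁ + cZZ f₁) * z + cXZ f₁ * (x + z) + (cXY f₁ + cYZ f₁) * y)
    Λ₁₃ x y z = trans (solve 3 (λ p q r → 𝟙 :* p :+ 𝟘 :* q :+ 𝟙 :* r := p :+ r) _ _ _ _) (+-cong (go f₃) (go f₁))
      where
      go : ∀ f → polar f x y z 1# 0# 1# ≈ (cXX f + cXX f) * x + (cZZ f + cZZ f) * z + cXZ f * (x + z) + (cXY f + cYZ f) * y
      go f = solve 9 (λ xx yy zz xy xz yz x y z → polarₚ xx yy zz xy xz yz x y z 𝟙 𝟘 𝟙
          := (xx :+ xx) :* x :+ (zz :+ zz) :* z :+ xz :* (x :+ z) :+ (xy :+ yz) :* y)
        _ (cXX f) (cYY f) (cZZ f) (cXY f) (cXZ f) (cYZ f) x y z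

    Λ₂₃ : Λ 1# 0# 0# 0# 1# 1# ≈ (cXY f₂ + cXZ f₂) + (cXY f₁ + cXZ f₁)
    Λ₂₃ = trans (solve 3 (λ p q r → 𝟘 :* p :+ 𝟙 :* q :+ 𝟙 :* r := q :+ r) _ _ _ _) (+-cong (go f₂) (go f₁))
      where
      go : ∀ f → polar f 1# 0# 0# 0# 1# 1# ≈ cXY f + cXZ f
      go f = solve 6 (λ xx yy zz xy xz yz → polarₚ xx yy zz xy xz yz 𝟙 𝟘 𝟘 𝟘 𝟙 𝟙 := xy :+ xz)
        _ (cXX f) (cYY f) (cZZ f) (cXY f) (cXZ f) (cYZ f)

    e₁≉0 : ∀ {b c} → ¬ (1# ≈ 0# × b ≈ 0# × c ≈ 0#)
    e₁≉0 (1≈0 , _) = 1≉0 1≈0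
    e₂≉0 : ∀ {a c} → ¬ (a ≈ 0# × 1# ≈ 0# × c ≈ 0#)
    e₂≉0 (_ , 1≈0 , _) = 1≉0 1≈0
    e₃≉0 : ∀ {a b} → ¬ (a ≈ 0# × b ≈ 0# × 1# ≈ 0#)
    e₃≉0 (_ , _ , 1≈0) = 1≉0 1≈0

    coord₁ : ∀ p q r → p * 1# + q * 0# + r * 0# ≈ p
    coord₁ = solve 3 (λ p q r → p :* 𝟙 :+ q :* 𝟘 :+ r :* 𝟘 := p) _
    coord₂ : ∀ p q r → p * 0# + q * 1# + r * 0# ≈ q
    coord₂ = solve 3 (λ p q r → p :* 𝟘 :+ q :* 𝟙 :+ r :* 𝟘 := q) _
    coord₃ : ∀ p q r → p * 0# + q * 0# + r * 1# ≈ r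
    coord₃ = solve 3 (λ p q r → p :* 𝟘 :+ q :* 𝟘 :+ r :* 𝟙 := r) _

  -- `Λ` is linear in v and quadratic in w, so unit vectors v with w = eᵢ or w = eᵢ + eⱼ read off
  -- its coefficients.
  XY₃≈0 : cXY f₃ ≈ 0#
  XY₃≈0 = value 0# 1# 0# 1# 0# 0# e₁≉0 (trans (Λ₁ _ _ _) (coord₂ _ _ _))
  XZ₃≈0 : cXZ f₃ ≈ 0#
  XZ₃≈0 = value 0# 0# 1# 1# 0# 0# e₁≉0 (trans (Λ₁ _ _ _) (coord₃ _ _ _))
  XY₂≈0 : cXY f₂ ≈ 0#
  XY₂≈0 = value 1# 0# 0# 0# 1# 0# e₂≉0 (trans (Λ₂ _ _ _) (coord₂ _ _ _))
  YZ₂≈0 : cYZ f₂ ≈ 0#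
  YZ₂≈0 = value 0# 0# 1# 0# 1# 0# e₂≉0 (trans (Λ₂ _ _ _) (coord₃ _ _ _))
  XZ₁≈0 : cXZ f₁ ≈ 0#
  XZ₁≈0 = value 1# 0# 0# 0# 0# 1# e₃≉0 (trans (Λ₃ _ _ _) (coord₂ _ _ _))
  YZ₁≈0 : cYZ f₁ ≈ 0#
  YZ₁≈0 = value 0# 1# 0# 0# 0# 1# e₃≉0 (trans (Λ₃ _ _ _) (coord₃ _ _ _))

  private
    mixed₀ : ∀ p q r s p′ q′ r′ s′ → (p * 0# + q * 0# + r * (0# + 0#) + s * 1#) + (p′ * 0# + q′ * 0# + r′ * (0# + 0#) + s′ * 1#) ≈ s + s′
    mixed₀ = solve 8 (λ p q r s p′ q′ r′ s′ → (p :* 𝟘 :+ q :* 𝟘 :+ r :* (𝟘 :+ 𝟘) :+ s :* 𝟙) :+ (p′ :* 𝟘 :+ q′ :* 𝟘 :+ r′ :* (𝟘 :+ 𝟘) :+ s′ :* 𝟙) := s :+ s′) _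
    mixed₁ : ∀ p q r s p′ q′ r′ s′ → (p * 0# + q * 1# + r * (0# + 1#) + s * 0#) + (p′ * 0# + q′ * 1# + r′ * (0# + 1#) + s′ * 0#) ≈ (q + r) + (q′ + r′)
    mixed₁ = solve 8 (λ p q r s p′ q′ r′ s′ → (p :* 𝟘 :+ q :* 𝟙 :+ r :* (𝟘 :+ 𝟙) :+ s :* 𝟘) :+ (p′ :* 𝟘 :+ q′ :* 𝟙 :+ r′ :* (𝟘 :+ 𝟙) :+ s′ :* 𝟘) := (q :+ r) :+ (q′ :+ r′)) _

    drop : ∀ {p q r s} → p ≈ 0# → s ≈ 0# → (p + q) + (r + s) ≈ q + r
    drop p s = +-cong (trans (+-congʳ p) (+-identityˡ _)) (trans (+-congˡ s) (+-identityʳ _))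

  YZ₃+XZ₂≈0 : cYZ f₃ + cXZ f₂ ≈ 0#
  YZ₃+XZ₂≈0 = trans (sym (drop XZ₃≈0 YZ₂≈0)) (value 0# 0# 1# 1# 1# 0# e₁≉0 (trans (Λ₁₂ _ _ _) (mixed₀ _ _ _ _ _ _ _ _)))
  YZ₃+XY₁≈0 : cYZ f₃ + cXY f₁ ≈ 0#
  YZ₃+XY₁≈0 = trans (sym (drop XY₃≈0 YZ₁≈0)) (value 0# 1# 0# 1# 0# 1# e₁≉0 (trans (Λ₁₃ _ _ _) (mixed₀ _ _ _ _ _ _ _ _)))
  XZ₂+XY₁≈0 : cXZ f₂ + cXY f₁ ≈ 0#
  XZ₂+XY₁≈0 = trans (sym (drop XY₂≈0 XZ₁≈0)) (value 1# 0# 0# 0# 1# 1# e₂≉0 Λ₂₃)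

  -- If 2 were invertible, every quadratic coefficient of `f₃` would vanish. Those of the squares
  -- occur doubled in `Λ`. The coefficient of YZ belongs to a triple p, q, r with all pairwise sums
  -- 0, and 2p = (p + q) + (p + r) - (q + r).
  even-characteristic : HasDegree2 f₃ → 1# + 1# ≈ 0#
  even-characteristic degree-2 = decidable-stable (1# + 1# ≟ 0#) λ 2≉0 →
    let
      halve : ∀ {x} → x + x ≈ 0# → x ≈ 0#
      halve {x} eq = *-zero-cancelˡ 2≉0 (trans (solve 1 (λ x → (𝟙 :+ 𝟙) :* x := x :+ x) _ x) eq)
      drop₂ : ∀ {p q r s} → (p + q) + (r + s) ≈ 0# → q ≈ 0# → r ≈ 0# → s ≈ 0# → p ≈ 0#
      drop₂ {p} {q} {r} {s} eq q≈0 r≈0 s≈0 = trans (solve 4 (λ p q r s → p := ((p :+ q) :+ (r :+ s)) :- q :- r :- s) _ p q r s)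
        (trans (+-cong (+-cong (+-cong eq (-‿cong q≈0)) (-‿cong r≈0)) (-‿cong s≈0)) (solve 0 (𝟘 :- 𝟘 :- 𝟘 :- 𝟘 := 𝟘) _))
    in degree-2
      ( halve (value 1# 0# 0# 1# 0# 0# e₁≉0 (trans (Λ₁ _ _ _) (coord₁ _ _ _)))
      , halve (drop₂ (value 0# 1# 0# 1# 1# 0# e₁≉0 (trans (Λ₁₂ _ _ _) (mixed₁ _ _ _ _ _ _ _ _))) XY₃≈0
          (value 0# 1# 0# 0# 1# 0# e₂≉0 (trans (Λ₂ _ _ _) (coord₁ _ _ _))) XY₂≈0)
      , halve (drop₂ (value 0# 0# 1# 1# 0# 1# e₁≉0 (trans (Λ₁₃ _ _ _) (mixed₁ _ _ _ _ _ _ _ _))) XZ₃≈0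
          (value 0# 0# 1# 0# 0# 1# e₃≉0 (trans (Λ₃ _ _ _) (coord₁ _ _ _))) XZ₁≈0)
      , XY₃≈0 , XZ₃≈0
      , halve (trans (solve 3 (λ p q r → p :+ p := (p :+ q) :+ (p :+ r) :- (q :+ r)) _ (cYZ f₃) (cXZ f₂) (cXY f₁))
          (trans (+-cong (+-cong YZ₃+XZ₂≈0 YZ₃+XY₁≈0) (-‿cong XZ₂+XY₁≈0)) (solve 0 (𝟘 :+ 𝟘 :- 𝟘 := 𝟘) _))))

-- The anisotropic cubic form of the ovoid in characteristic 2

-- Ternary cubic forms: d i j is the coefficient of wᵢ wⱼ², and m that of w₁ w₂ w₃.
record Cubic (F : Set) : Set where
  constructor cubic
  field
    d₁₁ d₁₂ d₁₃ d₂₁ d₂₂ d₂₃ d₃₁ d₃₂ d₃₃ m : F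

module CubicForm (R : CommutativeRing 0ℓ 0ℓ) where
  open CommutativeRing R
  open Cubic

  row : Carrier → Carrier → Carrier → Carrier → Carrier → Carrier → Carrier
  row d e f x y z = d * (x * x) + e * (y * y) + f * (z * z)

  ⟦_⟧ : Cubic Carrier → Carrier → Carrier → Carrier → Carrier
  ⟦ c ⟧ x y z = x * row (d₁₁ c) (d₁₂ c) (d₁₃ c) x y z + y * row (d₂₁ c) (d₂₂ c) (d₂₃ c) x y z
    + z * row (d₃₁ c) (d₃₂ c) (d₃₃ c) x y z + m c * (x * (y * z))

  Anisotropic : Cubic Carrier → Set
  Anisotropic c = ∀ x y z → ¬ (x ≈ 0# × y ≈ 0# × z ≈ 0#) → ¬ (⟦ c ⟧ x y z ≈ 0#)

module EvenOvoid {n : ℕ} (𝔽 : FiniteField n) (5≤n : 5 ≤ n)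
  (f₁ f₂ f₃ : Geometry.Poly2 (FiniteField.ring 𝔽))
  (degree-2 : Geometry.HasDegree2 (FiniteField.ring 𝔽) f₃)
  (ovoid : Geometry.IsOvoid (FiniteField.ring 𝔽) (Geometry.O7 (FiniteField.ring 𝔽) f₁ f₂ f₃)) where
  open Field 𝔽
  open Geometry R
  open CubicForm R
  open Ovoid 𝔽 f₁ f₂ f₃ ovoid
  open Poly2

  2≈0 : 1# + 1# ≈ 0#
  2≈0 = even-characteristic degree-2

  open CharTwo R 2≈0
  open Relation.Binary.Reasoning.Setoid setoid

  -- In characteristic 2 a term wᵢ wⱼ² contributes wⱼ² to the i-th partial derivative and nothing
  -- else, even for i = j where the factor 3 is 1. The gradient of this form is therefore the
  -- quadratic part of (f₃ , f₂ , f₁), given the relations between the mixed coefficients.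
  c : Cubic F
  c = record
    { d₁₁ = cXX f₃ ; d₁₂ = cYY f₃ ; d₁₃ = cZZ f₃
    ; d₂₁ = cXX f₂ ; d₂₂ = cYY f₂ ; d₂₃ = cZZ f₂
    ; d₃₁ = cXX f₁ ; d₃₂ = cYY f₁ ; d₃₃ = cZZ f₁ ; m = cYZ f₃ }

  row₃ row₂ row₁ : F → F → F → F
  row₃ = row (cXX f₃) (cYY f₃) (cZZ f₃)
  row₂ = row (cXX f₂) (cYY f₂) (cZZ f₂)
  row₁ = row (cXX f₁) (cYY f₁) (cZZ f₁)

  private
    equate : ∀ {x y} → x + y ≈ 0# → y ≈ x
    equate {x} {y} eq = trans (solve 2 (λ x y → y := (x :+ y) :+ x) _ x y) (trans (+-congʳ eq) (+-identityˡ x))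

  quad₃ : ∀ x y z → quad f₃ x y z ≈ row₃ x y z + cYZ f₃ * (y * z)
  quad₃ x y z = +-congʳ (trans (+-cong (trans (+-congˡ (trans (*-congʳ XY₃≈0) (zeroˡ _))) (+-identityʳ _))
    (trans (*-congʳ XZ₃≈0) (zeroˡ _))) (+-identityʳ _))

  quad₂ : ∀ x y z → quad f₂ x y z ≈ row₂ x y z + cYZ f₃ * (x * z)
  quad₂ x y z = trans (+-cong (+-cong (trans (+-congˡ (trans (*-congʳ XY₂≈0) (zeroˡ _))) (+-identityʳ _))
    (*-congʳ (equate YZ₃+XZ₂≈0))) (trans (*-congʳ YZ₂≈0) (zeroˡ _))) (+-identityʳ _)

  quad₁ : ∀ x y z → quad f₁ x y z ≈ row₁ x y z + cYZ f₃ * (x * y)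
  quad₁ x y z = trans (+-cong (trans (+-cong (+-congˡ (*-congʳ (equate YZ₃+XY₁≈0))) (trans (*-congʳ XZ₁≈0) (zeroˡ _)))
    (+-identityʳ _)) (trans (*-congʳ YZ₁≈0) (zeroˡ _))) (+-identityʳ _)

  -- The quadratic form v · L v of the linear part L of f; its vanishing is what makes L
  -- alternating.
  s : F → F → F → F
  s x y z = x * lin f₃ x y z + y * lin f₂ x y z + z * lin f₁ x y z

  self≈s+c : ∀ x y z → self x y z ≈ s x y z + ⟦ c ⟧ x y z
  self≈s+c x y z = trans
    (+-cong (+-cong (*-congˡ (+-congˡ (quad₃ x y z))) (*-congˡ (+-congˡ (quad₂ x y z)))) (*-congˡ (+-congˡ (quad₁ x y z))))
    (solve 10 (λ x y z l₃ l₂ l₁ r₃ r₂ r₁ m →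
        x :* (l₃ :+ (r₃ :+ m :* (y :* z))) :+ y :* (l₂ :+ (r₂ :+ m :* (x :* z))) :+ z :* (l₁ :+ (r₁ :+ m :* (x :* y)))
          := (x :* l₃ :+ y :* l₂ :+ z :* l₁) :+ (x :* r₃ :+ y :* r₂ :+ z :* r₁ :+ m :* (x :* (y :* z))))
      _ x y z (lin f₃ x y z) (lin f₂ x y z) (lin f₁ x y z) (row₃ x y z) (row₂ x y z) (row₁ x y z) (cYZ f₃))

  private
    lin-scale : ∀ f t x y z → lin f (t * x) (t * y) (t * z) ≈ t * lin f x y z
    lin-scale f t x y z = solve 7 (λ a b c t x y z → a :* (t :* x) :+ b :* (t :* y) :+ c :* (t :* z)
      := t :* (a :* x :+ b :* y :+ c :* z)) _ (cX f) (cY f) (cZ f) t x y z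

    row-scale : ∀ a b c t x y z → row a b c (t * x) (t * y) (t * z) ≈ t * t * row a b c x y z
    row-scale = solve 7 (λ a b c t x y z →
      a :* (t :* x :* (t :* x)) :+ b :* (t :* y :* (t :* y)) :+ c :* (t :* z :* (t :* z))
        := t :* t :* (a :* (x :* x) :+ b :* (y :* y) :+ c :* (z :* z))) _

    self-scale : ∀ t x y z → self (t * x) (t * y) (t * z) ≈ t * t * (s x y z + t * ⟦ c ⟧ x y z)
    self-scale t x y z = begin
      self (t * x) (t * y) (t * z) ≈⟨ self≈s+c (t * x) (t * y) (t * z) ⟩
      s (t * x) (t * y) (t * z) + ⟦ c ⟧ (t * x) (t * y) (t * z)
        ≈⟨ +-cong (+-cong (+-cong (*-congˡ (lin-scale f₃ t x y z)) (*-congˡ (lin-scale f₂ t x y z))) (*-congˡ (lin-scale f₁ t x y z)))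
             (+-congʳ (+-cong (+-cong (*-congˡ (row-scale _ _ _ t x y z)) (*-congˡ (row-scale _ _ _ t x y z))) (*-congˡ (row-scale _ _ _ t x y z)))) ⟩
      (t * x * (t * lin f₃ x y z) + t * y * (t * lin f₂ x y z) + t * z * (t * lin f₁ x y z))
        + (t * x * (t * t * row₃ x y z) + t * y * (t * t * row₂ x y z) + t * z * (t * t * row₁ x y z) + cYZ f₃ * (t * x * (t * y * (t * z))))
        ≈⟨ solve 11 (λ t x y z l₃ l₂ l₁ r₃ r₂ r₁ m →
             (t :* x :* (t :* l₃) :+ t :* y :* (t :* l₂) :+ t :* z :* (t :* l₁))
               :+ (t :* x :* (t :* t :* r₃) :+ t :* y :* (t :* t :* r₂) :+ t :* z :* (t :* t :* r₁) :+ m :* (t :* x :* (t :* y :* (t :* z))))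
             := t :* t :* ((x :* l₃ :+ y :* l₂ :+ z :* l₁) :+ t :* (x :* r₃ :+ y :* r₂ :+ z :* r₁ :+ m :* (x :* (y :* z)))))
             _ t x y z (lin f₃ x y z) (lin f₂ x y z) (lin f₁ x y z) (row₃ x y z) (row₂ x y z) (row₁ x y z) (cYZ f₃) ⟩
      t * t * (s x y z + t * ⟦ c ⟧ x y z) ∎

    -- On the multiple t w, `self` equals t² (s + t c). Since it never vanishes off 0, this shows
    -- that for each nonzero w exactly one of s and c is 0.
    s+tc≉0 : ∀ t x y z → t ≉ 0# → ¬ (x ≈ 0# × y ≈ 0# × z ≈ 0#) → s x y z + t * ⟦ c ⟧ x y z ≉ 0#
    s+tc≉0 t x y z t≉0 w≉0 eq = self-nonzero (t * x) (t * y) (t * z)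
      (λ (x≈0 , y≈0 , z≈0) → w≉0 (*-zero-cancelˡ t≉0 x≈0 , *-zero-cancelˡ t≉0 y≈0 , *-zero-cancelˡ t≉0 z≈0))
      (trans (self-scale t x y z) (trans (*-congˡ eq) (zeroʳ _)))

    c≈0⇒s≉0 : ∀ x y z → ¬ (x ≈ 0# × y ≈ 0# × z ≈ 0#) → ⟦ c ⟧ x y z ≈ 0# → s x y z ≉ 0#
    c≈0⇒s≉0 x y z w≉0 c≈0 s≈0 = s+tc≉0 1# x y z 1≉0 w≉0 (trans (+-cong s≈0 (trans (*-congˡ c≈0) (zeroʳ 1#))) (+-identityʳ 0#))

    c≉0⇒s≈0 : ∀ x y z → ⟦ c ⟧ x y z ≉ 0# → s x y z ≈ 0#
    c≉0⇒s≈0 x y z c≉0 = decidable-stable (s x y z ≟ 0#) λ s≉0 →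
      s+tc≉0 (s x y z * inv (⟦ c ⟧ x y z)) x y z (*-nonzero s≉0 (inv-nonzero c≉0)) w≉0 (begin
        s x y z + s x y z * inv (⟦ c ⟧ x y z) * ⟦ c ⟧ x y z
          ≈⟨ solve 3 (λ s i c → s :+ s :* i :* c := s :+ s :* (c :* i)) _ (s x y z) (inv (⟦ c ⟧ x y z)) (⟦ c ⟧ x y z) ⟩
        s x y z + s x y z * (⟦ c ⟧ x y z * inv (⟦ c ⟧ x y z)) ≈⟨ +-congˡ (*-congˡ (inv-right c≉0)) ⟩
        s x y z + s x y z * 1#   ≈⟨ solve 1 (λ s → s :+ s :* con true := con false) _ (s x y z) ⟩
        0# ∎)
      where
      w≉0 : ¬ (x ≈ 0# × y ≈ 0# × z ≈ 0#)
      w≉0 (x≈0 , y≈0 , z≈0) = c≉0 (trans (+-cong (+-cong (+-cong (vanish x≈0) (vanish y≈0)) (vanish z≈0)) (trans (*-congˡ (vanish x≈0)) (zeroʳ _)))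
          (solve 0 (con false :+ con false :+ con false :+ con false := con false) _))
        where
        vanish : ∀ {u v} → u ≈ 0# → u * v ≈ 0#
        vanish u≈0 = trans (*-congʳ u≈0) (zeroˡ _)

    s*c≈0 : ∀ x y z → s x y z * ⟦ c ⟧ x y z ≈ 0#
    s*c≈0 x y z = by-cases (⟦ c ⟧ x y z ≟ 0#)
      where
      by-cases : Dec (⟦ c ⟧ x y z ≈ 0#) → s x y z * ⟦ c ⟧ x y z ≈ 0#
      by-cases (yes c≈0) = trans (*-congˡ c≈0) (zeroʳ _)
      by-cases (no c≉0)  = trans (*-congʳ (c≉0⇒s≈0 x y z c≉0)) (zeroˡ _)

  -- On the line w + t w′ the product s c would be a nonzero polynomial of degree at most 4 in t.
  module Line (x y z x′ y′ z′ : F) where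
    s₁ c₁ c₂ : F
    s₁ = (x * lin f₃ x′ y′ z′ + y * lin f₂ x′ y′ z′ + z * lin f₁ x′ y′ z′) + (x′ * lin f₃ x y z + y′ * lin f₂ x y z + z′ * lin f₁ x y z)
    c₁ = (x′ * row₃ x y z + y′ * row₂ x y z + z′ * row₁ x y z) + cYZ f₃ * (x′ * (y * z) + x * (y′ * z) + x * (y * z′))
    c₂ = (x * row₃ x′ y′ z′ + y * row₂ x′ y′ z′ + z * row₁ x′ y′ z′) + cYZ f₃ * (x * (y′ * z′) + x′ * (y * z′) + x′ * (y′ * z))

    lin-line : ∀ f t → lin f (x + t * x′) (y + t * y′) (z + t * z′) ≈ lin f x y z + t * lin f x′ y′ z′
    lin-line f t = solve 10 (λ a b c t x y z x′ y′ z′ → a :* (x :+ t :* x′) :+ b :* (y :+ t :* y′) :+ c :* (z :+ t :* z′)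
      := (a :* x :+ b :* y :+ c :* z) :+ t :* (a :* x′ :+ b :* y′ :+ c :* z′)) _ (cX f) (cY f) (cZ f) t x y z x′ y′ z′

    row-line : ∀ a b c t → row a b c (x + t * x′) (y + t * y′) (z + t * z′) ≈ row a b c x y z + t * t * row a b c x′ y′ z′
    row-line a b c t = solve 10 (λ a b c t x y z x′ y′ z′ →
      a :* ((x :+ t :* x′) :* (x :+ t :* x′)) :+ b :* ((y :+ t :* y′) :* (y :+ t :* y′)) :+ c :* ((z :+ t :* z′) :* (z :+ t :* z′))
      := (a :* (x :* x) :+ b :* (y :* y) :+ c :* (z :* z)) :+ t :* t :* (a :* (x′ :* x′) :+ b :* (y′ :* y′) :+ c :* (z′ :* z′)))
      _ a b c t x y z x′ y′ z′

    s-line : ∀ t → s (x + t * x′) (y + t * y′) (z + t * z′) ≈ s x y z + t * s₁ + t * t * s x′ y′ z′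
    s-line t = trans (+-cong (+-cong (*-congˡ (lin-line f₃ t)) (*-congˡ (lin-line f₂ t))) (*-congˡ (lin-line f₁ t)))
      (solve 13 (λ t x y z x′ y′ z′ l m n l′ m′ n′ →
        (x :+ t :* x′) :* (l :+ t :* l′) :+ (y :+ t :* y′) :* (m :+ t :* m′) :+ (z :+ t :* z′) :* (n :+ t :* n′)
        := (x :* l :+ y :* m :+ z :* n) :+ t :* ((x :* l′ :+ y :* m′ :+ z :* n′) :+ (x′ :* l :+ y′ :* m :+ z′ :* n))
           :+ t :* t :* (x′ :* l′ :+ y′ :* m′ :+ z′ :* n′))
        _ t x y z x′ y′ z′ (lin f₃ x y z) (lin f₂ x y z) (lin f₁ x y z) (lin f₃ x′ y′ z′) (lin f₂ x′ y′ z′) (lin f₁ x′ y′ z′))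

    c-line : ∀ t → ⟦ c ⟧ (x + t * x′) (y + t * y′) (z + t * z′) ≈ ⟦ c ⟧ x y z + t * c₁ + t * t * c₂ + t * t * t * ⟦ c ⟧ x′ y′ z′
    c-line t = trans (+-congʳ (+-cong (+-cong (*-congˡ (row-line _ _ _ t)) (*-congˡ (row-line _ _ _ t))) (*-congˡ (row-line _ _ _ t))))
      (solve 14 (λ t x y z x′ y′ z′ l m n l′ m′ n′ d →
        (x :+ t :* x′) :* (l :+ t :* t :* l′) :+ (y :+ t :* y′) :* (m :+ t :* t :* m′) :+ (z :+ t :* z′) :* (n :+ t :* t :* n′)
          :+ d :* ((x :+ t :* x′) :* ((y :+ t :* y′) :* (z :+ t :* z′)))
        := (x :* l :+ y :* m :+ z :* n :+ d :* (x :* (y :* z)))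
           :+ t :* ((x′ :* l :+ y′ :* m :+ z′ :* n) :+ d :* (x′ :* (y :* z) :+ x :* (y′ :* z) :+ x :* (y :* z′)))
           :+ t :* t :* ((x :* l′ :+ y :* m′ :+ z :* n′) :+ d :* (x :* (y′ :* z′) :+ x′ :* (y :* z′) :+ x′ :* (y′ :* z)))
           :+ t :* t :* t :* (x′ :* l′ :+ y′ :* m′ :+ z′ :* n′ :+ d :* (x′ :* (y′ :* z′))))
        _ t x y z x′ y′ z′ (row₃ x y z) (row₂ x y z) (row₁ x y z) (row₃ x′ y′ z′) (row₂ x′ y′ z′) (row₁ x′ y′ z′) (cYZ f₃))

    impossible : ⟦ c ⟧ x y z ≈ 0# → s x y z ≉ 0# → ⟦ c ⟧ x′ y′ z′ ≉ 0# → ⊥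
    impossible c≈0 s≉0 c′≉0 = conclude (vanishing⇒zero 5≤n poly vanishes)
      where
      s₀ = s x y z
      c₃ = ⟦ c ⟧ x′ y′ z′
      poly : Vec F 5
      -- The product of s₀ + t s₁ and t c₁ + t² c₂ + t³ c₃: c has constant term 0 by assumption, and
      -- s has no t² term because s is 0 wherever c is not. As s₀ ≠ 0, its coefficients give c₁ = 0,
      -- c₂ = 0, c₃ = 0 in turn.
      poly = 0# ∷ s₀ * c₁ ∷ s₀ * c₂ + s₁ * c₁ ∷ s₀ * c₃ + s₁ * c₂ ∷ s₁ * c₃ ∷ []
      vanishes : ∀ t → evalₚ poly t ≈ 0#
      vanishes t = begin
        evalₚ poly t ≈⟨ solve 6 (λ t s₀ s₁ c₁ c₂ c₃ →
           con false :+ t :* (s₀ :* c₁ :+ t :* (s₀ :* c₂ :+ s₁ :* c₁ :+ t :* (s₀ :* c₃ :+ s₁ :* c₂ :+ t :* (s₁ :* c₃ :+ t :* con false))))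
           := (s₀ :+ t :* s₁ :+ t :* t :* con false) :* (con false :+ t :* c₁ :+ t :* t :* c₂ :+ t :* t :* t :* c₃)) _ t s₀ s₁ c₁ c₂ c₃ ⟩
        (s₀ + t * s₁ + t * t * 0#) * (0# + t * c₁ + t * t * c₂ + t * t * t * c₃)
          ≈⟨ *-cong (+-congˡ (*-congˡ (c≉0⇒s≈0 x′ y′ z′ c′≉0))) (+-congʳ (+-congʳ (+-congʳ c≈0))) ⟨
        (s₀ + t * s₁ + t * t * s x′ y′ z′) * (⟦ c ⟧ x y z + t * c₁ + t * t * c₂ + t * t * t * c₃)
          ≈⟨ *-cong (s-line t) (c-line t) ⟨
        s (x + t * x′) (y + t * y′) (z + t * z′) * ⟦ c ⟧ (x + t * x′) (y + t * y′) (z + t * z′)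
          ≈⟨ s*c≈0 _ _ _ ⟩
        0# ∎
      conclude : All (_≈ 0#) poly → ⊥
      conclude (_ ∷ z₁ ∷ z₂ ∷ z₃ ∷ _) = c′≉0 (first z₃ (first z₂ (*-zero-cancelˡ s≉0 z₁)))
        where
        first : ∀ {u v} → s₀ * u + s₁ * v ≈ 0# → v ≈ 0# → u ≈ 0#
        first {u} {v} eq v≈0 = *-zero-cancelˡ s≉0 (trans (sym (trans (+-congˡ (trans (*-congˡ v≈0) (zeroʳ _))) (+-identityʳ _))) eq)

  private
    binary : ∀ p q r u → (∀ t → p + q * t + r * (t * t) + u * (t * t * t) ≈ 0#) → p ≈ 0# × q ≈ 0# × r ≈ 0# × u ≈ 0#
    binary p q r u eq = unpack (vanishing⇒zero (ℕ.≤-trans (ℕ.n≤1+n 4) 5≤n) (p ∷ q ∷ r ∷ u ∷ [])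
        (λ t → trans (solve 5 (λ p q r u t → p :+ t :* (q :+ t :* (r :+ t :* (u :+ t :* con false)))
           := p :+ q :* t :+ r :* (t :* t) :+ u :* (t :* t :* t)) _ p q r u t) (eq t)))
      where
      unpack : All (_≈ 0#) (p ∷ q ∷ r ∷ u ∷ []) → p ≈ 0# × q ≈ 0# × r ≈ 0# × u ≈ 0#
      unpack (p ∷ q ∷ r ∷ u ∷ []) = p , q , r , u

    -- The restrictions to the coordinate lines determine every coefficient except `m`, and the
    -- value at (1 , 1 , 1) determines that one. If all were 0, `f₃` would have no quadratic part.
    c-not-identically-zero : ¬ (∀ x y z → ⟦ c ⟧ x y z ≈ 0#)
    c-not-identically-zero c≈0 = degree-2 (d₁₁≈0 , d₁₂≈0 , d₁₃≈0 , XY₃≈0 , XZ₃≈0 , m≈0)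
      where
      open Cubic c
      formₚ : ∀ {k} (a b c d e f g h i m x y z : Polynomial k) → Polynomial k
      formₚ a b c d e f g h i m x y z = x :* (a :* (x :* x) :+ b :* (y :* y) :+ c :* (z :* z)) :+ y :* (d :* (x :* x) :+ e :* (y :* y) :+ f :* (z :* z))
        :+ z :* (g :* (x :* x) :+ h :* (y :* y) :+ i :* (z :* z)) :+ m :* (x :* (y :* z))
      𝟘 𝟙 : ∀ {k} → Polynomial k
      𝟘 = con false
      𝟙 = con true
      xy = binary d₁₁ d₂₁ d₁₂ d₂₂ λ t → trans (solve 11 (λ a b c d e f g h i m t →
        a :+ d :* t :+ b :* (t :* t) :+ e :* (t :* t :* t) := formₚ a b c d e f g h i m 𝟙 t 𝟘) _ d₁₁ d₁₂ d₁₃ d₂₁ d₂₂ d₂₃ d₃₁ d₃₂ d₃₃ m t) (c≈0 1# t 0#)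
      xz = binary d₁₁ d₃₁ d₁₃ d₃₃ λ t → trans (solve 11 (λ a b c d e f g h i m t →
        a :+ g :* t :+ c :* (t :* t) :+ i :* (t :* t :* t) := formₚ a b c d e f g h i m 𝟙 𝟘 t) _ d₁₁ d₁₂ d₁₃ d₂₁ d₂₂ d₂₃ d₃₁ d₃₂ d₃₃ m t) (c≈0 1# 0# t)
      yz = binary d₂₂ d₃₂ d₂₃ d₃₃ λ t → trans (solve 11 (λ a b c d e f g h i m t →
        e :+ h :* t :+ f :* (t :* t) :+ i :* (t :* t :* t) := formₚ a b c d e f g h i m 𝟘 𝟙 t) _ d₁₁ d₁₂ d₁₃ d₂₁ d₂₂ d₂₃ d₃₁ d₃₂ d₃₃ m t) (c≈0 0# 1# t)
      d₁₁≈0 = proj₁ xy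
      d₁₂≈0 = proj₁ (proj₂ (proj₂ xy))
      d₁₃≈0 = proj₁ (proj₂ (proj₂ xz))
      m≈0 : m ≈ 0#
      m≈0 = begin
        m ≈⟨ solve 10 (λ a b c d e f g h i m → m := formₚ a b c d e f g h i m 𝟙 𝟙 𝟙 :+ ((a :+ b :+ c) :+ (d :+ e :+ f) :+ (g :+ h :+ i)))
               _ d₁₁ d₁₂ d₁₃ d₂₁ d₂₂ d₂₃ d₃₁ d₃₂ d₃₃ m ⟩
        ⟦ c ⟧ 1# 1# 1# + ((d₁₁ + d₁₂ + d₁₃) + (d₂₁ + d₂₂ + d₂₃) + (d₃₁ + d₃₂ + d₃₃))
          ≈⟨ +-cong (c≈0 1# 1# 1#) (+-cong (+-cong
               (+-cong (+-cong d₁₁≈0 d₁₂≈0) d₁₃≈0)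
               (+-cong (+-cong (proj₁ (proj₂ xy)) (proj₁ yz)) (proj₁ (proj₂ (proj₂ yz)))))
               (+-cong (+-cong (proj₁ (proj₂ xz)) (proj₁ (proj₂ yz))) (proj₂ (proj₂ (proj₂ yz))))) ⟩
        0# + ((0# + 0# + 0#) + (0# + 0# + 0#) + (0# + 0# + 0#))
          ≈⟨ solve 0 (𝟘 :+ ((𝟘 :+ 𝟘 :+ 𝟘) :+ (𝟘 :+ 𝟘 :+ 𝟘) :+ (𝟘 :+ 𝟘 :+ 𝟘)) := 𝟘) _ ⟩
        0# ∎

  -- A nontrivial zero of c has s ≠ 0; joining it by a line to any other point, `Line.impossible`
  -- shows that c vanishes there as well, hence everywhere.
  c-anisotropic : Anisotropic c
  c-anisotropic x y z w≉0 c≈0 = c-not-identically-zero λ x′ y′ z′ → decidable-stable (⟦ c ⟧ x′ y′ z′ ≟ 0#)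
    (Line.impossible x y z x′ y′ z′ c≈0 (c≈0⇒s≉0 x y z w≉0 c≈0))

  s≈0 : ∀ x y z → s x y z ≈ 0#
  s≈0 x y z = by-cases (x ≟ 0#) (y ≟ 0#) (z ≟ 0#)
    where
    nonzero : ¬ (x ≈ 0# × y ≈ 0# × z ≈ 0#) → s x y z ≈ 0#
    nonzero w≉0 = c≉0⇒s≈0 x y z (c-anisotropic x y z w≉0)
    by-cases : Dec (x ≈ 0#) → Dec (y ≈ 0#) → Dec (z ≈ 0#) → s x y z ≈ 0#
    by-cases (no x≉0) _ _ = nonzero λ (x≈0 , _) → x≉0 x≈0
    by-cases _ (no y≉0) _ = nonzero λ (_ , y≈0 , _) → y≉0 y≈0
    by-cases _ _ (no z≉0) = nonzero λ (_ , _ , z≈0) → z≉0 z≈0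
    by-cases (yes x≈0) (yes y≈0) (yes z≈0) = trans (+-cong (+-cong (*-congʳ x≈0) (*-congʳ y≈0)) (*-congʳ z≈0))
      (solve 3 (λ x y z → con false :* x :+ con false :* y :+ con false :* z := con false) _ _ _ _)

-- Adjoining a root of an irreducible cubic

Rootless : (R : CommutativeRing 0ℓ 0ℓ) → CommutativeRing.Carrier R → CommutativeRing.Carrier R → Set
Rootless R p r = ∀ x → ¬ (x * x * x + p * x + r ≈ 0#)
  where open CommutativeRing R

record CubicExtension {q : ℕ} (𝔽 : FiniteField q) (p r : CommutativeRing.Carrier (FiniteField.ring 𝔽)) : Set₁ where
  field
    𝕂   : FiniteField (q ℕ.^ 3)
    hom : Kantor.RingHom (FiniteField.ring 𝔽) (FiniteField.ring 𝕂)
  open Kantor.RingHom hom public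
  open CommutativeRing (FiniteField.ring 𝕂)
  field
    η      : Carrier
    η-root : η * η * η + ι p * η + ι r ≈ 0#
    span   : ∀ t → ∃ λ x → ∃ λ y → ∃ λ z → t ≈ ι x + ι y * η + ι z * (η * η)

module Adjunction {q : ℕ} (𝔽 : FiniteField q) where
  open Field 𝔽
  module _ (2≈0 : 1# + 1# ≈ 0#) (p r : F) (irreducible : ∀ x → x * x * x + p * x + r ≉ 0#) where
    open CharTwo R 2≈0
    open Relation.Binary.Reasoning.Setoid setoid

    private
      K : Set
      K = F × F × F

      +-group³ : AbelianGroup 0ℓ 0ℓ
      +-group³ = DirectProduct.abelianGroup +-abelianGroup (DirectProduct.abelianGroup +-abelianGroup +-abelianGroup)

      infixl 7 _⊗_
      infix 4 _≃_

      -- The product of a + b η + c η² and a′ + b′ η + c′ η², reduced by η³ = p η + r and η⁴ = p η²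
      -- + r η.
      _⊗_ : K → K → K
      (a , b , c) ⊗ (a′ , b′ , c′) =
        a * a′ + r * (b * c′ + c * b′) ,
        a * b′ + b * a′ + p * (b * c′ + c * b′) + r * (c * c′) ,
        a * c′ + b * b′ + c * a′ + p * (c * c′)

      one : K
      one = 1# , 0# , 0#

      _≃_ : K → K → Set
      _≃_ = AbelianGroup._≈_ +-group³

      open AbelianGroup +-group³ using () renaming (_∙_ to _⊕_)

      m₀ m₁ m₂ : ∀ {n} (p r a b c a′ b′ c′ : Polynomial n) → Polynomial n
      m₀ p r a b c a′ b′ c′ = a :* a′ :+ r :* (b :* c′ :+ c :* b′)
      m₁ p r a b c a′ b′ c′ = a :* b′ :+ b :* a′ :+ p :* (b :* c′ :+ c :* b′) :+ r :* (c :* c′)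
      m₂ p r a b c a′ b′ c′ = a :* c′ :+ b :* b′ :+ c :* a′ :+ p :* (c :* c′)

      Entry : Set
      Entry = ∀ {n} (p r a b c a′ b′ c′ : Polynomial n) → Polynomial n

      left right : Entry → ∀ {n} (p r a b c a′ b′ c′ a″ b″ c″ : Polynomial n) → Polynomial n
      left m p r a b c a′ b′ c′ = m p r (m₀ p r a b c a′ b′ c′) (m₁ p r a b c a′ b′ c′) (m₂ p r a b c a′ b′ c′)
      right m p r a b c a′ b′ c′ a″ b″ c″ =
        m p r a b c (m₀ p r a′ b′ c′ a″ b″ c″) (m₁ p r a′ b′ c′ a″ b″ c″) (m₂ p r a′ b′ c′ a″ b″ c″)

      ⊗-assoc : ∀ x y z → (x ⊗ y) ⊗ z ≃ x ⊗ (y ⊗ z)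
      ⊗-assoc (a , b , c) (a′ , b′ , c′) (a″ , b″ , c″) =
        solve 11 (λ p r a b c a′ b′ c′ a″ b″ c″ → left m₀ p r a b c a′ b′ c′ a″ b″ c″ := right m₀ p r a b c a′ b′ c′ a″ b″ c″) _ p r a b c a′ b′ c′ a″ b″ c″ ,
        solve 11 (λ p r a b c a′ b′ c′ a″ b″ c″ → left m₁ p r a b c a′ b′ c′ a″ b″ c″ := right m₁ p r a b c a′ b′ c′ a″ b″ c″) _ p r a b c a′ b′ c′ a″ b″ c″ ,
        solve 11 (λ p r a b c a′ b′ c′ a″ b″ c″ → left m₂ p r a b c a′ b′ c′ a″ b″ c″ := right m₂ p r a b c a′ b′ c′ a″ b″ c″) _ p r a b c a′ b′ c′ a″ b″ c″

      ⊗-comm : ∀ x y → x ⊗ y ≃ y ⊗ x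
      ⊗-comm (a , b , c) (a′ , b′ , c′) =
        solve 8 (λ p r a b c a′ b′ c′ → m₀ p r a b c a′ b′ c′ := m₀ p r a′ b′ c′ a b c) _ p r a b c a′ b′ c′ ,
        solve 8 (λ p r a b c a′ b′ c′ → m₁ p r a b c a′ b′ c′ := m₁ p r a′ b′ c′ a b c) _ p r a b c a′ b′ c′ ,
        solve 8 (λ p r a b c a′ b′ c′ → m₂ p r a b c a′ b′ c′ := m₂ p r a′ b′ c′ a b c) _ p r a b c a′ b′ c′

      ⊗-cong : ∀ {x y u v} → x ≃ y → u ≃ v → x ⊗ u ≃ y ⊗ v
      ⊗-cong (a , b , c) (a′ , b′ , c′) =
        +-cong (*-cong a a′) (*-congˡ (+-cong (*-cong b c′) (*-cong c b′))) ,
        +-cong (+-cong (+-cong (*-cong a b′) (*-cong b a′)) (*-congˡ (+-cong (*-cong b c′) (*-cong c b′)))) (*-congˡ (*-cong c c′)) ,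
        +-cong (+-cong (+-cong (*-cong a c′) (*-cong b b′)) (*-cong c a′)) (*-congˡ (*-cong c c′))

      ⊗-identityˡ : ∀ x → one ⊗ x ≃ x
      ⊗-identityˡ (a , b , c) =
        solve 5 (λ p r a b c → m₀ p r (con true) (con false) (con false) a b c := a) _ p r a b c ,
        solve 5 (λ p r a b c → m₁ p r (con true) (con false) (con false) a b c := b) _ p r a b c ,
        solve 5 (λ p r a b c → m₂ p r (con true) (con false) (con false) a b c := c) _ p r a b c

      ⊗-distribˡ : ∀ x y z → x ⊗ (y ⊕ z) ≃ (x ⊗ y) ⊕ (x ⊗ z)
      ⊗-distribˡ (a , b , c) (a′ , b′ , c′) (a″ , b″ , c″) =
        solve 11 (λ p r a b c a′ b′ c′ a″ b″ c″ → m₀ p r a b c (a′ :+ a″) (b′ :+ b″) (c′ :+ c″) := m₀ p r a b c a′ b′ c′ :+ m₀ p r a b c a″ b″ c″) _ p r a b c a′ b′ c′ a″ b″ c″ ,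
        solve 11 (λ p r a b c a′ b′ c′ a″ b″ c″ → m₁ p r a b c (a′ :+ a″) (b′ :+ b″) (c′ :+ c″) := m₁ p r a b c a′ b′ c′ :+ m₁ p r a b c a″ b″ c″) _ p r a b c a′ b′ c′ a″ b″ c″ ,
        solve 11 (λ p r a b c a′ b′ c′ a″ b″ c″ → m₂ p r a b c (a′ :+ a″) (b′ :+ b″) (c′ :+ c″) := m₂ p r a b c a′ b′ c′ :+ m₂ p r a b c a″ b″ c″) _ p r a b c a′ b′ c′ a″ b″ c″

      module G = AbelianGroup +-group³

      K-ring : CommutativeRing 0ℓ 0ℓ
      K-ring = record
        { Carrier = K ; _≈_ = _≃_ ; _+_ = _⊕_ ; _*_ = _⊗_ ; -_ = G._⁻¹ ; 0# = G.ε ; 1# = one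
        ; isCommutativeRing = record
          { isRing = record
            { +-isAbelianGroup = G.isAbelianGroup
            ; *-cong = λ {x} {y} {u} {v} → ⊗-cong {x} {y} {u} {v}
            ; *-assoc = ⊗-assoc
            ; *-identity = ⊗-identityˡ , λ x → G.trans (⊗-comm x one) (⊗-identityˡ x)
            ; distrib = ⊗-distribˡ , λ x y z → G.trans (⊗-comm (y ⊕ z) x) (G.trans (⊗-distribˡ x y z)
                (G.∙-cong (⊗-comm x y) (⊗-comm x z)))
            }
          ; *-comm = ⊗-comm
          }
        }

      module S = CommutativeRing K-ring

      Invertible : K → Set
      Invertible x = ∃ λ y → x ⊗ y ≃ one

      -- Invertibility passes to factors, so an element is inverted by multiplying it into one of
      -- lower degree in η: a quadratic into a linear one, a linear one into a nonzero constant.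
      invertible-factor : ∀ {x y} → Invertible (x ⊗ y) → Invertible x
      invertible-factor {x} {y} (z , eq) = y ⊗ z , S.trans (S.sym (⊗-assoc x y z)) eq

      invertible-cong : ∀ {x y} → x ≃ y → Invertible x → Invertible y
      invertible-cong x≃y (z , eq) = z , S.trans (S.*-congʳ (S.sym x≃y)) eq

      constant : ∀ {a} → a ≉ 0# → Invertible (a , 0# , 0#)
      constant {a} a≉0 = (inv a , 0# , 0#) ,
        (trans (solve 4 (λ p r a i → m₀ p r a (con false) (con false) i (con false) (con false) := a :* i) _ p r a (inv a)) (inv-right a≉0) ,
         solve 4 (λ p r a i → m₁ p r a (con false) (con false) i (con false) (con false) := con false) _ p r a (inv a) ,
         solve 4 (λ p r a i → m₂ p r a (con false) (con false) i (con false) (con false) := con false) _ p r a (inv a))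

      -- (s + η)(s² + p + s η + η²) = s³ + p s + r
      monic-linear : ∀ s → Invertible (s , 1# , 0#)
      monic-linear s = invertible-factor {s , 1# , 0#} {s * s + p , s , 1#} (invertible-cong
        (solve 3 (λ p r s → s :* s :* s :+ p :* s :+ r := m₀ p r s (con true) (con false) (s :* s :+ p) s (con true)) _ p r s ,
         solve 3 (λ p r s → con false := m₁ p r s (con true) (con false) (s :* s :+ p) s (con true)) _ p r s ,
         solve 3 (λ p r s → con false := m₂ p r s (con true) (con false) (s :* s :+ p) s (con true)) _ p r s)
        (constant (irreducible s)))

      scaled : ∀ {a b c d} → d ≉ 0# → Invertible (d * a , d * b , d * c) → Invertible (a , b , c)
      scaled {a} {b} {c} {d} d≉0 i = invertible-factor {a , b , c} {d , 0# , 0#} (invertible-cong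
        (solve 6 (λ p r a b c d → d :* a := m₀ p r a b c d (con false) (con false)) _ p r a b c d ,
         solve 6 (λ p r a b c d → d :* b := m₁ p r a b c d (con false) (con false)) _ p r a b c d ,
         solve 6 (λ p r a b c d → d :* c := m₂ p r a b c d (con false) (con false)) _ p r a b c d) i)

      linear : ∀ a b → ¬ (a ≈ 0# × b ≈ 0#) → Invertible (a , b , 0#)
      linear a b ≉0 = by-cases (b ≟ 0#)
        where
        by-cases : Dec (b ≈ 0#) → Invertible (a , b , 0#)
        by-cases (yes b≈0) = invertible-cong (refl , sym b≈0 , refl) (constant λ a≈0 → ≉0 (a≈0 , b≈0))
        by-cases (no b≉0) = scaled (inv-nonzero b≉0) (invertible-cong
          (refl , trans (sym (inv-right b≉0)) (*-comm b (inv b)) , sym (zeroʳ (inv b))) (monic-linear (inv b * a)))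

      -- (c + b η + η²)(b + η) is linear; were it 0, b would be a root of the cubic.
      monic-quadratic : ∀ c b → Invertible (c , b , 1#)
      monic-quadratic c b = invertible-factor {c , b , 1#} {b , 1# , 0#} (invertible-cong
        (solve 4 (λ p r b c → r :+ b :* c := m₀ p r c b (con true) b (con true) (con false)) _ p r b c ,
         solve 4 (λ p r b c → p :+ c :+ b :* b := m₁ p r c b (con true) b (con true) (con false)) _ p r b c ,
         solve 4 (λ p r b c → con false := m₂ p r c b (con true) b (con true) (con false)) _ p r b c)
        (linear (r + b * c) (p + c + b * b) λ (r+bc≈0 , p+c+b²≈0) → irreducible b (begin
          b * b * b + p * b + r
            ≈⟨ solve 4 (λ p r b c → b :* b :* b :+ p :* b :+ r := (p :+ c :+ b :* b) :* b :+ (r :+ b :* c)) _ p r b c ⟩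
          (p + c + b * b) * b + (r + b * c) ≈⟨ +-cong (*-congʳ p+c+b²≈0) r+bc≈0 ⟩
          0# * b + 0#                       ≈⟨ solve 1 (λ b → con false :* b :+ con false := con false) _ b ⟩
          0#                                ∎)))

      inverse-K : ∀ x → ¬ (x ≃ G.ε) → Invertible x
      inverse-K (a , b , c) ≉0 = by-cases (c ≟ 0#)
        where
        by-cases : Dec (c ≈ 0#) → Invertible (a , b , c)
        by-cases (yes c≈0) = invertible-cong (refl , refl , sym c≈0) (linear a b λ (a≈0 , b≈0) → ≉0 (a≈0 , b≈0 , c≈0))
        by-cases (no c≉0) = scaled (inv-nonzero c≉0) (invertible-cong
          (refl , refl , trans (sym (inv-right c≉0)) (*-comm c (inv c))) (monic-quadratic (inv c * a) (inv c * b)))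

      module card = Bijection card

      -- The power q ^ 3 unfolds to q * (q * (q * 1)), whence the trailing element of `Fin 1`.
      index : K → Fin (q ℕ.^ 3)
      index (a , b , c) = combine (card.to a) (combine (card.to b) (combine (card.to c) Fin.zero))

      index-injective : ∀ {x y} → index x ≡ index y → x ≃ y
      index-injective {a , b , c} {a′ , b′ , c′} eq =
        let eq₁ , eq′ = Fin.combine-injective (card.to a) _ (card.to a′) _ eq
            eq₂ , eq″ = Fin.combine-injective (card.to b) _ (card.to b′) _ eq′
            eq₃ , _   = Fin.combine-injective (card.to c) _ (card.to c′) _ eq″
        in card.injective eq₁ , card.injective eq₂ , card.injective eq₃

      index-cong : ∀ {x y} → x ≃ y → index x ≡ index y
      index-cong (a , b , c) = ≡.cong₂ combine (card.cong a)
        (≡.cong₂ combine (card.cong b) (≡.cong₂ combine (card.cong c) ≡.refl))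

      index-surjective : ∀ i → ∃ λ x → index x ≡ i
      index-surjective i =
        let i₁ , i′ , eq₁ = Fin.combine-surjective {q} {q ℕ.^ 2} i
            i₂ , i″ , eq₂ = Fin.combine-surjective {q} {q ℕ.^ 1} i′
            i₃ , i‴ , eq₃ = Fin.combine-surjective {q} {q ℕ.^ 0} i″
        in (enum i₁ , enum i₂ , enum i₃) ,
           ≡.trans (≡.cong₂ combine (to-enum i₁) (≡.trans (≡.cong₂ combine (to-enum i₂)
             (≡.trans (≡.cong₂ combine (to-enum i₃) (unique i‴)) eq₃)) eq₂)) eq₁
        where
        unique : (i : Fin 1) → Fin.zero ≡ i
        unique Fin.zero = ≡.refl

    opaque
      cubicExtension : CubicExtension 𝔽 p r
      cubicExtension = record
        { 𝕂 = record
          { ring = K-ring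
          ; 1≉0 = λ (1≈0 , _) → 1≉0 1≈0
          ; inverse = inverse-K
          ; card = record
            { to = index
            ; cong = index-cong
            ; bijective = index-injective , λ i → let x , eq = index-surjective i in x , λ z≃x → ≡.trans (index-cong z≃x) eq
            }
          }
        ; hom = record
          { ι = λ a → a , 0# , 0#
          ; ι-cong = λ eq → eq , refl , refl
          ; ι-+ = λ a b → refl , sym (+-identityˡ 0#) , sym (+-identityˡ 0#)
          ; ι-* = λ a b →
              solve 4 (λ p r a b → a :* b := m₀ p r a (con false) (con false) b (con false) (con false)) _ p r a b ,
              solve 4 (λ p r a b → con false := m₁ p r a (con false) (con false) b (con false) (con false)) _ p r a b ,
              solve 4 (λ p r a b → con false := m₂ p r a (con false) (con false) b (con false) (con false)) _ p r a b
          ; ι-1 = refl , refl , refl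
          }
        ; η = 0# , 1# , 0#
        ; η-root =
            solve 2 (λ p r → rootₚ m₀ p r p :+ r := con false) _ p r ,
            solve 2 (λ p r → rootₚ m₁ p r p :+ con false := con false) _ p r ,
            solve 2 (λ p r → rootₚ m₂ p r p :+ con false := con false) _ p r
        ; span = λ (a , b , c) → a , b , c ,
            solve 5 (λ p r a b c → a := spanₚ m₀ a p r b c) _ p r a b c ,
            solve 5 (λ p r a b c → b := spanₚ m₁ (con false) p r b c) _ p r a b c ,
            solve 5 (λ p r a b c → c := spanₚ m₂ (con false) p r b c) _ p r a b c
        }
        where
        𝟘 𝟙 : ∀ {n} → Polynomial n
        𝟘 = con false
        𝟙 = con true
        rootₚ : Entry → ∀ {n} (p r c : Polynomial n) → Polynomial n
        rootₚ m p r c = left m p r 𝟘 𝟙 𝟘 𝟘 𝟙 𝟘 𝟘 𝟙 𝟘 :+ m p r c 𝟘 𝟘 𝟘 𝟙 𝟘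
        spanₚ : Entry → ∀ {n} (x p r b c : Polynomial n) → Polynomial n
        spanₚ m x p r b c = x :+ m p r b 𝟘 𝟘 𝟘 𝟙 𝟘 :+ right m p r c 𝟘 𝟘 𝟘 𝟙 𝟘 𝟘 𝟙 𝟘

-- The Frobenius map and the conjugate roots

-- This is the size condition of `power≉id` for the exponent q = 2 + k in a field with q³ elements.
suc≤cube : ∀ k → 2 ℕ.+ suc k ≤ (2 ℕ.+ k) ℕ.^ 3
suc≤cube k = begin
  2 ℕ.+ suc k      ≡⟨ ≡.cong suc (ℕ.+-suc 1 k) ⟩
  1 ℕ.+ q          ≤⟨ ℕ.+-monoˡ-≤ q {1} {q} (s≤s z≤n) ⟩
  q ℕ.+ q          ≡⟨ ≡.cong (q ℕ.+_) (ℕ.+-identityʳ q) ⟨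
  2 ℕ.* q          ≤⟨ ℕ.*-monoˡ-≤ q {2} {q} (s≤s (s≤s z≤n)) ⟩
  q ℕ.* q          ≤⟨ ℕ.*-monoʳ-≤ q (ℕ.m≤m*n q (q ℕ.* 1)) ⟩
  q ℕ.* (q ℕ.* (q ℕ.* 1)) ∎
  where
  open ℕ.≤-Reasoning
  q = 2 ℕ.+ k

module Frobenius (R : CommutativeRing 0ℓ 0ℓ)
  (2≈0 : TwoIsZero R) where
  open CommutativeRing R hiding (zero)
  open CharTwo R 2≈0
  open Algebra.Properties.Semiring.Exp semiring using (_^_; ^-homo-*)
  open Relation.Binary.Reasoning.Setoid setoid

  frobenius-suc : ∀ k x → x ^ (2 ℕ.^ suc k) ≈ x ^ (2 ℕ.^ k) * x ^ (2 ℕ.^ k)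
  frobenius-suc k x = trans (reflexive (≡.cong (λ m → x ^ (2 ℕ.^ k ℕ.+ m)) (ℕ.+-identityʳ (2 ℕ.^ k))))
    (^-homo-* x (2 ℕ.^ k) (2 ℕ.^ k))

  frobenius-+ : ∀ k x y → (x + y) ^ (2 ℕ.^ k) ≈ x ^ (2 ℕ.^ k) + y ^ (2 ℕ.^ k)
  frobenius-+ zero x y = solve 2 (λ x y → (x :+ y) :* con true := x :* con true :+ y :* con true) _ x y
  frobenius-+ (suc k) x y = begin
    (x + y) ^ (2 ℕ.^ suc k)                  ≈⟨ frobenius-suc k (x + y) ⟩
    (x + y) ^ (2 ℕ.^ k) * (x + y) ^ (2 ℕ.^ k) ≈⟨ *-cong (frobenius-+ k x y) (frobenius-+ k x y) ⟩
    (u + v) * (u + v)                        ≈⟨ solve 2 (λ u v → (u :+ v) :* (u :+ v) := u :* u :+ v :* v) _ u v ⟩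
    u * u + v * v                            ≈⟨ +-cong (frobenius-suc k x) (frobenius-suc k y) ⟨
    x ^ (2 ℕ.^ suc k) + y ^ (2 ℕ.^ suc k)    ∎
    where
    u = x ^ (2 ℕ.^ k)
    v = y ^ (2 ℕ.^ k)

module Conjugates {q : ℕ} (𝔽 : FiniteField q) (h : ℕ) (q≡2^h : q ≡ 2 ℕ.^ h) (2≤q : 2 ≤ q)
  (2≈0 : TwoIsZero (FiniteField.ring 𝔽))
  (p r : CommutativeRing.Carrier (FiniteField.ring 𝔽))
  (irreducible : Rootless (FiniteField.ring 𝔽) p r)
  (ext : CubicExtension 𝔽 p r) where
  module F = Field 𝔽
  open CubicExtension ext public
  open Field 𝕂 public renaming (F to K; R to RK)
  open F using (F)

  ι-0 : ι F.0# ≈ 0#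
  ι-0 = begin
    ι F.0#                        ≈⟨ +-identityʳ _ ⟨
    ι F.0# + 0#                   ≈⟨ +-congˡ (-‿inverseʳ (ι F.0#)) ⟨
    ι F.0# + (ι F.0# - ι F.0#)    ≈⟨ +-assoc _ _ _ ⟨
    (ι F.0# + ι F.0#) - ι F.0#    ≈⟨ +-congʳ (trans (sym (ι-+ F.0# F.0#)) (ι-cong (F.+-identityˡ F.0#))) ⟩
    ι F.0# - ι F.0#               ≈⟨ -‿inverseʳ _ ⟩
    0#                            ∎
    where open Relation.Binary.Reasoning.Setoid setoid

  2≈0-K : 1# + 1# ≈ 0#
  2≈0-K = trans (+-cong (sym ι-1) (sym ι-1)) (trans (sym (ι-+ _ _)) (trans (ι-cong 2≈0) ι-0))

  open CharTwo RK 2≈0-K public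
  open Frobenius RK 2≈0-K public
  open Relation.Binary.Reasoning.Setoid setoid

  ι-nonzero : ∀ {a} → a F.≉ F.0# → ι a ≉ 0#
  ι-nonzero {a} a≉0 ιa≈0 = 1≉0 (begin
    1#                  ≈⟨ ι-1 ⟨
    ι F.1#              ≈⟨ ι-cong (F.inv-right a≉0) ⟨
    ι (a F.* F.inv a)   ≈⟨ ι-* _ _ ⟩
    ι a * ι (F.inv a)   ≈⟨ *-congʳ ιa≈0 ⟩
    0# * ι (F.inv a)    ≈⟨ zeroˡ _ ⟩
    0#                  ∎)

  ι-zero : ∀ {a} → ι a ≈ 0# → a F.≈ F.0#
  ι-zero {a} ιa≈0 = decidable-stable (a F.≟ F.0#) λ a≉0 → ι-nonzero a≉0 ιa≈0

  +≈0⇒≈ : ∀ {x y} → x + y ≈ 0# → x ≈ y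
  +≈0⇒≈ {x} {y} eq = trans (solve 2 (λ x y → x := (x :+ y) :+ y) _ x y) (trans (+-congʳ eq) (+-identityˡ y))

  ≈⇒+≈0 : ∀ {x y} → x ≈ y → x + y ≈ 0#
  ≈⇒+≈0 {x} {y} eq = trans (+-congʳ eq) (x+x≈0 y)

  ι-injective : ∀ {a b} → ι a ≈ ι b → a F.≈ b
  ι-injective {a} {b} eq = F.trans (F₂.solve 2 (λ x y → x F₂.:= (x F₂.:+ y) F₂.:+ y) _ a b)
    (F.trans (F.+-congʳ (ι-zero (trans (ι-+ a b) (≈⇒+≈0 eq)))) (F.+-identityˡ b))
    where module F₂ = CharTwo F.R 2≈0

  ι-^ : ∀ a k → ι (a F.^ k) ≈ ι a ^ k
  ι-^ a zero    = ι-1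
  ι-^ a (suc k) = trans (ι-* _ _) (*-congˡ (ι-^ a k))

  σ : K → K
  σ t = t ^ q

  σ-cong : ∀ {s t} → s ≈ t → σ s ≈ σ t
  σ-cong = ^-congˡ q

  σ-+ : ∀ s t → σ (s + t) ≈ σ s + σ t
  σ-+ s t = ≡.subst (λ k → (s + t) ^ k ≈ s ^ k + t ^ k) (≡.sym q≡2^h) (frobenius-+ h s t)

  σ-* : ∀ s t → σ (s * t) ≈ σ s * σ t
  σ-* s t = ^-distrib-* s t q

  σ-ι : ∀ a → σ (ι a) ≈ ι a
  σ-ι a = trans (sym (ι-^ a q)) (ι-cong (F.fermat a))

  σ-zero : ∀ {t} → σ t ≈ 0# → t ≈ 0#
  σ-zero = ^-zero-root q

  σ-0 : σ 0# ≈ 0#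
  σ-0 = trans (σ-cong (sym ι-0)) (trans (σ-ι F.0#) ι-0)

  IsRoot : K → Set
  IsRoot t = t * t * t + ι p * t + ι r ≈ 0#

  IsRoot-cong : ∀ {s t} → s ≈ t → IsRoot s → IsRoot t
  IsRoot-cong s≈t root = trans (sym (+-congʳ (+-cong (*-cong (*-cong s≈t s≈t) s≈t) (*-congˡ s≈t)))) root

  σ-root : ∀ t → IsRoot t → IsRoot (σ t)
  σ-root t root = begin
    σ t * σ t * σ t + ι p * σ t + ι r
      ≈⟨ +-cong (+-cong (trans (σ-* _ _) (*-congʳ (σ-* t t))) (trans (σ-* _ _) (*-congʳ (σ-ι p)))) (σ-ι r) ⟨
    σ (t * t * t) + σ (ι p * t) + σ (ι r)  ≈⟨ trans (σ-+ _ _) (+-congʳ (σ-+ _ _)) ⟨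
    σ (t * t * t + ι p * t + ι r)          ≈⟨ σ-cong root ⟩
    σ 0#                                   ≈⟨ σ-0 ⟩
    0#                                     ∎

  ι-not-root : ∀ a → ¬ IsRoot (ι a)
  ι-not-root a root = irreducible a (ι-zero (begin
    ι (a F.* a F.* a F.+ p F.* a F.+ r)
      ≈⟨ trans (ι-+ _ _) (+-congʳ (trans (ι-+ _ _) (+-cong (trans (ι-* _ _) (*-congʳ (ι-* _ _))) (ι-* _ _)))) ⟩
    ι a * ι a * ι a + ι p * ι a + ι r ≈⟨ root ⟩
    0# ∎))

  -- The cubic has no square term, so its roots add up to 0 and the third is the sum of the first
  -- two. That it is also σ η₂ is shown in `σ-η₂`.
  η₁ η₂ η₃ : K
  η₁ = η
  η₂ = σ η
  η₃ = η₁ + η₂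

  private
    σ-coordinates : ∀ x y z → σ (ι x + ι y * η + ι z * (η * η)) ≈ ι x + ι y * η₂ + ι z * (η₂ * η₂)
    σ-coordinates x y z = trans (σ-+ _ _) (+-cong (trans (σ-+ _ _) (+-cong (σ-ι x) (trans (σ-* _ _) (*-congʳ (σ-ι y)))))
      (trans (σ-* _ _) (*-cong (σ-ι z) (σ-* η η))))

    exponent : ∀ {q} → 2 ≤ q → ∃ λ k → q ≡ 2 ℕ.+ k × 2 ℕ.+ suc k ≤ q ℕ.^ 3
    exponent {suc (suc k)} (s≤s (s≤s z≤n)) = k , ≡.refl , suc≤cube k

  -- Otherwise the Frobenius map would be the identity and t^q - t would have q³ roots.
  η₁≉η₂ : η₁ ≉ η₂
  η₁≉η₂ η₁≈η₂ with exponent 2≤q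
  ... | k , q≡2+k , 2+k<q³ = power≉id k 2+k<q³ λ t → ≡.subst (λ m → t ^ m ≈ t) q≡2+k (fixed t)
    where
    fixed : ∀ t → σ t ≈ t
    fixed t = let x , y , z , eq = span t in begin
      σ t                                  ≈⟨ σ-cong eq ⟩
      σ (ι x + ι y * η + ι z * (η * η))    ≈⟨ σ-coordinates x y z ⟩
      ι x + ι y * η₂ + ι z * (η₂ * η₂)     ≈⟨ +-cong (+-congˡ (*-congˡ η₁≈η₂)) (*-congˡ (*-cong η₁≈η₂ η₁≈η₂)) ⟨
      ι x + ι y * η + ι z * (η * η)        ≈⟨ eq ⟨
      t                                    ∎

  η₃≉0 : η₃ ≉ 0#
  η₃≉0 eq = η₁≉η₂ (+≈0⇒≈ eq)

  -- Subtract the equations of the roots η₁ and η₂ and divide by their difference, which is η₃.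
  e₂ : ι p ≈ η₁ * η₁ + η₁ * η₂ + η₂ * η₂
  e₂ = sym (+≈0⇒≈ (*-zero-cancelˡ η₃≉0 (begin
    (η₁ + η₂) * (η₁ * η₁ + η₁ * η₂ + η₂ * η₂ + ι p)
      ≈⟨ solve 4 (λ a b p r → (a :+ b) :* (a :* a :+ a :* b :+ b :* b :+ p)
           := (a :* a :* a :+ p :* a :+ r) :+ (b :* b :* b :+ p :* b :+ r)) _ η₁ η₂ (ι p) (ι r) ⟩
    (η₁ * η₁ * η₁ + ι p * η₁ + ι r) + (η₂ * η₂ * η₂ + ι p * η₂ + ι r) ≈⟨ +-cong η-root (σ-root η η-root) ⟩
    0# + 0# ≈⟨ +-identityˡ 0# ⟩
    0# ∎)))

  e₃ : ι r ≈ η₁ * η₂ * η₃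
  e₃ = +≈0⇒≈ (begin
    ι r + η₁ * η₂ * (η₁ + η₂)
      ≈⟨ solve 3 (λ a b r → r :+ a :* b :* (a :+ b) := a :* a :* a :+ (a :* a :+ a :* b :+ b :* b) :* a :+ r) _ η₁ η₂ (ι r) ⟩
    η₁ * η₁ * η₁ + (η₁ * η₁ + η₁ * η₂ + η₂ * η₂) * η₁ + ι r ≈⟨ +-congʳ (+-congˡ (*-congʳ e₂)) ⟨
    η₁ * η₁ * η₁ + ι p * η₁ + ι r                           ≈⟨ η-root ⟩
    0# ∎)

  factored : ∀ t → t * t * t + ι p * t + ι r ≈ (t + η₁) * (t + η₂) * (t + η₃)
  factored t = trans (+-cong (+-congˡ (*-congʳ e₂)) e₃)
    (solve 3 (λ t a b → t :* t :* t :+ (a :* a :+ a :* b :+ b :* b) :* t :+ a :* b :* (a :+ b)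
      := (t :+ a) :* (t :+ b) :* (t :+ (a :+ b))) _ t η₁ η₂)

  η₃-root : IsRoot η₃
  η₃-root = trans (factored η₃) (trans (*-congˡ (x+x≈0 η₃)) (zeroʳ _))

  private
    no-relation : ∀ y z → ι y + ι z * η₃ ≈ 0# → y F.≈ F.0# × z F.≈ F.0#
    no-relation y z relation = ι-zero ιy≈0 , z≈0
      where
      z≈0 : z F.≈ F.0#
      z≈0 = decidable-stable (z F.≟ F.0#) λ z≉0 → ι-not-root (F.inv z F.* y) (IsRoot-cong (sym (begin
        ι (F.inv z F.* y)           ≈⟨ ι-* _ _ ⟩
        ι (F.inv z) * ι y           ≈⟨ *-congˡ (+≈0⇒≈ relation) ⟩
        ι (F.inv z) * (ι z * η₃)    ≈⟨ solve 3 (λ i z e → i :* (z :* e) := z :* i :* e) _ (ι (F.inv z)) (ι z) η₃ ⟩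
        ι z * ι (F.inv z) * η₃      ≈⟨ *-congʳ (trans (sym (ι-* _ _)) (trans (ι-cong (F.inv-right z≉0)) ι-1)) ⟩
        1# * η₃                     ≈⟨ *-identityˡ η₃ ⟩
        η₃                          ∎)) η₃-root)
      ιy≈0 : ι y ≈ 0#
      ιy≈0 = trans (sym (+-identityʳ _)) (trans (+-congˡ (sym (trans (*-congʳ (trans (ι-cong z≈0) ι-0)) (zeroˡ _)))) relation)

    -- The difference of t and σ t is η₃ (y + z η₃). As η₃ is a root of the cubic it lies outside
    -- the base field, so the second factor vanishes only for y = z = 0.
    fixed-coordinates : ∀ x y z → σ (ι x + ι y * η + ι z * (η * η)) ≈ ι x + ι y * η + ι z * (η * η) → y F.≈ F.0# × z F.≈ F.0#
    fixed-coordinates x y z σt≈t = no-relation y z (*-zero-cancelˡ η₃≉0 (begin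
      (η₁ + η₂) * (ι y + ι z * (η₁ + η₂))
        ≈⟨ solve 5 (λ a b x y z → (a :+ b) :* (y :+ z :* (a :+ b))
             := (x :+ y :* a :+ z :* (a :* a)) :+ (x :+ y :* b :+ z :* (b :* b))) _ η₁ η₂ (ι x) (ι y) (ι z) ⟩
      (ι x + ι y * η₁ + ι z * (η₁ * η₁)) + (ι x + ι y * η₂ + ι z * (η₂ * η₂))
        ≈⟨ ≈⇒+≈0 (trans (sym σt≈t) (σ-coordinates x y z)) ⟩
      0# ∎))

    constant-term : ∀ x {y z} → y F.≈ F.0# → z F.≈ F.0# → ι x + ι y * η + ι z * (η * η) ≈ ι x
    constant-term x y≈0 z≈0 = trans (+-cong (+-congˡ (*-congʳ (trans (ι-cong y≈0) ι-0))) (*-congʳ (trans (ι-cong z≈0) ι-0)))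
      (solve 2 (λ x e → x :+ con false :* e :+ con false :* (e :* e) := x) _ (ι x) η)

  fixed⇒ι : ∀ t → σ t ≈ t → ∃ λ a → t ≈ ι a
  fixed⇒ι t σt≈t = go (span t)
    where
    go : (∃ λ x → ∃ λ y → ∃ λ z → t ≈ ι x + ι y * η + ι z * (η * η)) → ∃ λ a → t ≈ ι a
    go (x , y , z , eq) =
      let y≈0 , z≈0 = fixed-coordinates x y z (trans (σ-cong (sym eq)) (trans σt≈t eq))
      in x , trans eq (constant-term x y≈0 z≈0)

  independent : ∀ x y z → ι x + ι y * η + ι z * (η * η) ≈ 0# → x F.≈ F.0# × y F.≈ F.0# × z F.≈ F.0#
  independent x y z eq =
    let y≈0 , z≈0 = fixed-coordinates x y z (trans (σ-cong eq) (trans σ-0 (sym eq)))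
    in ι-zero (trans (sym (constant-term x y≈0 z≈0)) eq) , y≈0 , z≈0

  η₃-not-fixed : σ η₃ ≉ η₃
  η₃-not-fixed eq = let a , η₃≈ιa = fixed⇒ι η₃ eq in ι-not-root a (IsRoot-cong η₃≈ιa η₃-root)

  -- σ η₂ is one of the three roots. If it were η₁, then η₃ would be fixed by σ; if it were η₂, then
  -- σ η₃ would be 0.
  σ-η₂ : σ η₂ ≈ η₃
  σ-η₂ = +≈0⇒≈ (*-zero-cancelˡ (*-nonzero not-η₁ not-η₂) (trans (sym (factored (σ η₂))) (σ-root η₂ (σ-root η η-root))))
    where
    not-η₁ : σ η₂ + η₁ ≉ 0#
    not-η₁ eq = η₃-not-fixed (trans (σ-+ _ _) (trans (+-congˡ (+≈0⇒≈ eq)) (+-comm _ _)))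
    not-η₂ : σ η₂ + η₂ ≉ 0#
    not-η₂ eq = η₃≉0 (σ-zero (trans (σ-+ η₁ η₂) (trans (+-comm _ _) eq)))

  σ-η₃ : σ η₃ ≈ η₁
  σ-η₃ = trans (σ-+ _ _) (trans (+-congˡ σ-η₂) (solve 2 (λ a b → b :+ (a :+ b) := a) _ η₁ η₂))

  η₁≉0 : η₁ ≉ 0#
  η₁≉0 eq = ι-not-root F.0# (IsRoot-cong (trans eq (sym ι-0)) η-root)

  η₂≉0 : η₂ ≉ 0#
  η₂≉0 eq = η₁≉0 (σ-zero eq)

  -- m = η₁²η₂ + η₂²η₃ + η₃²η₁ is a root of the quadratic resolvent of the cubic, and it is fixed by σ.
  resolvent-root : ∃ λ m → m F.* m F.+ r F.* m F.+ p F.* p F.* p F.+ r F.* r F.≈ F.0#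
  resolvent-root = go (fixed⇒ι M σM≈M)
    where
    M = η₁ * η₁ * η₂ + η₂ * η₂ * η₃ + η₃ * η₃ * η₁
    σ-term : ∀ {s t s′ t′} → σ s ≈ s′ → σ t ≈ t′ → σ (s * s * t) ≈ s′ * s′ * t′
    σ-term s t = trans (σ-* _ _) (*-cong (trans (σ-* _ _) (*-cong s s)) t)
    σM≈M : σ M ≈ M
    σM≈M = trans (σ-+ _ _) (trans (+-cong (trans (σ-+ _ _) (+-cong (σ-term refl σ-η₂) (σ-term σ-η₂ σ-η₃))) (σ-term σ-η₃ refl))
      (solve 3 (λ a b c → a :+ b :+ c := c :+ a :+ b) _ _ _ _))
    go : (∃ λ m → M ≈ ι m) → ∃ λ m → m F.* m F.+ r F.* m F.+ p F.* p F.* p F.+ r F.* r F.≈ F.0#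
    go (m , M≈ιm) = m , ι-zero (begin
      ι (m F.* m F.+ r F.* m F.+ p F.* p F.* p F.+ r F.* r)
        ≈⟨ trans (ι-+ _ _) (+-cong (trans (ι-+ _ _) (+-cong (trans (ι-+ _ _) (+-cong (ι-* _ _) (ι-* _ _))) (trans (ι-* _ _) (*-congʳ (ι-* _ _))))) (ι-* _ _)) ⟩
      ι m * ι m + ι r * ι m + ι p * ι p * ι p + ι r * ι r
        ≈⟨ +-cong (+-cong (+-cong (*-cong M≈ιm M≈ιm) (*-cong (sym e₃) M≈ιm)) (*-cong (*-cong (sym e₂) (sym e₂)) (sym e₂))) (*-cong (sym e₃) (sym e₃)) ⟨
      M * M + η₁ * η₂ * η₃ * M + P * P * P + η₁ * η₂ * η₃ * (η₁ * η₂ * η₃)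
        ≈⟨ solve 2 (λ a b → let c = a :+ b ; M = a :* a :* b :+ b :* b :* c :+ c :* c :* a ; P = a :* a :+ a :* b :+ b :* b ; r = a :* b :* c in
             M :* M :+ r :* M :+ P :* P :* P :+ r :* r := con false) _ η₁ η₂ ⟩
      0# ∎)
      where P = η₁ * η₁ + η₁ * η₂ + η₂ * η₂

-- Sums over the field of polynomials and of fractions with one pole

module PowerSums {q : ℕ} (𝔽 : FiniteField q) (h : ℕ) (q≡2^h : q ≡ 2 ℕ.^ h) (2≤q : 2 ≤ q)
  (2≈0 : TwoIsZero (FiniteField.ring 𝔽))
  (p r : CommutativeRing.Carrier (FiniteField.ring 𝔽))
  (irreducible : Rootless (FiniteField.ring 𝔽) p r)
  (ext : CubicExtension 𝔽 p r) where
  open Conjugates 𝔽 h q≡2^h 2≤q 2≈0 p r irreducible ext public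
  open F using (F)
  open F.Sum +-commutativeMonoid public
  open Relation.Binary.Reasoning.Setoid setoid

  *-∑ : ∀ (c : K) (f : F → K) → ∑ (λ y → c * f y) ≈ c * ∑ f
  *-∑ c f = ∑-homo (c *_) (zeroʳ c) (distribˡ c) f

  ∑-+-≈ : ∀ {f g : F → K} {s t} → ∑ f ≈ s → ∑ g ≈ t → ∑ (λ y → f y + g y) ≈ s + t
  ∑-+-≈ {f} {g} f≈s g≈t = trans (∑-+ f g) (+-cong f≈s g≈t)

  *-∑-≈ : ∀ {f : F → K} {s} c → ∑ f ≈ s → ∑ (λ y → c * f y) ≈ c * s
  *-∑-≈ {f} c f≈s = trans (*-∑ c f) (*-congˡ f≈s)

  -- Translation by 1 permutes `F`, so the sums of y and of y + 1 coincide, and their difference is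
  -- the sum of ones.
  ∑1≈0 : ∑ (λ _ → 1#) ≈ 0#
  ∑1≈0 = begin
    ∑ (λ _ → 1#)                    ≈⟨ solve 2 (λ s t → t := (s :+ t) :+ s) _ (∑ ι) _ ⟩
    (∑ ι + ∑ (λ _ → 1#)) + ∑ ι      ≈⟨ +-congʳ (∑-+ ι (λ _ → 1#)) ⟨
    ∑ (λ y → ι y + 1#) + ∑ ι        ≈⟨ +-congʳ (∑-cong λ y → trans (ι-+ y F.1#) (+-congˡ ι-1)) ⟨
    ∑ (λ y → ι (y F.+ F.1#)) + ∑ ι  ≈⟨ +-congʳ (∑-reindex ι-cong (F._+ F.1#) (F._+ F.1#) F.+-congʳ F.+-congʳ involutive involutive) ⟩
    ∑ ι + ∑ ι                       ≈⟨ x+x≈0 _ ⟩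
    0#                              ∎
    where
    involutive : ∀ y → (y F.+ F.1#) F.+ F.1# F.≈ y
    involutive y = F.trans (F.+-assoc _ _ _) (F.trans (F.+-congˡ 2≈0) (F.+-identityʳ y))

  -- A sum S of b-th powers satisfies g^b S = S for all g ≠ 0.
  ∑-power : ∀ b → 2 ℕ.+ b ≤ q → ∑ (λ y → ι y ^ b) ≈ 0#
  ∑-power zero    _     = ∑1≈0
  ∑-power (suc b) b+2≤q = decidable-stable (S ≟ 0#) λ S≉0 → F.power≉id b b+2≤q λ g → identity S≉0 g (g F.≟ F.0#)
    where
    S = ∑ (λ y → ι y ^ suc b)
    module _ (S≉0 : S ≉ 0#) (g : F) where
      root-of-unity : g F.≉ F.0# → ι g ^ suc b ≈ 1#
      root-of-unity g≉0 = *-cancelˡ-nonzero S≉0 (begin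
        S * ι g ^ suc b                        ≈⟨ *-comm _ _ ⟩
        ι g ^ suc b * S                        ≈⟨ *-∑ _ _ ⟨
        ∑ (λ y → ι g ^ suc b * ι y ^ suc b)    ≈⟨ ∑-cong (λ y → trans (^-congˡ (suc b) (ι-* g y)) (^-distrib-* (ι g) (ι y) (suc b))) ⟨
        ∑ (λ y → ι (g F.* y) ^ suc b)          ≈⟨ ∑-reindex (λ eq → ^-congˡ (suc b) (ι-cong eq)) (g F.*_) (F.inv g F.*_) F.*-congˡ F.*-congˡ
          (λ x → F.trans (F.sym (F.*-assoc g _ x)) (F.trans (F.*-congʳ (F.inv-right g≉0)) (F.*-identityˡ x)))
          (λ x → F.trans (F.sym (F.*-assoc _ g x)) (F.trans (F.*-congʳ (F.trans (F.*-comm _ g) (F.inv-right g≉0))) (F.*-identityˡ x))) ⟩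
        S                                      ≈⟨ *-identityʳ S ⟨
        S * 1#                                 ∎)
      identity : Dec (g F.≈ F.0#) → g F.* (g F.* g F.^ b) F.≈ g
      identity (yes g≈0) = F.trans (F.*-congʳ g≈0) (F.trans (F.zeroˡ _) (F.sym g≈0))
      identity (no g≉0)  = F.trans (F.*-congˡ (ι-injective (trans (ι-^ g (suc b)) (trans (root-of-unity g≉0) (sym ι-1))))) (F.*-identityʳ g)

  -- Here b = q - 1, so the summand is 1 away from 0 and 0 at 0; adding the missing 1 completes the
  -- sum of q ones, which is 0.
  ∑-power-top : ∀ b → 1 ℕ.+ b ≡ q → ∑ (λ y → ι y ^ b) ≈ 1#
  ∑-power-top b 1+b≡q = +≈0⇒≈ (begin
    ∑ (λ y → ι y ^ b) + 1#           ≈⟨ ∑-constant-off-zero (λ eq → ^-congˡ b (ι-cong eq)) unit ⟩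
    ι F.0# ^ b + _                   ≈⟨ +-cong (trans (^-congˡ b ι-0) (zero-power b (≡.subst (2 ≤_) (≡.sym 1+b≡q) 2≤q))) (sym (∑-const 1#)) ⟩
    0# + ∑ (λ _ → 1#)                ≈⟨ trans (+-identityˡ _) ∑1≈0 ⟩
    0#                               ∎)
    where
    zero-power : ∀ b → 2 ≤ suc b → 0# ^ b ≈ 0#
    zero-power (suc b) _ = zeroˡ _
    zero-power zero (s≤s ())
    unit : ∀ y → y F.≉ F.0# → ι y ^ b ≈ 1#
    unit y y≉0 = *-cancelˡ-nonzero (ι-nonzero y≉0) (begin
      ι y ^ suc b   ≈⟨ ≡.subst (λ k → ι y ^ k ≈ ι y) (≡.sym 1+b≡q) (σ-ι y) ⟩
      ι y           ≈⟨ *-identityʳ _ ⟨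
      ι y * 1#      ∎)

  -- f behaves in power sums like a polynomial of degree at most d.
  Low : ℕ → (F → K) → Set
  Low d f = ∀ b → 2 ℕ.+ (b ℕ.+ d) ≤ q → ∑ (λ y → ι y ^ b * f y) ≈ 0#

  Low-cong : ∀ {d f g} → (∀ y → f y ≈ g y) → Low d f → Low d g
  Low-cong f≈g low b b≤ = trans (∑-cong (λ y → *-congˡ (sym (f≈g y)))) (low b b≤)

  Low-const : ∀ c → Low 0 (λ _ → c)
  Low-const c b b≤ = begin
    ∑ (λ y → ι y ^ b * c)   ≈⟨ ∑-cong (λ y → *-comm _ c) ⟩
    ∑ (λ y → c * ι y ^ b)   ≈⟨ *-∑ c _ ⟩
    c * ∑ (λ y → ι y ^ b)   ≈⟨ *-congˡ (∑-power b (≡.subst (λ k → 2 ℕ.+ k ≤ q) (ℕ.+-identityʳ b) b≤)) ⟩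
    c * 0#                  ≈⟨ zeroʳ c ⟩
    0#                      ∎

  ∑-linear : ∀ (c : K) b (f : F → K) → ∑ (λ y → ι y ^ b * ((ι y + c) * f y)) ≈ ∑ (λ y → ι y ^ suc b * f y) + c * ∑ (λ y → ι y ^ b * f y)
  ∑-linear c b f = begin
    ∑ (λ y → ι y ^ b * ((ι y + c) * f y))
      ≈⟨ ∑-cong (λ y → solve 4 (λ w x c f → w :* ((x :+ c) :* f) := x :* w :* f :+ c :* (w :* f)) _ (ι y ^ b) (ι y) c (f y)) ⟩
    ∑ (λ y → ι y ^ suc b * f y + c * (ι y ^ b * f y))      ≈⟨ ∑-+ _ _ ⟩
    ∑ (λ y → ι y ^ suc b * f y) + ∑ (λ y → c * (ι y ^ b * f y)) ≈⟨ +-congˡ (*-∑ c _) ⟩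
    ∑ (λ y → ι y ^ suc b * f y) + c * ∑ (λ y → ι y ^ b * f y)   ∎

  Low-linear : ∀ {d f} c → Low d f → Low (suc d) (λ y → (ι y + c) * f y)
  Low-linear {d} {f} c low b b≤ = begin
    _ ≈⟨ ∑-linear c b f ⟩
    ∑ (λ y → ι y ^ suc b * f y) + c * ∑ (λ y → ι y ^ b * f y)
      ≈⟨ +-cong (low (suc b) b≤′) (*-congˡ (low b (ℕ.≤-trans (ℕ.n≤1+n _) b≤′))) ⟩
    0# + c * 0#  ≈⟨ solve 1 (λ c → con false :+ c :* con false := con false) _ c ⟩
    0#           ∎
    where
    b≤′ : 2 ℕ.+ (suc b ℕ.+ d) ≤ q
    b≤′ = ≡.subst (λ k → 2 ℕ.+ k ≤ q) (ℕ.+-suc b d) b≤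

  Low-power : ∀ {d f} c k → Low d f → Low (k ℕ.+ d) (λ y → (ι y + c) ^ k * f y)
  Low-power c zero    low = Low-cong (λ y → sym (*-identityˡ _)) low
  Low-power c (suc k) low = Low-cong (λ y → sym (*-assoc _ _ _)) (Low-linear c (Low-power c k low))

  ∑-shifted-power-low : ∀ c k → 2 ℕ.+ k ≤ q → ∑ (λ y → (ι y + c) ^ k) ≈ 0#
  ∑-shifted-power-low c k k≤ = trans (∑-cong (λ y → solve 1 (λ w → w := con true :* (w :* con true)) _ _))
    (Low-power c k (Low-const 1#) 0 (≡.subst (λ j → 2 ℕ.+ j ≤ q) (≡.sym (ℕ.+-identityʳ k)) k≤))

  -- Replacing the factors y + c by y one at a time changes the sum by c times a sum of degree q -
  -- 2, which is 0.
  ∑-shifted-power-top : ∀ c k → 1 ℕ.+ k ≡ q → ∑ (λ y → (ι y + c) ^ k) ≈ 1#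
  ∑-shifted-power-top c k k≡ = trans (∑-cong (λ y → sym (*-identityˡ _))) (go 0 k k≡)
    where
    go : ∀ b k → 1 ℕ.+ (b ℕ.+ k) ≡ q → ∑ (λ y → ι y ^ b * (ι y + c) ^ k) ≈ 1#
    go b zero eq = trans (∑-cong (λ y → *-identityʳ _)) (∑-power-top b (≡.trans (≡.cong suc (≡.sym (ℕ.+-identityʳ b))) eq))
    go b (suc k) eq = begin
      _ ≈⟨ ∑-linear c b (λ y → (ι y + c) ^ k) ⟩
      _ ≈⟨ +-cong (go (suc b) k eq′) (*-congˡ (trans (∑-cong (λ y → *-congˡ (sym (*-identityʳ _))))
             (Low-power c k (Low-const 1#) b (ℕ.≤-reflexive (≡.trans (≡.cong (λ j → 2 ℕ.+ (b ℕ.+ j)) (ℕ.+-identityʳ k)) eq′))))) ⟩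
      1# + c * 0# ≈⟨ solve 1 (λ c → con true :+ c :* con false := con true) _ c ⟩
      1# ∎
      where
      eq′ : 1 ℕ.+ (suc b ℕ.+ k) ≡ q
      eq′ = ≡.trans (≡.cong suc (≡.sym (ℕ.+-suc b k))) eq

  inv-^ : ∀ {u} → u ≉ 0# → ∀ k → u ^ k * inv u ^ k ≈ 1#
  inv-^ {u} u≉0 k = trans (sym (^-distrib-* u (inv u) k)) (trans (^-congˡ k (inv-right u≉0)) (one-power k))
    where
    one-power : ∀ k → 1# ^ k ≈ 1#
    one-power zero    = refl
    one-power (suc k) = trans (*-identityˡ _) (one-power k)

  -- Power sums of 1 / (y + θ), from (y + θ)^q = (y + θ) + ν with ν = θ^q + θ.
  module Pole (θ θ′ : K) (σθ : σ θ ≈ θ′) (θ≉θ′ : θ ≉ θ′) (u≉0 : ∀ y → ι y + θ ≉ 0#) where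
    ν μ : K
    ν = θ + θ′
    μ = inv ν

    ν≉0 : ν ≉ 0#
    ν≉0 eq = θ≉θ′ (+≈0⇒≈ eq)

    u Z : F → K
    u y = ι y + θ
    Z y = inv (u y)

    u^q : ∀ y → u y ^ q ≈ u y + ν
    u^q y = trans (σ-+ _ _) (trans (+-cong (σ-ι y) σθ) (solve 3 (λ y t t′ → y :+ t′ := (y :+ t) :+ (t :+ t′)) _ (ι y) θ θ′))

    private
      -- Divide u^q = u + ν by u^(j+1). This gives a recursion on the order of the pole.
      step : ∀ y k j → k ℕ.+ suc j ≡ q → ν * Z y ^ suc j ≈ u y ^ k + Z y ^ j
      step y k j eq = begin
        ν * Z y ^ suc j
          ≈⟨ solve 4 (λ u v z w → v :* (z :* w) := (u :+ v) :* (z :* w) :+ (u :* z) :* w) _ (u y) ν (Z y) (Z y ^ j) ⟩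
        (u y + ν) * Z y ^ suc j + (u y * Z y) * Z y ^ j
          ≈⟨ +-cong (*-congʳ (sym (u^q y))) (trans (*-congʳ (inv-right (u≉0 y))) (*-identityˡ _)) ⟩
        u y ^ q * Z y ^ suc j + Z y ^ j
          ≈⟨ +-congʳ (*-congʳ (≡.subst (λ e → u y ^ e ≈ u y ^ k * u y ^ suc j) eq (^-homo-* (u y) k (suc j)))) ⟩
        u y ^ k * u y ^ suc j * Z y ^ suc j + Z y ^ j
          ≈⟨ +-congʳ (trans (*-assoc _ _ _) (trans (*-congˡ (inv-^ (u≉0 y) (suc j))) (*-identityʳ _))) ⟩
        u y ^ k + Z y ^ j ∎

      ν-cancel : ∀ {s w} → ν * s ≈ w → s ≈ μ * w
      ν-cancel {s} {w} eq = *-cancelˡ-nonzero ν≉0 (begin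
        ν * s        ≈⟨ eq ⟩
        w            ≈⟨ *-identityˡ w ⟨
        1# * w       ≈⟨ *-congʳ (inv-right ν≉0) ⟨
        ν * μ * w    ≈⟨ *-assoc _ _ _ ⟩
        ν * (μ * w)  ∎)

    -- Summing `step`, the polynomial term u^k contributes 1 when k = q - 1 and 0 for smaller k. So
    -- the first order starts the recursion at μ and each further order only adds a factor μ.
    ∑Z : ∀ j → suc j ≤ q → ∑ (λ y → Z y ^ suc j) ≈ μ ^ suc j
    ∑Z zero 1≤q = ν-cancel (begin
      ν * ∑ (λ y → Z y ^ 1)       ≈⟨ *-∑ ν _ ⟨
      ∑ (λ y → ν * Z y ^ 1)       ≈⟨ ∑-cong (λ y → step y k 0 (≡.trans (ℕ.+-comm k 1) 1+k≡q)) ⟩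
      ∑ (λ y → u y ^ k + 1#)      ≈⟨ ∑-+ _ _ ⟩
      ∑ (λ y → u y ^ k) + ∑ (λ _ → 1#) ≈⟨ +-cong (∑-shifted-power-top θ k 1+k≡q) ∑1≈0 ⟩
      1# + 0#                     ≈⟨ +-identityʳ 1# ⟩
      1#                          ∎)
      where
      k = q ℕ.∸ 1
      1+k≡q : 1 ℕ.+ k ≡ q
      1+k≡q = ℕ.m+[n∸m]≡n 1≤q
    ∑Z (suc j) 2+j≤q = ν-cancel (begin
      ν * ∑ (λ y → Z y ^ (2 ℕ.+ j))    ≈⟨ *-∑ ν _ ⟨
      ∑ (λ y → ν * Z y ^ (2 ℕ.+ j))    ≈⟨ ∑-cong (λ y → step y k (suc j) (≡.trans (ℕ.+-comm k (2 ℕ.+ j)) 2+j+k≡q)) ⟩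
      ∑ (λ y → u y ^ k + Z y ^ suc j)  ≈⟨ ∑-+ _ _ ⟩
      ∑ (λ y → u y ^ k) + ∑ (λ y → Z y ^ suc j)
        ≈⟨ +-cong (∑-shifted-power-low θ k (≡.subst (2 ℕ.+ k ≤_) 2+j+k≡q (s≤s (s≤s (ℕ.m≤n+m k j))))) (∑Z j (ℕ.<⇒≤ 2+j≤q)) ⟩
      0# + μ ^ suc j                   ≈⟨ +-identityˡ _ ⟩
      μ ^ suc j                        ∎)
      where
      k = q ℕ.∸ (2 ℕ.+ j)
      2+j+k≡q : 2 ℕ.+ j ℕ.+ k ≡ q
      2+j+k≡q = ℕ.m+[n∸m]≡n 2+j≤q

    -- The residue rule: since θ′ + θ = ν, the right side is the fraction yᵐ / (y + θ)ᵏ at y = θ′.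
    -- The induction writes one factor y as (y + θ) + θ.
    ∑yZ : ∀ m k → m < k → k ≤ q → ∑ (λ y → ι y ^ m * Z y ^ k) ≈ μ ^ k * θ′ ^ m
    ∑yZ zero (suc k) _ k≤q = trans (∑-cong (λ y → *-identityˡ _)) (trans (∑Z k k≤q) (sym (*-identityʳ _)))
    ∑yZ (suc m) (suc k) (s≤s m<k) k≤q = begin
      ∑ (λ y → ι y ^ suc m * Z y ^ suc k)
        ≈⟨ ∑-cong (λ y → trans (solve 5 (λ x w t z v → x :* w :* (z :* v) := w :* (((x :+ t) :* z) :* v) :+ t :* (w :* (z :* v)))
             _ (ι y) (ι y ^ m) θ (Z y) (Z y ^ k))
             (+-congʳ (*-congˡ (trans (*-congʳ (inv-right (u≉0 y))) (*-identityˡ _))))) ⟩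
      ∑ (λ y → ι y ^ m * Z y ^ k + θ * (ι y ^ m * Z y ^ suc k)) 
        ≈⟨ ∑-+-≈ (∑yZ m k m<k (ℕ.<⇒≤ k≤q)) (*-∑-≈ θ (∑yZ m (suc k) (ℕ.m≤n⇒m≤1+n m<k) k≤q)) ⟩
      μ ^ k * θ′ ^ m + θ * (μ ^ suc k * θ′ ^ m)
        ≈⟨ +-congʳ (*-congʳ (trans (sym (*-identityˡ _)) (*-congʳ (sym (inv-right ν≉0))))) ⟩
      ν * μ * μ ^ k * θ′ ^ m + θ * (μ ^ suc k * θ′ ^ m)
        ≈⟨ solve 5 (λ t t′ m w v → (t :+ t′) :* m :* w :* v :+ t :* (m :* w :* v) := (m :* w) :* (t′ :* v)) _ θ θ′ μ (μ ^ k) (θ′ ^ m) ⟩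
      μ ^ suc k * θ′ ^ suc m ∎

    private
      μ⁴ν⁴ : ν ^ 4 * μ ^ 4 ≈ 1#
      μ⁴ν⁴ = inv-^ ν≉0 4

      u⁴Z⁴ : ∀ y → u y ^ 4 * Z y ^ 4 ≈ 1#
      u⁴Z⁴ y = inv-^ (u≉0 y) 4

    module Weighted (θ″ : K) (m : ℕ) (m≤2 : m ≤ 2) (16≤q : 16 ≤ q) where
      ν″ : K
      ν″ = θ + θ″

      -- E⁴ without its leading coefficient. The exponent 4 is a power of 2, so each factor is u⁴
      -- plus a constant.
      weight : F → K
      weight y = u y ^ 4 * ((ι y + θ′) ^ 4 * (ι y + θ″) ^ 4)

      private
        fourth : ∀ x y → (x + y) ^ 4 ≈ x ^ 4 + y ^ 4
        fourth = frobenius-+ 2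

        u′⁴ : ∀ y → (ι y + θ′) ^ 4 ≈ u y ^ 4 + ν ^ 4
        u′⁴ y = trans (^-congˡ 4 (solve 3 (λ y t t′ → y :+ t′ := (y :+ t) :+ (t :+ t′)) _ (ι y) θ θ′)) (fourth (u y) ν)

        u″⁴ : ∀ y → (ι y + θ″) ^ 4 ≈ u y ^ 4 + ν″ ^ 4
        u″⁴ y = trans (^-congˡ 4 (solve 3 (λ y t t′ → y :+ t′ := (y :+ t) :+ (t :+ t′)) _ (ι y) θ θ″)) (fourth (u y) ν″)

        -- The point where q ≥ 16 is exactly what is required: a polynomial of degree m + 12, at
        -- most 14, must stay within degree q - 2 for its sum to vanish.
        m+k+2≤q : ∀ {k} → k ≤ 12 → 2 ℕ.+ (m ℕ.+ k) ≤ q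
        m+k+2≤q k≤12 = ℕ.≤-trans (s≤s (s≤s (ℕ.+-mono-≤ m≤2 k≤12))) 16≤q

      -- The factor u⁴ of the weight absorbs a pole of order k ≤ 4, and what remains is a polynomial
      -- of degree m + j + 8.
      small : ∀ j k → j ℕ.+ k ≡ 4 → ∑ (λ y → ι y ^ m * (weight y * Z y ^ k)) ≈ 0#
      small j k j+k≡4 = trans (∑-cong (λ y → *-congˡ (begin
          u y ^ 4 * (_ * _) * Z y ^ k
            ≈⟨ *-congʳ (*-congʳ (≡.subst (λ e → u y ^ e ≈ u y ^ j * u y ^ k) j+k≡4 (^-homo-* (u y) j k))) ⟩
          u y ^ j * u y ^ k * (_ * _) * Z y ^ k
            ≈⟨ solve 5 (λ a b c d e → a :* b :* (c :* d) :* e := (b :* e) :* (a :* (c :* d))) _ (u y ^ j) (u y ^ k) _ _ (Z y ^ k) ⟩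
          u y ^ k * Z y ^ k * (u y ^ j * (_ * _))  ≈⟨ trans (*-congʳ (inv-^ (u≉0 y) k)) (*-identityˡ _) ⟩
          u y ^ j * ((ι y + θ′) ^ 4 * (ι y + θ″) ^ 4) ≈⟨ *-congˡ (*-congˡ (sym (*-identityʳ _))) ⟩
          u y ^ j * ((ι y + θ′) ^ 4 * ((ι y + θ″) ^ 4 * 1#)) ∎)))
        (Low-power θ j (Low-power θ′ 4 (Low-power θ″ 4 (Low-const 1#))) m
          (m+k+2≤q (ℕ.+-monoˡ-≤ 8 {j} {4} (≡.subst (j ≤_) j+k≡4 (ℕ.m≤m+n j k)))))

      none : ∑ (λ y → ι y ^ m * weight y) ≈ 0#
      none = trans (∑-cong (λ y → *-congˡ (sym (*-identityʳ _)))) (small 4 0 ≡.refl)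

      -- After cancelling, (u⁴ + ν⁴)(u⁴ + ν″⁴) / u⁴ = (u⁴ + ν″⁴) + ν⁴ + ν⁴ ν″⁴ / u⁴, and only the
      -- last term has a nonzero sum.
      eight : ∑ (λ y → ι y ^ m * (weight y * Z y ^ 8)) ≈ ν″ ^ 4 * θ′ ^ m
      eight = begin
        ∑ (λ y → ι y ^ m * (weight y * Z y ^ 8)) ≈⟨ ∑-cong expand ⟩
        ∑ (λ y → ι y ^ m * ((ι y + θ″) ^ 4 * 1#) + (ι y ^ m * ν ^ 4 + ν ^ 4 * ν″ ^ 4 * (ι y ^ m * Z y ^ 4)))
          ≈⟨ ∑-+-≈ (Low-power θ″ 4 (Low-const 1#) m (m+k+2≤q (ℕ.m≤m+n 4 8)))
               (∑-+-≈ (Low-const (ν ^ 4) m (m+k+2≤q z≤n))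
                 (*-∑-≈ (ν ^ 4 * ν″ ^ 4) (∑yZ m 4 (ℕ.≤-<-trans m≤2 (ℕ.m≤m+n 3 1)) (ℕ.≤-trans (ℕ.m≤m+n 4 12) 16≤q)))) ⟩
        0# + (0# + ν ^ 4 * ν″ ^ 4 * (μ ^ 4 * θ′ ^ m))
          ≈⟨ solve 4 (λ n n″ m t → con false :+ (con false :+ n :* n″ :* (m :* t)) := n :* m :* (n″ :* t)) _ (ν ^ 4) (ν″ ^ 4) (μ ^ 4) (θ′ ^ m) ⟩
        ν ^ 4 * μ ^ 4 * (ν″ ^ 4 * θ′ ^ m) ≈⟨ trans (*-congʳ μ⁴ν⁴) (*-identityˡ _) ⟩
        ν″ ^ 4 * θ′ ^ m ∎
        where
        expand : ∀ y → ι y ^ m * (weight y * Z y ^ 8) ≈ ι y ^ m * ((ι y + θ″) ^ 4 * 1#) + (ι y ^ m * ν ^ 4 + ν ^ 4 * ν″ ^ 4 * (ι y ^ m * Z y ^ 4))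
        expand y = begin
          ι y ^ m * (weight y * Z y ^ 8)
            ≈⟨ *-congˡ (*-cong (*-congˡ (*-cong (u′⁴ y) (u″⁴ y))) (^-homo-* (Z y) 4 4)) ⟩
          w * (u⁴ * ((u⁴ + n) * (u⁴ + n″)) * (z * z))
            ≈⟨ solve 5 (λ w u n n″ z → w :* (u :* ((u :+ n) :* (u :+ n″)) :* (z :* z))
                 := w :* (u :* z :* (u :* z :* (u :+ n″)) :+ u :* z :* (u :* z :* n :+ n :* n″ :* z))) _ w u⁴ n n″ z ⟩
          w * (u⁴ * z * (u⁴ * z * (u⁴ + n″)) + u⁴ * z * (u⁴ * z * n + n * n″ * z))
            ≈⟨ *-congˡ (+-cong (*-cong (u⁴Z⁴ y) (*-cong (u⁴Z⁴ y) (sym (u″⁴ y)))) (*-cong (u⁴Z⁴ y) (+-congʳ (*-congʳ (u⁴Z⁴ y))))) ⟩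
          w * (1# * (1# * (ι y + θ″) ^ 4) + 1# * (1# * n + n * n″ * z))
            ≈⟨ solve 5 (λ w v n n″ z → w :* (con true :* (con true :* v) :+ con true :* (con true :* n :+ n :* n″ :* z))
                 := w :* (v :* con true) :+ (w :* n :+ n :* n″ :* (w :* z))) _ w ((ι y + θ″) ^ 4) n n″ z ⟩
          w * ((ι y + θ″) ^ 4 * 1#) + (w * n + n * n″ * (w * z)) ∎
          where
          w = ι y ^ m
          u⁴ = u y ^ 4
          z = Z y ^ 4
          n = ν ^ 4
          n″ = ν″ ^ 4

      -- Now the fraction is proper, so the sum is its value at θ′, where the weight vanishes. In
      -- formulas this is the factor 1 + ν⁴ μ⁴ = 0; the condition m < j keeps all three terms of the
      -- expansion proper.
      large : ∀ j → m < j → 8 ℕ.+ j ≤ q → ∑ (λ y → ι y ^ m * (weight y * Z y ^ (12 ℕ.+ j))) ≈ 0#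
      large j m<j 8+j≤q = begin
        ∑ (λ y → ι y ^ m * (weight y * Z y ^ (12 ℕ.+ j))) ≈⟨ ∑-cong expand ⟩
        ∑ (λ y → ι y ^ m * Z y ^ j + ((n + n″) * (ι y ^ m * Z y ^ (4 ℕ.+ j)) + n * n″ * (ι y ^ m * Z y ^ (8 ℕ.+ j))))
          ≈⟨ ∑-+-≈ (∑yZ m j m<j (ℕ.≤-trans (ℕ.m≤n+m j 8) 8+j≤q))
               (∑-+-≈
                 (*-∑-≈ (n + n″) (∑yZ m (4 ℕ.+ j) (ℕ.≤-trans m<j (ℕ.m≤n+m j 4)) (ℕ.≤-trans (ℕ.+-monoˡ-≤ j {4} {8} (ℕ.m≤m+n 4 4)) 8+j≤q)))
                 (*-∑-≈ (n * n″) (∑yZ m (8 ℕ.+ j) (ℕ.≤-trans m<j (ℕ.m≤n+m j 8)) 8+j≤q))) ⟩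
        μ ^ j * t + ((n + n″) * (μ ^ (4 ℕ.+ j) * t) + n * n″ * (μ ^ (8 ℕ.+ j) * t))
          ≈⟨ +-congˡ (+-cong (*-congˡ (*-congʳ (^-homo-* μ 4 j))) (*-congˡ (*-congʳ (trans (^-homo-* μ 4 (4 ℕ.+ j)) (*-congˡ (^-homo-* μ 4 j)))))) ⟩
        μ ^ j * t + ((n + n″) * (μ ^ 4 * μ ^ j * t) + n * n″ * (μ ^ 4 * (μ ^ 4 * μ ^ j) * t))
          ≈⟨ solve 5 (λ n n″ m w t → w :* t :+ ((n :+ n″) :* (m :* w :* t) :+ n :* n″ :* (m :* (m :* w) :* t))
               := (con true :+ n :* m) :* (w :* t) :+ n″ :* m :* w :* t :* (con true :+ n :* m)) _ n n″ (μ ^ 4) (μ ^ j) t ⟩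
        (1# + n * μ ^ 4) * (μ ^ j * t) + n″ * μ ^ 4 * μ ^ j * t * (1# + n * μ ^ 4)
          ≈⟨ +-cong (*-congʳ (≈⇒+≈0 (sym μ⁴ν⁴))) (*-congˡ (≈⇒+≈0 (sym μ⁴ν⁴))) ⟩
        0# * (μ ^ j * t) + n″ * μ ^ 4 * μ ^ j * t * 0#
          ≈⟨ trans (+-cong (zeroˡ _) (zeroʳ _)) (+-identityˡ 0#) ⟩
        0# ∎
        where
        n = ν ^ 4
        n″ = ν″ ^ 4
        t = θ′ ^ m
        expand : ∀ y → ι y ^ m * (weight y * Z y ^ (12 ℕ.+ j)) ≈
          ι y ^ m * Z y ^ j + ((n + n″) * (ι y ^ m * Z y ^ (4 ℕ.+ j)) + n * n″ * (ι y ^ m * Z y ^ (8 ℕ.+ j)))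
        expand y = begin
          ι y ^ m * (weight y * Z y ^ (12 ℕ.+ j))
            ≈⟨ *-congˡ (*-cong (*-congˡ (*-cong (u′⁴ y) (u″⁴ y))) (trans (^-homo-* (Z y) 4 (8 ℕ.+ j)) (*-congˡ (trans (^-homo-* (Z y) 4 (4 ℕ.+ j)) (*-congˡ (^-homo-* (Z y) 4 j)))))) ⟩
          w * (u⁴ * ((u⁴ + n) * (u⁴ + n″)) * (z * (z * (z * v))))
            ≈⟨ solve 6 (λ w u n n″ z v → w :* (u :* ((u :+ n) :* (u :+ n″)) :* (z :* (z :* (z :* v))))
                 := w :* (u :* z) :* (u :* z) :* (u :* z) :* v :+ ((u :* z) :* (u :* z) :* (n :+ n″) :* (w :* (z :* v)) :+ (u :* z) :* (n :* n″) :* (w :* (z :* (z :* v))))) _ w u⁴ n n″ z v ⟩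
          w * (u⁴ * z) * (u⁴ * z) * (u⁴ * z) * v + ((u⁴ * z) * (u⁴ * z) * (n + n″) * (w * (z * v)) + (u⁴ * z) * (n * n″) * (w * (z * (z * v))))
            ≈⟨ +-cong (*-congʳ (*-cong (*-cong (*-congˡ (u⁴Z⁴ y)) (u⁴Z⁴ y)) (u⁴Z⁴ y)))
                 (+-cong (*-congʳ (*-congʳ (*-cong (u⁴Z⁴ y) (u⁴Z⁴ y)))) (*-congʳ (*-congʳ (u⁴Z⁴ y)))) ⟩
          w * 1# * 1# * 1# * v + (1# * 1# * (n + n″) * (w * (z * v)) + 1# * (n * n″) * (w * (z * (z * v))))
            ≈⟨ solve 5 (λ w n n″ z v → w :* con true :* con true :* con true :* v :+ (con true :* con true :* (n :+ n″) :* (w :* (z :* v)) :+ con true :* (n :* n″) :* (w :* (z :* (z :* v))))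
                 := w :* v :+ ((n :+ n″) :* (w :* (z :* v)) :+ n :* n″ :* (w :* (z :* (z :* v))))) _ w n n″ z v ⟩
          w * v + ((n + n″) * (w * (z * v)) + n * n″ * (w * (z * (z * v))))
            ≈⟨ +-congˡ (+-cong (*-congˡ (*-congˡ (^-homo-* (Z y) 4 j))) (*-congˡ (*-congˡ (trans (^-homo-* (Z y) 4 (4 ℕ.+ j)) (*-congˡ (^-homo-* (Z y) 4 j)))))) ⟨
          w * Z y ^ j + ((n + n″) * (w * Z y ^ (4 ℕ.+ j)) + n * n″ * (w * Z y ^ (8 ℕ.+ j))) ∎
          where
          w = ι y ^ m
          u⁴ = u y ^ 4
          z = Z y ^ 4
          v = Z y ^ j

-- Traces of partial fractions summed against the weights

16≤2^[4+k] : ∀ k → 16 ≤ 2 ℕ.^ (4 ℕ.+ k)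
16≤2^[4+k] k = ℕ.^-monoʳ-≤ 2 {4} {4 ℕ.+ k} (ℕ.m≤m+n 4 k)

module TraceSums {q : ℕ} (𝔽 : FiniteField q) (h : ℕ) (q≡2^h : q ≡ 2 ℕ.^ h) (4≤h : 4 ≤ h) (2≤q : 2 ≤ q)
  (2≈0 : TwoIsZero (FiniteField.ring 𝔽))
  (p r : CommutativeRing.Carrier (FiniteField.ring 𝔽))
  (irreducible : Rootless (FiniteField.ring 𝔽) p r)
  (ext : CubicExtension 𝔽 p r) where
  open PowerSums 𝔽 h q≡2^h 2≤q 2≈0 p r irreducible ext public
  open F using (F)
  open Relation.Binary.Reasoning.Setoid setoid

  2^i≤q : ∀ {i} → i ≤ h → 2 ℕ.^ i ≤ q
  2^i≤q i≤h = ≡.subst (_ ≤_) (≡.sym q≡2^h) (ℕ.^-monoʳ-≤ 2 i≤h)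

  16≤q : 16 ≤ q
  16≤q = 2^i≤q 4≤h

  -- For k = h this polynomial is the absolute trace on the base field. It is applied on the
  -- extension because the poles are only defined there.
  trace : ℕ → K → K
  trace zero    x = 0#
  trace (suc k) x = trace k x + x ^ (2 ℕ.^ k)

  trace-cong : ∀ k {x y} → x ≈ y → trace k x ≈ trace k y
  trace-cong zero    eq = refl
  trace-cong (suc k) eq = +-cong (trace-cong k eq) (^-congˡ (2 ℕ.^ k) eq)

  trace-x²+x : ∀ k x → trace k (x * x + x) ≈ x ^ (2 ℕ.^ k) + x
  trace-x²+x zero x = solve 1 (λ x → con false := x :* con true :+ x) _ x
  trace-x²+x (suc k) x = begin
    trace k (x * x + x) + (x * x + x) ^ (2 ℕ.^ k)
      ≈⟨ +-cong (trace-x²+x k x) (trans (frobenius-+ k (x * x) x) (+-congʳ (^-distrib-* x x (2 ℕ.^ k)))) ⟩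
    (w + x) + (w * w + w)    ≈⟨ solve 2 (λ w x → (w :+ x) :+ (w :* w :+ w) := w :* w :+ x) _ w x ⟩
    w * w + x                ≈⟨ +-congʳ (frobenius-suc k x) ⟨
    x ^ (2 ℕ.^ suc k) + x    ∎
    where w = x ^ (2 ℕ.^ k)

  trace-ι[g²+g] : ∀ g → trace h (ι g * ι g + ι g) ≈ 0#
  trace-ι[g²+g] g = trans (trace-x²+x h (ι g)) (≈⇒+≈0 (≡.subst (λ k → ι g ^ k ≈ ι g) q≡2^h (σ-ι g)))

  private
    u₁≉0 : ∀ y → ι y + η₁ ≉ 0#
    u₁≉0 y eq = ι-not-root y (IsRoot-cong (sym (+≈0⇒≈ eq)) η-root)

    u₂≉0 : ∀ y → ι y + η₂ ≉ 0#
    u₂≉0 y eq = ι-not-root y (IsRoot-cong (sym (+≈0⇒≈ eq)) (σ-root η η-root))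

    u₃≉0 : ∀ y → ι y + η₃ ≉ 0#
    u₃≉0 y eq = ι-not-root y (IsRoot-cong (sym (+≈0⇒≈ eq)) η₃-root)

    η₂≉η₃ : η₂ ≉ η₃
    η₂≉η₃ eq = η₁≉0 (trans (solve 2 (λ a b → a := b :+ (a :+ b)) _ η₁ η₂) (≈⇒+≈0 eq))

    η₃≉η₁ : η₃ ≉ η₁
    η₃≉η₁ eq = η₂≉0 (trans (solve 2 (λ a b → b := (a :+ b) :+ a) _ η₁ η₂) (≈⇒+≈0 eq))

  module P₁ = Pole η₁ η₂ refl η₁≉η₂ u₁≉0
  module P₂ = Pole η₂ η₃ σ-η₂ η₂≉η₃ u₂≉0
  module P₃ = Pole η₃ η₁ σ-η₃ η₃≉η₁ u₃≉0

  module _ (m : ℕ) (m≤2 : m ≤ 2) where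
    private
      module W₁ = P₁.Weighted η₃ m m≤2 16≤q
      module W₂ = P₂.Weighted η₁ m m≤2 16≤q
      module W₃ = P₃.Weighted η₂ m m≤2 16≤q

    w : F → K
    w y = ι y ^ m * W₁.weight y

    -- The trace involves only powers whose exponent is a power of 2, so these weighted sums are all
    -- that is needed; v is the one that may be nonzero.
    record Moments (f : F → K) (v : K) : Set where
      field
        zeroth : ∑ (λ y → w y * f y ^ 1) ≈ 0#
        first  : ∑ (λ y → w y * f y ^ 2) ≈ 0#
        second : ∑ (λ y → w y * f y ^ 4) ≈ 0#
        third  : ∑ (λ y → w y * f y ^ 8) ≈ v
        higher : ∀ k → 4 ℕ.+ k ≤ h → ∑ (λ y → w y * f y ^ (2 ℕ.^ (4 ℕ.+ k))) ≈ 0#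

    private
      -- Each pole sees the same weight with its factors in a different cyclic order; `weight≈`
      -- reconciles the orders.
      pole-moments : ∀ {f weight : F → K} {v} → (∀ y → weight y ≈ W₁.weight y) →
        (∀ j k → j ℕ.+ k ≡ 4 → ∑ (λ y → ι y ^ m * (weight y * f y ^ k)) ≈ 0#) →
        ∑ (λ y → ι y ^ m * (weight y * f y ^ 8)) ≈ v →
        (∀ j → m < j → 8 ℕ.+ j ≤ q → ∑ (λ y → ι y ^ m * (weight y * f y ^ (12 ℕ.+ j))) ≈ 0#) → Moments f v
      pole-moments {f} {weight} weight≈ small eight large = record
        { zeroth = trans (reweigh 1) (small 3 1 ≡.refl)
        ; first  = trans (reweigh 2) (small 2 2 ≡.refl)
        ; second = trans (reweigh 4) (small 0 4 ≡.refl)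
        ; third  = trans (reweigh 8) eight
        ; higher = λ k 4+k≤h →
            let e = 2 ℕ.^ (4 ℕ.+ k)
                12+j≡e = ℕ.m+[n∸m]≡n {12} {e} (ℕ.≤-trans (ℕ.m≤m+n 12 4) (16≤2^[4+k] k))
            in trans (reweigh e) (≡.subst (λ e → ∑ (λ y → ι y ^ m * (weight y * f y ^ e)) ≈ 0#) 12+j≡e
                 -- `large` counts exponents from 12. Since e ≥ 16, the excess j = e - 12 is at
                 -- least 4, hence above m.
                 (large (e ℕ.∸ 12)
                   (ℕ.≤-<-trans m≤2 (ℕ.<-≤-trans {2} {4} (ℕ.m≤m+n 3 1) (ℕ.∸-monoˡ-≤ 12 (16≤2^[4+k] k))))
                   (ℕ.≤-trans (ℕ.+-monoˡ-≤ (e ℕ.∸ 12) {8} {12} (ℕ.m≤m+n 8 4)) (≡.subst (_≤ q) (≡.sym 12+j≡e) (2^i≤q 4+k≤h)))))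
        }
        where
        reweigh : ∀ k → ∑ (λ y → w y * f y ^ k) ≈ ∑ (λ y → ι y ^ m * (weight y * f y ^ k))
        reweigh k = ∑-cong (λ y → trans (*-assoc _ _ _) (*-congˡ (*-congʳ (sym (weight≈ y)))))

      moments₁ : Moments P₁.Z ((η₁ + η₃) ^ 4 * η₂ ^ m)
      moments₁ = pole-moments {P₁.Z} {W₁.weight} (λ _ → refl) W₁.small W₁.eight W₁.large
      moments₂ : Moments P₂.Z ((η₂ + η₁) ^ 4 * η₃ ^ m)
      moments₂ = pole-moments {P₂.Z} {W₂.weight} (λ y → solve 3 (λ a b c → b :* (c :* a) := a :* (b :* c)) _ _ _ _) W₂.small W₂.eight W₂.large
      moments₃ : Moments P₃.Z ((η₃ + η₂) ^ 4 * η₁ ^ m)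
      moments₃ = pole-moments {P₃.Z} {W₃.weight} (λ y → solve 3 (λ a b c → c :* (a :* b) := a :* (b :* c)) _ _ _ _) W₃.small W₃.eight W₃.large

    module _ (c s₁ t₁ s₂ t₂ s₃ t₃ : K) where
      partial-fractions : F → K
      partial-fractions y = c + ((s₁ * (P₁.Z y * P₁.Z y) + t₁ * P₁.Z y) + ((s₂ * (P₂.Z y * P₂.Z y) + t₂ * P₂.Z y) + (s₃ * (P₃.Z y * P₃.Z y) + t₃ * P₃.Z y)))

      private
        -- At level i the double pole already has exponent 2^(i+1). The eighth power is therefore
        -- met twice, by s at level 2 and by t at level 3, which explains the coefficient s⁴ + t⁸ of
        -- the total.
        term : ∀ i s t z → (s * (z * z) + t * z) ^ (2 ℕ.^ i) ≈ s ^ (2 ℕ.^ i) * z ^ (2 ℕ.^ suc i) + t ^ (2 ℕ.^ i) * z ^ (2 ℕ.^ i)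
        term i s t z = trans (frobenius-+ i _ _) (+-cong
          (trans (^-distrib-* s (z * z) (2 ℕ.^ i)) (*-congˡ (trans (^-distrib-* z z (2 ℕ.^ i)) (sym (frobenius-suc i z)))))
          (^-distrib-* t z (2 ℕ.^ i)))

        ∑-term : ∀ i s t (Z : F → K) {v v′} → ∑ (λ y → w y * Z y ^ (2 ℕ.^ suc i)) ≈ v′ → ∑ (λ y → w y * Z y ^ (2 ℕ.^ i)) ≈ v →
          ∑ (λ y → w y * (s * (Z y * Z y) + t * Z y) ^ (2 ℕ.^ i)) ≈ s ^ (2 ℕ.^ i) * v′ + t ^ (2 ℕ.^ i) * v
        ∑-term i s t Z {v} {v′} ∑v′ ∑v = begin
          ∑ (λ y → w y * (s * (Z y * Z y) + t * Z y) ^ (2 ℕ.^ i))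
            ≈⟨ ∑-cong (λ y → trans (*-congˡ (term i s t (Z y))) (solve 5 (λ w s z′ t z → w :* (s :* z′ :+ t :* z) := s :* (w :* z′) :+ t :* (w :* z))
                 _ (w y) (s ^ (2 ℕ.^ i)) (Z y ^ (2 ℕ.^ suc i)) (t ^ (2 ℕ.^ i)) (Z y ^ (2 ℕ.^ i)))) ⟩
          ∑ (λ y → s ^ (2 ℕ.^ i) * (w y * Z y ^ (2 ℕ.^ suc i)) + t ^ (2 ℕ.^ i) * (w y * Z y ^ (2 ℕ.^ i)))
            ≈⟨ ∑-+-≈ (*-∑-≈ (s ^ (2 ℕ.^ i)) ∑v′) (*-∑-≈ (t ^ (2 ℕ.^ i)) ∑v) ⟩
          s ^ (2 ℕ.^ i) * v′ + t ^ (2 ℕ.^ i) * v ∎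

        level : ∀ i {v₁ v₁′ v₂ v₂′ v₃ v₃′} →
          ∑ (λ y → w y * P₁.Z y ^ (2 ℕ.^ suc i)) ≈ v₁′ → ∑ (λ y → w y * P₁.Z y ^ (2 ℕ.^ i)) ≈ v₁ →
          ∑ (λ y → w y * P₂.Z y ^ (2 ℕ.^ suc i)) ≈ v₂′ → ∑ (λ y → w y * P₂.Z y ^ (2 ℕ.^ i)) ≈ v₂ →
          ∑ (λ y → w y * P₃.Z y ^ (2 ℕ.^ suc i)) ≈ v₃′ → ∑ (λ y → w y * P₃.Z y ^ (2 ℕ.^ i)) ≈ v₃ →
          ∑ (λ y → w y * partial-fractions y ^ (2 ℕ.^ i)) ≈
            (s₁ ^ (2 ℕ.^ i) * v₁′ + t₁ ^ (2 ℕ.^ i) * v₁) + ((s₂ ^ (2 ℕ.^ i) * v₂′ + t₂ ^ (2 ℕ.^ i) * v₂) + (s₃ ^ (2 ℕ.^ i) * v₃′ + t₃ ^ (2 ℕ.^ i) * v₃))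
        level i a₁ b₁ a₂ b₂ a₃ b₃ = trans (∑-cong (λ y → trans (*-congˡ
              (trans (frobenius-+ i _ _) (+-congˡ (trans (frobenius-+ i _ _) (+-congˡ (frobenius-+ i _ _))))))
              (solve 5 (λ w c x y z → w :* (c :+ (x :+ (y :+ z))) := c :* w :+ (w :* x :+ (w :* y :+ w :* z))) _ (w y) (c ^ (2 ℕ.^ i)) _ _ _)))
          (trans (∑-+-≈ (*-∑-≈ (c ^ (2 ℕ.^ i)) W₁.none)
              (∑-+-≈ (∑-term i s₁ t₁ P₁.Z a₁ b₁) (∑-+-≈ (∑-term i s₂ t₂ P₂.Z a₂ b₂) (∑-term i s₃ t₃ P₃.Z a₃ b₃))))
            (trans (+-congʳ (zeroʳ _)) (+-identityˡ _)))

        module M₁ = Moments moments₁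
        module M₂ = Moments moments₂
        module M₃ = Moments moments₃

        no-contribution : ∀ {x₁ y₁ x₂ y₂ x₃ y₃} → (x₁ * 0# + y₁ * 0#) + ((x₂ * 0# + y₂ * 0#) + (x₃ * 0# + y₃ * 0#)) ≈ 0#
        no-contribution = solve 6 (λ x₁ y₁ x₂ y₂ x₃ y₃ → let 𝟘 = con false in
          (x₁ :* 𝟘 :+ y₁ :* 𝟘) :+ ((x₂ :* 𝟘 :+ y₂ :* 𝟘) :+ (x₃ :* 𝟘 :+ y₃ :* 𝟘)) := 𝟘) _ _ _ _ _ _ _

        v₁ v₂ v₃ : K
        v₁ = (η₁ + η₃) ^ 4 * η₂ ^ m
        v₂ = (η₂ + η₁) ^ 4 * η₃ ^ m
        v₃ = (η₃ + η₂) ^ 4 * η₁ ^ m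

        total : K
        total = (s₁ ^ 4 + t₁ ^ 8) * v₁ + ((s₂ ^ 4 + t₂ ^ 8) * v₂ + (s₃ ^ 4 + t₃ ^ 8) * v₃)

        ∑-trace : ∀ k → 4 ℕ.+ k ≤ h → ∑ (λ y → w y * trace (4 ℕ.+ k) (partial-fractions y)) ≈ total
        ∑-trace zero _ = begin
          ∑ (λ y → w y * trace 4 (partial-fractions y))
            ≈⟨ ∑-cong (λ y → solve 5 (λ w a b c d → w :* (con false :+ a :+ b :+ c :+ d) := w :* a :+ (w :* b :+ (w :* c :+ w :* d)))
                 _ (w y) (partial-fractions y ^ 1) (partial-fractions y ^ 2) (partial-fractions y ^ 4) (partial-fractions y ^ 8)) ⟩
          ∑ (λ y → w y * partial-fractions y ^ 1 + (w y * partial-fractions y ^ 2 + (w y * partial-fractions y ^ 4 + w y * partial-fractions y ^ 8)))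
            ≈⟨ ∑-+-≈ (trans (level 0 M₁.first M₁.zeroth M₂.first M₂.zeroth M₃.first M₃.zeroth) no-contribution)
                 (∑-+-≈ (trans (level 1 M₁.second M₁.first M₂.second M₂.first M₃.second M₃.first) no-contribution)
                   (∑-+-≈ (level 2 M₁.third M₁.second M₂.third M₂.second M₃.third M₃.second)
                     (level 3 (M₁.higher 0 4≤h) M₁.third (M₂.higher 0 4≤h) M₂.third (M₃.higher 0 4≤h) M₃.third))) ⟩
          0# + (0# + (((s₁ ^ 4 * v₁ + t₁ ^ 4 * 0#) + ((s₂ ^ 4 * v₂ + t₂ ^ 4 * 0#) + (s₃ ^ 4 * v₃ + t₃ ^ 4 * 0#)))
            + ((s₁ ^ 8 * 0# + t₁ ^ 8 * v₁) + ((s₂ ^ 8 * 0# + t₂ ^ 8 * v₂) + (s₃ ^ 8 * 0# + t₃ ^ 8 * v₃)))))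
            ≈⟨ collect (s₁ ^ 4) (s₂ ^ 4) (s₃ ^ 4) (t₁ ^ 4) (t₂ ^ 4) (t₃ ^ 4) (s₁ ^ 8) (s₂ ^ 8) (s₃ ^ 8) (t₁ ^ 8) (t₂ ^ 8) (t₃ ^ 8) v₁ v₂ v₃ ⟩
          total ∎
          where
          collect : ∀ s₁ s₂ s₃ a b c d e f t₁ t₂ t₃ v₁ v₂ v₃ →
            0# + (0# + (((s₁ * v₁ + a * 0#) + ((s₂ * v₂ + b * 0#) + (s₃ * v₃ + c * 0#))) + ((d * 0# + t₁ * v₁) + ((e * 0# + t₂ * v₂) + (f * 0# + t₃ * v₃)))))
            ≈ (s₁ + t₁) * v₁ + ((s₂ + t₂) * v₂ + (s₃ + t₃) * v₃)
          collect = solve 15 (λ s₁ s₂ s₃ a b c d e f t₁ t₂ t₃ v₁ v₂ v₃ → let 𝟘 = con false in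
            𝟘 :+ (𝟘 :+ (((s₁ :* v₁ :+ a :* 𝟘) :+ ((s₂ :* v₂ :+ b :* 𝟘) :+ (s₃ :* v₃ :+ c :* 𝟘))) :+ ((d :* 𝟘 :+ t₁ :* v₁) :+ ((e :* 𝟘 :+ t₂ :* v₂) :+ (f :* 𝟘 :+ t₃ :* v₃)))))
            := (s₁ :+ t₁) :* v₁ :+ ((s₂ :+ t₂) :* v₂ :+ (s₃ :+ t₃) :* v₃)) _
        ∑-trace (suc k) 5+k≤h = begin
          ∑ (λ y → w y * (trace (4 ℕ.+ k) (partial-fractions y) + partial-fractions y ^ (2 ℕ.^ (4 ℕ.+ k))))
            ≈⟨ ∑-cong (λ y → distribˡ _ _ _) ⟩
          ∑ (λ y → w y * trace (4 ℕ.+ k) (partial-fractions y) + w y * partial-fractions y ^ (2 ℕ.^ (4 ℕ.+ k)))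
            ≈⟨ ∑-+-≈ (∑-trace k 4+k≤h) (trans (level (4 ℕ.+ k)
                 (M₁.higher (suc k) 5+k≤h) (M₁.higher k 4+k≤h) (M₂.higher (suc k) 5+k≤h) (M₂.higher k 4+k≤h) (M₃.higher (suc k) 5+k≤h) (M₃.higher k 4+k≤h))
                 no-contribution) ⟩
          total + 0# ≈⟨ +-identityʳ _ ⟩
          total      ∎
          where
          4+k≤h : 4 ℕ.+ k ≤ h
          4+k≤h = ℕ.≤-trans (ℕ.n≤1+n _) 5+k≤h

      traceless⇒relation : (∀ y → trace h (partial-fractions y) ≈ 0#) →
        (s₁ ^ 4 + t₁ ^ 8) * ((η₁ + η₃) ^ 4 * η₂ ^ m) + ((s₂ ^ 4 + t₂ ^ 8) * ((η₂ + η₁) ^ 4 * η₃ ^ m) + (s₃ ^ 4 + t₃ ^ 8) * ((η₃ + η₂) ^ 4 * η₁ ^ m)) ≈ 0#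
      traceless⇒relation traceless = begin
        total ≈⟨ ∑-trace (h ℕ.∸ 4) (ℕ.≤-reflexive h≡) ⟨
        ∑ (λ y → w y * trace (4 ℕ.+ (h ℕ.∸ 4)) (partial-fractions y))
          ≈⟨ ∑-cong (λ y → *-congˡ (≡.subst (λ k → trace k (partial-fractions y) ≈ 0#) (≡.sym h≡) (traceless y))) ⟩
        ∑ (λ y → w y * 0#)   ≈⟨ ∑-cong (λ y → *-comm _ _) ⟩
        ∑ (λ y → 0# * w y)   ≈⟨ *-∑ 0# w ⟩
        0# * ∑ w             ≈⟨ zeroˡ _ ⟩
        0#                   ∎
        where
        h≡ : 4 ℕ.+ (h ℕ.∸ 4) ≡ h
        h≡ = ℕ.m+[n∸m]≡n 4≤h

  -- The relations for m = 0, 1, 2 form a Vandermonde system.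
  traceless⇒s≈t² : ∀ c s₁ t₁ s₂ t₂ s₃ t₃ →
    (∀ y → trace h (partial-fractions 0 z≤n c s₁ t₁ s₂ t₂ s₃ t₃ y) ≈ 0#) → s₁ ≈ t₁ * t₁
  traceless⇒s≈t² c s₁ t₁ s₂ t₂ s₃ t₃ traceless = +≈0⇒≈ (^-zero-root 4 (begin
    (s₁ + t₁ * t₁) ^ 4         ≈⟨ frobenius-+ 2 s₁ (t₁ * t₁) ⟩
    s₁ ^ 4 + (t₁ * t₁) ^ 4     ≈⟨ +-congˡ (solve 1 (λ t → let w = t :* t in w :* (w :* (w :* (w :* con true))) := t :* (t :* (t :* (t :* (t :* (t :* (t :* (t :* con true)))))))) _ t₁) ⟩
    x₁                         ≈⟨ *-zero-cancelˡ (^-nonzero η₁+η₃≉0 4) (*-zero-cancelˡ (*-nonzero η₃≉0′ η₁≉0′) vandermonde) ⟩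
    0#                         ∎))
    where
    x₁ = s₁ ^ 4 + t₁ ^ 8
    x₂ = s₂ ^ 4 + t₂ ^ 8
    x₃ = s₃ ^ 4 + t₃ ^ 8
    η₁+η₃≉0 : η₁ + η₃ ≉ 0#
    η₁+η₃≉0 eq = η₃≉η₁ (sym (+≈0⇒≈ eq))
    η₃≉0′ : η₂ + η₃ ≉ 0#
    η₃≉0′ eq = η₂≉η₃ (+≈0⇒≈ eq)
    η₁≉0′ : η₂ + η₁ ≉ 0#
    η₁≉0′ eq = η₁≉η₂ (sym (+≈0⇒≈ eq))
    relation : ∀ m (m≤2 : m ≤ 2) → _
    relation m m≤2 = traceless⇒relation m m≤2 c s₁ t₁ s₂ t₂ s₃ t₃ traceless
    vandermonde : (η₂ + η₃) * (η₂ + η₁) * ((η₁ + η₃) ^ 4 * x₁) ≈ 0#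
    vandermonde = begin
      (η₂ + η₃) * (η₂ + η₁) * ((η₁ + η₃) ^ 4 * x₁)
        -- The relations are combined with the coefficients of (T + η₃)(T + η₁). This polynomial
        -- vanishes at the nodes η₃ of x₂ and η₁ of x₃, and isolates x₁ with node η₂.
        ≈⟨ solve 9 (λ a b d x₁ x₂ x₃ w₁ w₂ w₃ → (b :+ d) :* (b :+ a) :* (w₁ :* x₁)
             := (x₁ :* (w₁ :* (b :* (b :* con true))) :+ (x₂ :* (w₂ :* (d :* (d :* con true))) :+ x₃ :* (w₃ :* (a :* (a :* con true)))))
               :+ (d :+ a) :* (x₁ :* (w₁ :* (b :* con true)) :+ (x₂ :* (w₂ :* (d :* con true)) :+ x₃ :* (w₃ :* (a :* con true))))
               :+ d :* a :* (x₁ :* (w₁ :* con true) :+ (x₂ :* (w₂ :* con true) :+ x₃ :* (w₃ :* con true))))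
             _ η₁ η₂ η₃ x₁ x₂ x₃ ((η₁ + η₃) ^ 4) ((η₂ + η₁) ^ 4) ((η₃ + η₂) ^ 4) ⟩
      _ ≈⟨ +-cong (+-cong (relation 2 ℕ.≤-refl) (*-congˡ (relation 1 (s≤s z≤n)))) (*-congˡ (relation 0 z≤n)) ⟩
      0# + (η₃ + η₁) * 0# + η₃ * η₁ * 0#
        ≈⟨ solve 2 (λ x y → con false :+ x :* con false :+ y :* con false := con false) _ (η₃ + η₁) (η₃ * η₁) ⟩
      0# ∎

-- Splitting of an anisotropic depressed cubic form

DepressedAnisotropic : (R : CommutativeRing 0ℓ 0ℓ) (α a β e p r : CommutativeRing.Carrier R) → Set
DepressedAnisotropic R α a β e p r = ∀ x y z → ¬ (x ≈ 0# × y ≈ 0# × z ≈ 0#) →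
    ¬ (x * x * x + x * (α * (y * y) + a * (y * z) + β * (z * z)) + e * (y * y * y + p * (y * (z * z)) + r * (z * z * z)) ≈ 0#)
  where open CommutativeRing R

module DepressedForm {q : ℕ} (𝔽 : FiniteField q) (h : ℕ) (q≡2^h : q ≡ 2 ℕ.^ h) (4≤h : 4 ≤ h) (2≤q : 2 ≤ q)
  (2≈0 : TwoIsZero (FiniteField.ring 𝔽))
  (α a β e p r : CommutativeRing.Carrier (FiniteField.ring 𝔽))
  (anisotropic : DepressedAnisotropic (FiniteField.ring 𝔽) α a β e p r)
  (irreducible : Rootless (FiniteField.ring 𝔽) p r) (ext : CubicExtension 𝔽 p r) where

  private
    module Base = Field 𝔽
    open Base using (F)

  module _ where
    open Base
    open CharTwo R 2≈0
    open Relation.Binary.Reasoning.Setoid setoid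

    -- P and E of x³ + x P + E at z = 1.
    quadratic cubic-part : F → F
    quadratic y = α * (y * y) + a * y + β
    cubic-part y = e * (y * y * y + p * y + r)

    e≉0 : e ≉ 0#
    e≉0 e≈0 = anisotropic 0# 1# 0# (λ (_ , 1≈0 , _) → 1≉0 1≈0)
      (trans (solve 6 (λ α a β e p r → let 𝟘 = con false ; 𝟙 = con true in
          𝟘 :* 𝟘 :* 𝟘 :+ 𝟘 :* (α :* (𝟙 :* 𝟙) :+ a :* (𝟙 :* 𝟘) :+ β :* (𝟘 :* 𝟘)) :+ e :* (𝟙 :* 𝟙 :* 𝟙 :+ p :* (𝟙 :* (𝟘 :* 𝟘)) :+ r :* (𝟘 :* 𝟘 :* 𝟘)) := e)
        _ α a β e p r) e≈0)

    no-root : ∀ x y → x * x * x + quadratic y * x + cubic-part y ≉ 0#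
    no-root x y eq = anisotropic x y 1# (λ (_ , _ , 1≈0) → 1≉0 1≈0) (trans
      (solve 8 (λ α a β e p r x y → let 𝟙 = con true in
          x :* x :* x :+ x :* (α :* (y :* y) :+ a :* (y :* 𝟙) :+ β :* (𝟙 :* 𝟙)) :+ e :* (y :* y :* y :+ p :* (y :* (𝟙 :* 𝟙)) :+ r :* (𝟙 :* 𝟙 :* 𝟙))
          := x :* x :* x :+ (α :* (y :* y) :+ a :* y :+ β) :* x :+ e :* (y :* y :* y :+ p :* y :+ r)) _ α a β e p r x y) eq)

    cubic-part≉0 : ∀ y → cubic-part y ≉ 0#
    cubic-part≉0 y eq = no-root 0# y (trans (solve 2 (λ w c → let 𝟘 = con false in 𝟘 :* 𝟘 :* 𝟘 :+ w :* 𝟘 :+ c := c) _ (quadratic y) (cubic-part y)) eq)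

    divide : a ≉ 0# → ∀ {x y} → a * a * x + e * e * y ≈ 0# → x ≈ e * inv a * (e * inv a) * y
    divide a≉0 {x} {y} eq = begin
      x                       ≈⟨ solve 1 (λ x → x := con true :* con true :* x) _ x ⟩
      1# * 1# * x             ≈⟨ *-congʳ (*-cong (inv-right a≉0) (inv-right a≉0)) ⟨
      a * i * (a * i) * x
        ≈⟨ solve 5 (λ a i e x y → a :* i :* (a :* i) :* x := (a :* a :* x :+ e :* e :* y) :* (i :* i) :+ e :* i :* (e :* i) :* y) _ a i e x y ⟩
      (a * a * x + e * e * y) * (i * i) + e * i * (e * i) * y ≈⟨ +-congʳ (trans (*-congʳ eq) (zeroˡ _)) ⟩
      0# + e * i * (e * i) * y ≈⟨ +-identityˡ _ ⟩
      e * i * (e * i) * y     ∎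
      where i = inv a

    -- g = m / E for a root m of the resolvent of x³ + P x + E.
    artin-schreier : ∀ y → ∃ λ g → g * g + g ≈ 1# + quadratic y * quadratic y * quadratic y * (inv (cubic-part y) * inv (cubic-part y))
    artin-schreier y = m * i , (begin
        m * i * (m * i) + m * i       ≈⟨ solve 2 (λ m i → m :* i :* (m :* i) :+ m :* i := m :* i :* (m :* i) :+ con true :* (m :* i)) _ m i ⟩
        m * i * (m * i) + 1# * (m * i)  ≈⟨ +-congˡ (*-congʳ (sym Ei≈1)) ⟩
        m * i * (m * i) + E * i * (m * i)
          ≈⟨ solve 4 (λ m i E P → m :* i :* (m :* i) :+ E :* i :* (m :* i)
               := (m :* m :+ E :* m :+ P :* P :* P :+ E :* E) :* (i :* i) :+ (E :* i :* (E :* i) :+ P :* P :* P :* (i :* i))) _ m i E P ⟩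
        (m * m + E * m + P * P * P + E * E) * (i * i) + (E * i * (E * i) + P * P * P * (i * i))
          ≈⟨ +-cong (*-congʳ (proj₂ resolvent)) (+-congʳ (*-cong Ei≈1 Ei≈1)) ⟩
        0# * (i * i) + (1# * 1# + P * P * P * (i * i))
          ≈⟨ solve 2 (λ i w → con false :* i :+ (con true :* con true :+ w) := con true :+ w) _ (i * i) (P * P * P * (i * i)) ⟩
        1# + P * P * P * (i * i) ∎)
      where
      P = quadratic y
      E = cubic-part y
      i = inv E
      Ei≈1 : E * i ≈ 1#
      Ei≈1 = inv-right (cubic-part≉0 y)
      irr : ∀ x → x * x * x + P * x + E ≉ 0#
      irr x = no-root x y
      resolvent = Conjugates.resolvent-root 𝔽 h q≡2^h 2≤q 2≈0 P E irr (Adjunction.cubicExtension 𝔽 2≈0 P E irr)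
      m = proj₁ resolvent

  open TraceSums 𝔽 h q≡2^h 4≤h 2≤q 2≈0 p r irreducible ext hiding (module F)
  module F = Base
  open Relation.Binary.Reasoning.Setoid setoid

  private
    e⁻ r⁻ k : K
    e⁻ = ι (F.inv e)
    r⁻ = ι (F.inv r)
    k = e⁻ * r⁻

    r≉0 : r F.≉ F.0#
    r≉0 r≈0 = irreducible F.0# (F.trans (F.+-cong (F.+-cong (F.zeroʳ _) (F.zeroʳ p)) r≈0) (F.trans (F.+-identityʳ _) (F.+-identityʳ _)))

    ι-inv : ∀ {x} → x F.≉ F.0# → ι x * ι (F.inv x) ≈ 1#
    ι-inv x≉0 = trans (sym (ι-* _ _)) (trans (ι-cong (F.inv-right x≉0)) ι-1)

    quadratic-K : K → K
    quadratic-K t = ι α * (t * t) + ι a * t + ι β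

    -- The coefficients of 1 / (y + η)² and 1 / (y + η) in P³ / E². From r = η₁ η₂ η₃ and E′ (η₁) =
    -- e η₂ η₃ it follows that k η₁ = 1 / E′ (η₁), and likewise for the conjugates. In
    -- characteristic 2 the square E² has no cubic term at η, and the derivative of P³ is a P².
    s t : K → K
    s η = quadratic-K η * quadratic-K η * quadratic-K η * (k * η * (k * η))
    t η = ι a * (quadratic-K η * quadratic-K η) * (k * η * (k * η))

    -- The summand 1 of P³ / E² + 1 together with the value α³ / e² of P³ / E² at infinity.
    c : K
    c = 1# + ι α * ι α * ι α * (e⁻ * e⁻)

    -- Lagrange interpolation at 0 of a cubic polynomial through v₁, v₂, v₃.
    lagrange : ∀ g₀ g₁ g₂ g₃ v₁ v₂ v₃ →
      let Δ = (v₂ + v₃) * (v₃ + v₁) * (v₁ + v₂)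
          G = λ v → g₀ + g₁ * v + g₂ * (v * v) + g₃ * (v * v * v) in
      g₀ * Δ ≈ g₃ * Δ * (v₁ * v₂ * v₃) + (G v₁ * ((v₂ + v₃) * (v₂ * v₃)) + (G v₂ * ((v₃ + v₁) * (v₃ * v₁)) + G v₃ * ((v₁ + v₂) * (v₁ * v₂))))
    lagrange = solve 7 (λ g₀ g₁ g₂ g₃ v₁ v₂ v₃ →
      let Δ = (v₂ :+ v₃) :* (v₃ :+ v₁) :* (v₁ :+ v₂)
          G = λ v → g₀ :+ g₁ :* v :+ g₂ :* (v :* v) :+ g₃ :* (v :* v :* v) in
      g₀ :* Δ := g₃ :* Δ :* (v₁ :* v₂ :* v₃) :+ (G v₁ :* ((v₂ :+ v₃) :* (v₂ :* v₃)) :+ (G v₂ :* ((v₃ :+ v₁) :* (v₃ :* v₁)) :+ G v₃ :* ((v₁ :+ v₂) :* (v₁ :* v₂))))) _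

    module At (y : F) where
      P u₁ u₂ u₃ Z₁ Z₂ Z₃ V : K
      P = quadratic-K (ι y)
      u₁ = ι y + η₁
      u₂ = ι y + η₂
      u₃ = ι y + η₃
      Z₁ = inv u₁
      Z₂ = inv u₂
      Z₃ = inv u₃
      V = Z₁ * Z₂ * Z₃

      not-root : ∀ t → IsRoot t → ι y + t ≉ 0#
      not-root t root eq = ι-not-root y (IsRoot-cong (sym (+≈0⇒≈ eq)) root)

      u₁Z₁ : u₁ * Z₁ ≈ 1#
      u₁Z₁ = inv-right (not-root η₁ η-root)
      u₂Z₂ : u₂ * Z₂ ≈ 1#
      u₂Z₂ = inv-right (not-root η₂ (σ-root η η-root))
      u₃Z₃ : u₃ * Z₃ ≈ 1#
      u₃Z₃ = inv-right (not-root η₃ η₃-root)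

      ι-quadratic : ι (quadratic y) ≈ P
      ι-quadratic = trans (ι-+ _ _) (+-congʳ (trans (ι-+ _ _) (+-cong (trans (ι-* _ _) (*-congˡ (ι-* _ _))) (ι-* _ _))))

      ι-cubic : ι (cubic-part y) ≈ ι e * (u₁ * u₂ * u₃)
      ι-cubic = trans (ι-* _ _) (*-congˡ (trans (trans (ι-+ _ _) (+-congʳ (trans (ι-+ _ _) (+-cong (trans (ι-* _ _) (*-congʳ (ι-* _ _))) (ι-* _ _)))))
        (factored (ι y))))

      ι-inv-cubic : ι (F.inv (cubic-part y)) ≈ e⁻ * V
      ι-inv-cubic = *-cancelˡ-nonzero (ι-nonzero (cubic-part≉0 y)) (begin
        ι (cubic-part y) * ι (F.inv (cubic-part y)) ≈⟨ ι-inv (cubic-part≉0 y) ⟩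
        1#                                          ≈⟨ solve 0 (con true := con true :* (con true :* con true :* con true)) _ ⟩
        1# * (1# * 1# * 1#)                         ≈⟨ *-cong (ι-inv e≉0) (*-cong (*-cong u₁Z₁ u₂Z₂) u₃Z₃) ⟨
        ι e * e⁻ * (u₁ * Z₁ * (u₂ * Z₂) * (u₃ * Z₃))
          ≈⟨ solve 8 (λ e e⁻ a b c x y z → e :* e⁻ :* (a :* x :* (b :* y) :* (c :* z)) := e :* (a :* b :* c) :* (e⁻ :* (x :* y :* z)))
               _ (ι e) e⁻ u₁ u₂ u₃ Z₁ Z₂ Z₃ ⟩
        ι e * (u₁ * u₂ * u₃) * (e⁻ * V)             ≈⟨ *-congʳ ι-cubic ⟨
        ι (cubic-part y) * (e⁻ * V)                 ∎)

      g₁ g₂ g₃ : K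
      g₁ = P * P * ι α + P * (ι a * ι a)
      g₂ = ι a * ι a * ι α + ι α * ι α * P
      g₃ = ι α * ι α * ι α

      G : K → K
      G v = P * P * P + g₁ * v + g₂ * (v * v) + g₃ * (v * v * v)

      -- Put u = y + t and w = P (t). Both w² and w + a u = P (y) + α u² involve only u², so the
      -- numerators at the three poles are values at uᵢ² of one cubic polynomial, whose constant
      -- term is P (y)³.
      G-square : ∀ t → quadratic-K t * quadratic-K t * (quadratic-K t + ι a * (ι y + t)) ≈ G ((ι y + t) * (ι y + t))
      G-square t = trans (*-cong (*-cong shift shift) (+-congʳ shift))
        (solve 4 (λ p A a u → let w = p :+ a :* u :+ A :* (u :* u) ; v = u :* u in w :* w :* (w :+ a :* u)
           := p :* p :* p :+ (p :* p :* A :+ p :* (a :* a)) :* v :+ (a :* a :* A :+ A :* A :* p) :* (v :* v) :+ A :* A :* A :* (v :* v :* v))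
           _ P (ι α) (ι a) (ι y + t))
        where
        shift : quadratic-K t ≈ P + ι a * (ι y + t) + ι α * ((ι y + t) * (ι y + t))
        shift = solve 5 (λ A a B y t → A :* (t :* t) :+ a :* t :+ B
          := (A :* (y :* y) :+ a :* y :+ B) :+ a :* (y :+ t) :+ A :* ((y :+ t) :* (y :+ t))) _ (ι α) (ι a) (ι β) (ι y) t

      term : ∀ {ζ u u′ u″ z z′ z″ w} → u * z ≈ 1# → u′ * z′ ≈ 1# → u″ * z″ ≈ 1# →
        quadratic-K ζ * quadratic-K ζ * (quadratic-K ζ + ι a * u) ≈ w →
        k * k * (z * z′ * z″ * (z * z′ * z″)) * (w * (ζ * ζ * (u′ * u′ * (u″ * u″)))) ≈ s ζ * (z * z) + t ζ * z
      term {ζ} {u} {u′} {u″} {z} {z′} {z″} {w} uz u′z′ u″z″ eq = begin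
        k * k * (z * z′ * z″ * (z * z′ * z″)) * (w * (ζ * ζ * (u′ * u′ * (u″ * u″))))
          ≈⟨ *-congˡ (*-congʳ (sym eq)) ⟩
        k * k * (z * z′ * z″ * (z * z′ * z″)) * (Pζ * Pζ * (Pζ + ι a * u) * (ζ * ζ * (u′ * u′ * (u″ * u″))))
          ≈⟨ solve 10 (λ k z z′ z″ p a u ζ u′ u″ →
               k :* k :* (z :* z′ :* z″ :* (z :* z′ :* z″)) :* (p :* p :* (p :+ a :* u) :* (ζ :* ζ :* (u′ :* u′ :* (u″ :* u″))))
               := (u′ :* z′) :* (u′ :* z′) :* ((u″ :* z″) :* (u″ :* z″)) :* (p :* p :* p :* (k :* ζ :* (k :* ζ)) :* (z :* z) :+ (u :* z) :* (a :* (p :* p) :* (k :* ζ :* (k :* ζ)) :* z)))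
               _ k z z′ z″ Pζ (ι a) u ζ u′ u″ ⟩
        (u′ * z′) * (u′ * z′) * ((u″ * z″) * (u″ * z″)) * (s ζ * (z * z) + (u * z) * (t ζ * z))
          ≈⟨ *-cong (*-cong (*-cong u′z′ u′z′) (*-cong u″z″ u″z″)) (+-congˡ (*-congʳ uz)) ⟩
        1# * 1# * (1# * 1#) * (s ζ * (z * z) + 1# * (t ζ * z))
          ≈⟨ solve 2 (λ x y → con true :* con true :* (con true :* con true) :* (x :+ con true :* y) := x :+ y) _ _ _ ⟩
        s ζ * (z * z) + t ζ * z ∎
        where Pζ = quadratic-K ζ

      v₁ v₂ v₃ Δ : K
      v₁ = u₁ * u₁
      v₂ = u₂ * u₂
      v₃ = u₃ * u₃
      Δ = (v₂ + v₃) * (v₃ + v₁) * (v₁ + v₂)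

      η₁² : v₂ + v₃ ≈ η₁ * η₁
      η₁² = solve 3 (λ y a b → let u = y :+ b ; w = y :+ (a :+ b) in u :* u :+ w :* w := a :* a) _ (ι y) η₁ η₂
      η₂² : v₃ + v₁ ≈ η₂ * η₂
      η₂² = solve 3 (λ y a b → let u = y :+ (a :+ b) ; w = y :+ a in u :* u :+ w :* w := b :* b) _ (ι y) η₁ η₂
      η₃² : v₁ + v₂ ≈ η₃ * η₃
      η₃² = solve 3 (λ y a b → let u = y :+ a ; w = y :+ b in u :* u :+ w :* w := (a :+ b) :* (a :+ b)) _ (ι y) η₁ η₂

      -- Δ is the Vandermonde determinant of the nodes uᵢ². Their differences are the squares of the
      -- roots ηᵢ, so Δ = r² for every y.
      r⁻²Δ : r⁻ * r⁻ * Δ ≈ 1#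
      r⁻²Δ = begin
        r⁻ * r⁻ * Δ ≈⟨ *-congˡ (*-cong (*-cong η₁² η₂²) η₃²) ⟩
        r⁻ * r⁻ * (η₁ * η₁ * (η₂ * η₂) * (η₃ * η₃))
          ≈⟨ solve 4 (λ r a b c → r :* r :* (a :* a :* (b :* b) :* (c :* c)) := a :* b :* c :* r :* (a :* b :* c :* r)) _ r⁻ η₁ η₂ η₃ ⟩
        η₁ * η₂ * η₃ * r⁻ * (η₁ * η₂ * η₃ * r⁻) ≈⟨ *-cong (*-congʳ e₃) (*-congʳ e₃) ⟨
        ι r * r⁻ * (ι r * r⁻) ≈⟨ trans (*-cong (ι-inv r≉0) (ι-inv r≉0)) (*-identityˡ 1#) ⟩
        1# ∎

      -- Interpolating `G` at 0 from the nodes uᵢ² expresses P³ through the numerators at the poles;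
      -- division by E² turns this into the partial fraction expansion.
      expansion : P * P * P * (e⁻ * V * (e⁻ * V)) ≈
        ι α * ι α * ι α * (e⁻ * e⁻) + ((s η₁ * (Z₁ * Z₁) + t η₁ * Z₁) + ((s η₂ * (Z₂ * Z₂) + t η₂ * Z₂) + (s η₃ * (Z₃ * Z₃) + t η₃ * Z₃)))
      expansion = begin
        P * P * P * (e⁻ * V * (e⁻ * V))
          ≈⟨ trans (sym (*-identityˡ _)) (*-congʳ (sym r⁻²Δ)) ⟩
        r⁻ * r⁻ * Δ * (P * P * P * (e⁻ * V * (e⁻ * V)))
          ≈⟨ solve 5 (λ r d g e v → r :* r :* d :* (g :* (e :* v :* (e :* v))) := e :* r :* (e :* r) :* (v :* v) :* (g :* d)) _ r⁻ Δ (P * P * P) e⁻ V ⟩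
        k * k * (V * V) * (P * P * P * Δ)
          ≈⟨ *-congˡ (lagrange (P * P * P) g₁ g₂ g₃ v₁ v₂ v₃) ⟩
        k * k * (V * V) * (g₃ * Δ * (v₁ * v₂ * v₃) + (G v₁ * ((v₂ + v₃) * (v₂ * v₃)) + (G v₂ * ((v₃ + v₁) * (v₃ * v₁)) + G v₃ * ((v₁ + v₂) * (v₁ * v₂)))))
          ≈⟨ *-congˡ (+-congˡ (+-cong (*-congˡ (*-congʳ η₁²)) (+-cong (*-congˡ (*-congʳ η₂²)) (*-congˡ (*-congʳ η₃²))))) ⟩
        k * k * (V * V) * (g₃ * Δ * (v₁ * v₂ * v₃) + (G v₁ * (η₁ * η₁ * (v₂ * v₃)) + (G v₂ * (η₂ * η₂ * (v₃ * v₁)) + G v₃ * (η₃ * η₃ * (v₁ * v₂)))))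
          ≈⟨ solve 5 (λ m a b c d → m :* (a :+ (b :+ (c :+ d))) := m :* a :+ (m :* b :+ (m :* c :+ m :* d))) _ (k * k * (V * V)) _ _ _ _ ⟩
        k * k * (V * V) * (g₃ * Δ * (v₁ * v₂ * v₃)) + (k * k * (V * V) * (G v₁ * (η₁ * η₁ * (v₂ * v₃)))
          + (k * k * (V * V) * (G v₂ * (η₂ * η₂ * (v₃ * v₁))) + k * k * (V * V) * (G v₃ * (η₃ * η₃ * (v₁ * v₂)))))
          ≈⟨ +-cong constant (+-cong (term u₁Z₁ u₂Z₂ u₃Z₃ (G-square η₁))
               (+-cong (trans (*-congʳ (*-congˡ (*-cong rotate rotate))) (term u₂Z₂ u₃Z₃ u₁Z₁ (G-square η₂)))
                 (trans (*-congʳ (*-congˡ (*-cong (sym rotate′) (sym rotate′)))) (term u₃Z₃ u₁Z₁ u₂Z₂ (G-square η₃))))) ⟩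
        ι α * ι α * ι α * (e⁻ * e⁻) + ((s η₁ * (Z₁ * Z₁) + t η₁ * Z₁) + ((s η₂ * (Z₂ * Z₂) + t η₂ * Z₂) + (s η₃ * (Z₃ * Z₃) + t η₃ * Z₃))) ∎
        where
        rotate : V ≈ Z₂ * Z₃ * Z₁
        rotate = solve 3 (λ a b c → a :* b :* c := b :* c :* a) _ Z₁ Z₂ Z₃
        rotate′ : Z₃ * Z₁ * Z₂ ≈ V
        rotate′ = solve 3 (λ a b c → c :* a :* b := a :* b :* c) _ Z₁ Z₂ Z₃
        constant : k * k * (V * V) * (g₃ * Δ * (v₁ * v₂ * v₃)) ≈ ι α * ι α * ι α * (e⁻ * e⁻)
        constant = begin
          k * k * (V * V) * (g₃ * Δ * (v₁ * v₂ * v₃))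
            ≈⟨ solve 10 (λ e r z₁ z₂ z₃ g d u₁ u₂ u₃ → e :* r :* (e :* r) :* (z₁ :* z₂ :* z₃ :* (z₁ :* z₂ :* z₃)) :* (g :* d :* (u₁ :* u₁ :* (u₂ :* u₂) :* (u₃ :* u₃)))
                 := g :* (e :* e) :* (r :* r :* d :* (u₁ :* z₁ :* (u₁ :* z₁) :* (u₂ :* z₂ :* (u₂ :* z₂)) :* (u₃ :* z₃ :* (u₃ :* z₃))))) _ e⁻ r⁻ Z₁ Z₂ Z₃ g₃ Δ u₁ u₂ u₃ ⟩
          g₃ * (e⁻ * e⁻) * (r⁻ * r⁻ * Δ * (u₁ * Z₁ * (u₁ * Z₁) * (u₂ * Z₂ * (u₂ * Z₂)) * (u₃ * Z₃ * (u₃ * Z₃))))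
            ≈⟨ *-congˡ (*-cong r⁻²Δ (*-cong (*-cong (*-cong u₁Z₁ u₁Z₁) (*-cong u₂Z₂ u₂Z₂)) (*-cong u₃Z₃ u₃Z₃))) ⟩
          g₃ * (e⁻ * e⁻) * (1# * (1# * 1# * (1# * 1#) * (1# * 1#)))
            ≈⟨ solve 1 (λ x → let 𝟙 = con true in x :* (𝟙 :* (𝟙 :* 𝟙 :* (𝟙 :* 𝟙) :* (𝟙 :* 𝟙))) := x) _ (g₃ * (e⁻ * e⁻)) ⟩
          g₃ * (e⁻ * e⁻) ∎

      traceless : trace h (partial-fractions 0 z≤n c (s η₁) (t η₁) (s η₂) (t η₂) (s η₃) (t η₃) y) ≈ 0#
      traceless = trans (trace-cong h (sym (begin
        ι g * ι g + ι g               ≈⟨ trans (ι-+ _ _) (+-congʳ (ι-* _ _)) ⟨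
        ι (g F.* g F.+ g)             ≈⟨ ι-cong (proj₂ (artin-schreier y)) ⟩
        ι (F.1# F.+ quadratic y F.* quadratic y F.* quadratic y F.* (F.inv (cubic-part y) F.* F.inv (cubic-part y)))
          ≈⟨ trans (ι-+ _ _) (+-cong ι-1 (trans (ι-* _ _) (*-cong (trans (ι-* _ _) (*-congʳ (ι-* _ _))) (ι-* _ _)))) ⟩
        1# + ι (quadratic y) * ι (quadratic y) * ι (quadratic y) * (ι (F.inv (cubic-part y)) * ι (F.inv (cubic-part y)))
          ≈⟨ +-congˡ (*-cong (*-cong (*-cong ι-quadratic ι-quadratic) ι-quadratic) (*-cong ι-inv-cubic ι-inv-cubic)) ⟩
        1# + P * P * P * (e⁻ * V * (e⁻ * V)) ≈⟨ +-congˡ expansion ⟩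
        1# + (ι α * ι α * ι α * (e⁻ * e⁻) + ((s η₁ * (Z₁ * Z₁) + t η₁ * Z₁) + ((s η₂ * (Z₂ * Z₂) + t η₂ * Z₂) + (s η₃ * (Z₃ * Z₃) + t η₃ * Z₃))))
          ≈⟨ +-assoc _ _ _ ⟨
        partial-fractions 0 z≤n c (s η₁) (t η₁) (s η₂) (t η₂) (s η₃) (t η₃) y ∎))) (trace-ι[g²+g] g)
        where g = proj₁ (artin-schreier y)

    Q : K
    Q = quadratic-K η₁

    -- With w = 1 / E′ (η)², the relation s = t² at η reads Q³ w = a² Q⁴ w²; cancel Q³ w.
    key : Q ≉ 0# → ι a * ι a * Q * (k * η₁ * (k * η₁)) ≈ 1#
    key Q≉0 = *-cancelˡ-nonzero (*-nonzero (*-nonzero (*-nonzero Q≉0 Q≉0) Q≉0) (*-nonzero w≉0 w≉0)) (begin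
      s η₁ * (ι a * ι a * Q * (k * η₁ * (k * η₁)))
        ≈⟨ solve 3 (λ q a w → q :* q :* q :* w :* (a :* a :* q :* w) := a :* (q :* q) :* w :* (a :* (q :* q) :* w)) _ Q (ι a) (k * η₁ * (k * η₁)) ⟩
      t η₁ * t η₁  ≈⟨ traceless⇒s≈t² c (s η₁) (t η₁) (s η₂) (t η₂) (s η₃) (t η₃) At.traceless ⟨
      s η₁         ≈⟨ *-identityʳ _ ⟨
      s η₁ * 1#    ∎)
      where
      w≉0 : k * η₁ ≉ 0#
      w≉0 = *-nonzero (*-nonzero (ι-nonzero (F.inv-nonzero e≉0)) (ι-nonzero (F.inv-nonzero r≉0))) η₁≉0

    Q≈0⇒ : Q ≈ 0# → β F.≈ F.0# × a F.≈ F.0# × α F.≈ F.0#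
    Q≈0⇒ Q≈0 = independent β a α (trans (solve 3 (λ x y z → x :+ y :+ z := z :+ y :+ x) _ _ _ _) Q≈0)

  -- For a = 0 the relation `key` would read 0 = 1. So Q = 0, and the independence of 1, η, η²
  -- removes all coefficients of P.
  a≈0⇒α≈0 : a F.≈ F.0# → α F.≈ F.0#
  a≈0⇒α≈0 a≈0 = proj₂ (proj₂ (Q≈0⇒ (decidable-stable (Q ≟ 0#) λ Q≉0 → 1≉0 (begin
    1#                                    ≈⟨ key Q≉0 ⟨
    ι a * ι a * Q * (k * η₁ * (k * η₁))   ≈⟨ *-congʳ (*-congʳ (*-congʳ (trans (ι-cong a≈0) ι-0))) ⟩
    0# * ι a * Q * (k * η₁ * (k * η₁))    ≈⟨ solve 3 (λ a q w → con false :* a :* q :* w := con false) _ (ι a) Q _ ⟩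
    0#                                    ∎))))

  module Split (a≉0 : a F.≉ F.0#) where
    private
      -- `key` says a² Q = E′ (η)² = e² (η₂ η₃)². Writing the right side in the basis 1, η, η²
      -- allows a comparison of coefficients over the base field.
      a²Q : ι a * ι a * Q ≈ ι e * ι e * (ι p * (η * η) + ι r * η + ι p * ι p)
      a²Q = begin
        ι a * ι a * Q
          ≈⟨ solve 1 (λ x → x := x :* (con true :* con true)) _ (ι a * ι a * Q) ⟩
        ι a * ι a * Q * (1# * 1#) ≈⟨ *-congˡ (*-cong unit unit) ⟨
        ι a * ι a * Q * (k * η₁ * (ι e * (η₂ * η₃)) * (k * η₁ * (ι e * (η₂ * η₃))))
          ≈⟨ solve 4 (λ q w e m → q :* (w :* (e :* m) :* (w :* (e :* m))) := q :* (w :* w) :* (e :* e :* (m :* m))) _ (ι a * ι a * Q) (k * η₁) (ι e) (η₂ * η₃) ⟩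
        ι a * ι a * Q * (k * η₁ * (k * η₁)) * (ι e * ι e * (η₂ * η₃ * (η₂ * η₃)))
          ≈⟨ trans (*-congʳ (key (λ Q≈0 → a≉0 (proj₁ (proj₂ (Q≈0⇒ Q≈0)))))) (*-identityˡ _) ⟩
        ι e * ι e * (η₂ * η₃ * (η₂ * η₃)) ≈⟨ *-congˡ (begin
            η₂ * η₃ * (η₂ * η₃)
              ≈⟨ solve 2 (λ x y → let z = x :+ y ; p = x :* x :+ x :* y :+ y :* y ; r = x :* y :* z in
                   y :* z :* (y :* z) := p :* (x :* x) :+ r :* x :+ p :* p) _ η₁ η₂ ⟩
            _ ≈⟨ +-cong (+-cong (*-congʳ e₂) (*-congʳ e₃)) (*-cong e₂ e₂) ⟨
            ι p * (η * η) + ι r * η + ι p * ι p ∎) ⟩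
        ι e * ι e * (ι p * (η * η) + ι r * η + ι p * ι p) ∎
        where
        unit : k * η₁ * (ι e * (η₂ * η₃)) ≈ 1#
        unit = begin
          k * η₁ * (ι e * (η₂ * η₃))
            ≈⟨ solve 6 (λ e r x e′ y z → e :* r :* x :* (e′ :* (y :* z)) := (e′ :* e) :* (x :* y :* z :* r)) _ e⁻ r⁻ η₁ (ι e) η₂ η₃ ⟩
          ι e * e⁻ * (η₁ * η₂ * η₃ * r⁻) ≈⟨ *-cong (ι-inv e≉0) (trans (*-congʳ (sym e₃)) (ι-inv r≉0)) ⟩
          1# * 1# ≈⟨ *-identityˡ 1# ⟩
          1# ∎

      coefficients : (a F.* a F.* β F.+ e F.* e F.* (p F.* p) F.≈ F.0#) × (a F.* a F.* a F.+ e F.* e F.* r F.≈ F.0#) × (a F.* a F.* α F.+ e F.* e F.* p F.≈ F.0#)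
      coefficients = independent _ _ _ (begin
        ι (a F.* a F.* β F.+ e F.* e F.* (p F.* p)) + ι (a F.* a F.* a F.+ e F.* e F.* r) * η + ι (a F.* a F.* α F.+ e F.* e F.* p) * (η * η)
          ≈⟨ +-cong (+-cong (ι-coefficient β (ι-* p p)) (*-congʳ (ι-coefficient a refl))) (*-congʳ (ι-coefficient α refl)) ⟩
        (ι a * ι a * ι β + ι e * ι e * (ι p * ι p)) + (ι a * ι a * ι a + ι e * ι e * ι r) * η + (ι a * ι a * ι α + ι e * ι e * ι p) * (η * η)
          ≈⟨ solve 7 (λ a α β e p r x → (a :* a :* β :+ e :* e :* (p :* p)) :+ (a :* a :* a :+ e :* e :* r) :* x :+ (a :* a :* α :+ e :* e :* p) :* (x :* x)
               := a :* a :* (α :* (x :* x) :+ a :* x :+ β) :+ e :* e :* (p :* (x :* x) :+ r :* x :+ p :* p)) _ (ι a) (ι α) (ι β) (ι e) (ι p) (ι r) η ⟩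
        ι a * ι a * Q + ι e * ι e * (ι p * (η * η) + ι r * η + ι p * ι p) ≈⟨ ≈⇒+≈0 a²Q ⟩
        0# ∎)
        where
        ι-coefficient : ∀ x {y w} → ι y ≈ w → ι (a F.* a F.* x F.+ e F.* e F.* y) ≈ ι a * ι a * ι x + ι e * ι e * w
        ι-coefficient x eq = trans (ι-+ _ _) (+-cong (trans (ι-* _ _) (*-congʳ (ι-* _ _))) (trans (ι-* _ _) (*-cong (ι-* _ _) eq)))

    -- In terms of τ = e / a the comparison reads α = τ² p, a = τ² r, β = τ² p² and e = τ³ r, which
    -- are the coefficients of the norm of x + τ η y + τ η² z.
    τ : F
    τ = e F.* F.inv a

    τ≉0 : τ F.≉ F.0#
    τ≉0 = F.*-nonzero e≉0 (F.inv-nonzero a≉0)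

    private
      α≈ : α F.≈ τ F.* τ F.* p
      α≈ = divide a≉0 (proj₂ (proj₂ coefficients))
      a≈ : a F.≈ τ F.* τ F.* r
      a≈ = divide a≉0 (proj₁ (proj₂ coefficients))
      β≈ : β F.≈ τ F.* τ F.* (p F.* p)
      β≈ = divide a≉0 (proj₁ coefficients)
      e≈ : e F.≈ τ F.* (τ F.* τ F.* r)
      e≈ = F.trans (F.sym (F.trans (F.*-assoc _ _ _) (F.trans (F.*-congˡ (F.trans (F.*-comm _ _) (F.inv-right a≉0))) (F.*-identityʳ e)))) (F.*-congˡ a≈)

    factor : K → K → K → K → K
    factor ζ x y z = x + ι τ * ζ * y + ι τ * (ζ * ζ) * z

    splits : ∀ x y z →
      ι (x F.* x F.* x F.+ x F.* (α F.* (y F.* y) F.+ a F.* (y F.* z) F.+ β F.* (z F.* z)) F.+ e F.* (y F.* y F.* y F.+ p F.* (y F.* (z F.* z)) F.+ r F.* (z F.* z F.* z)))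
      ≈ factor η₁ (ι x) (ι y) (ι z) * factor η₂ (ι x) (ι y) (ι z) * factor η₃ (ι x) (ι y) (ι z)
    splits x y z = begin
      _ ≈⟨ trans (ι-+ _ _) (+-cong (trans (ι-+ _ _) (+-cong (trans (ι-* _ _) (*-congʳ (ι-* _ _)))
             (trans (ι-* _ _) (*-congˡ (trans (ι-+ _ _) (+-cong (trans (ι-+ _ _) (+-cong (ι-term α≈ (τ²× p) y y) (ι-term a≈ (τ²× r) y z)))
               (ι-term β≈ (trans (τ²× (p F.* p)) (*-congˡ (ι-* p p))) z z)))))))
             (trans (ι-* _ _) (*-cong (trans (ι-cong e≈) (trans (ι-* _ _) (*-congˡ (τ²× r))))
               (trans (ι-+ _ _) (+-cong (trans (ι-+ _ _) (+-cong (trans (ι-* _ _) (*-congʳ (ι-* _ _))) (trans (ι-* _ _) (*-congˡ (trans (ι-* _ _) (*-congˡ (ι-* _ _)))))))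
                 (trans (ι-* _ _) (*-congˡ (trans (ι-* _ _) (*-congʳ (ι-* _ _)))))))))) ⟩
      form (ι p) (ι r) ≈⟨ form-cong e₂ e₃ ⟩
      form (η₁ * η₁ + η₁ * η₂ + η₂ * η₂) (η₁ * η₂ * η₃)
        ≈⟨ solve 6 (λ X Y Z T a b → let p = a :* a :+ a :* b :+ b :* b ; c = a :+ b ; r = a :* b :* c ; f = λ ζ → X :+ T :* ζ :* Y :+ T :* (ζ :* ζ) :* Z in
             X :* X :* X :+ X :* (T :* T :* p :* (Y :* Y) :+ T :* T :* r :* (Y :* Z) :+ T :* T :* (p :* p) :* (Z :* Z))
               :+ T :* (T :* T :* r) :* (Y :* Y :* Y :+ p :* (Y :* (Z :* Z)) :+ r :* (Z :* Z :* Z))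
             := f a :* f b :* f c) _ (ι x) (ι y) (ι z) (ι τ) η₁ η₂ ⟩
      factor η₁ (ι x) (ι y) (ι z) * factor η₂ (ι x) (ι y) (ι z) * factor η₃ (ι x) (ι y) (ι z) ∎
      where
      form : K → K → K
      form p r = ι x * ι x * ι x + ι x * (ι τ * ι τ * p * (ι y * ι y) + ι τ * ι τ * r * (ι y * ι z) + ι τ * ι τ * (p * p) * (ι z * ι z))
        + ι τ * (ι τ * ι τ * r) * (ι y * ι y * ι y + p * (ι y * (ι z * ι z)) + r * (ι z * ι z * ι z))
      form-cong : ∀ {p p′ r r′} → p ≈ p′ → r ≈ r′ → form p r ≈ form p′ r′
      form-cong p r = +-cong (+-congˡ (*-congˡ (+-cong (+-cong (*-congʳ (*-congˡ p)) (*-congʳ (*-congˡ r))) (*-congʳ (*-congˡ (*-cong p p))))))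
        (*-cong (*-congˡ (*-congˡ r)) (+-cong (+-congˡ (*-congʳ p)) (*-congʳ r)))
      τ²× : ∀ w → ι (τ F.* τ F.* w) ≈ ι τ * ι τ * ι w
      τ²× w = trans (ι-* _ _) (*-congʳ (ι-* _ _))
      ι-term : ∀ {c d w} → c F.≈ d → ι d ≈ w → ∀ u v → ι (c F.* (u F.* v)) ≈ w * (ι u * ι v)
      ι-term c≈d d≈w u v = trans (ι-* _ _) (*-cong (trans (ι-cong c≈d) d≈w) (ι-* u v))

-- Reducing a cubic form to depressed shape

module Depression {q : ℕ} (𝔽 : FiniteField q)
  (2≈0 : TwoIsZero (FiniteField.ring 𝔽))
  (c : Cubic (CommutativeRing.Carrier (FiniteField.ring 𝔽)))
  (anisotropic : CubicForm.Anisotropic (FiniteField.ring 𝔽) c) where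
  open Field 𝔽
  open CharTwo R 2≈0
  open CubicForm R
  open Cubic c
  open Relation.Binary.Reasoning.Setoid setoid

  d i : F
  d = d₁₁
  i = inv d

  private
    formₚ : ∀ {k} (a b c d e f g h i m x y z : Polynomial k) → Polynomial k
    formₚ a b c d e f g h i m x y z = x :* (a :* (x :* x) :+ b :* (y :* y) :+ c :* (z :* z)) :+ y :* (d :* (x :* x) :+ e :* (y :* y) :+ f :* (z :* z))
      :+ z :* (g :* (x :* x) :+ h :* (y :* y) :+ i :* (z :* z)) :+ m :* (x :* (y :* z))

  d≉0 : d ≉ 0#
  d≉0 d≈0 = anisotropic 1# 0# 0# (λ (1≈0 , _) → 1≉0 1≈0) (trans
    (solve 10 (λ a b c d e f g h i m → formₚ a b c d e f g h i m (con true) (con false) (con false) := a)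
      _ d₁₁ d₁₂ d₁₃ d₂₁ d₂₂ d₂₃ d₃₁ d₃₂ d₃₃ m) d≈0)

  -- c (x , y , z) = d N (x + b y + b′ z , y , z) with N monic in its first variable and without square term.
  b b′ α a β₀ e e₁ e₂ e₃ : F
  b  = i * d₂₁
  b′ = i * d₃₁
  a  = i * m
  α  = b * b + i * d₁₂
  β₀ = b′ * b′ + i * d₁₃
  e  = b * (i * d₁₂) + i * d₂₂
  e₁ = b * a + b′ * (i * d₁₂) + i * d₃₂
  e₂ = b * (i * d₁₃) + b′ * a + i * d₂₃
  e₃ = b′ * (i * d₁₃) + i * d₃₃

  N : F → F → F → F
  N x y z = x * x * x + x * (α * (y * y) + a * (y * z) + β₀ * (z * z)) + (e * (y * y * y) + e₁ * (y * y * z) + e₂ * (y * (z * z)) + e₃ * (z * z * z))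

  private
    unscale : ∀ x → x ≈ d * (i * x)
    unscale x = trans (sym (*-identityˡ x)) (trans (*-congʳ (sym (inv-right d≉0))) (*-assoc d i x))

  depressed : ∀ x y z → ⟦ c ⟧ x y z ≈ d * N (x + b * y + b′ * z) y z
  depressed x y z = begin
    ⟦ c ⟧ x y z
      ≈⟨ +-cong (+-cong (+-cong
           (*-congˡ (+-cong (+-congˡ (*-congʳ (unscale d₁₂))) (*-congʳ (unscale d₁₃))))
           (*-congˡ (+-cong (+-cong (*-congʳ (unscale d₂₁)) (*-congʳ (unscale d₂₂))) (*-congʳ (unscale d₂₃)))))
           (*-congˡ (+-cong (+-cong (*-congʳ (unscale d₃₁)) (*-congʳ (unscale d₃₂))) (*-congʳ (unscale d₃₃)))))
           (*-congʳ (unscale m)) ⟩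
    ⟦ cubic d (d * (i * d₁₂)) (d * (i * d₁₃)) (d * b) (d * (i * d₂₂)) (d * (i * d₂₃)) (d * b′) (d * (i * d₃₂)) (d * (i * d₃₃)) (d * a) ⟧ x y z
      ≈⟨ solve 13 (λ d c₁₂ c₁₃ b c₂₂ c₂₃ b′ c₃₂ c₃₃ a x y z →
           formₚ d (d :* c₁₂) (d :* c₁₃) (d :* b) (d :* c₂₂) (d :* c₂₃) (d :* b′) (d :* c₃₂) (d :* c₃₃) (d :* a) x y z
           := (let X = x :+ b :* y :+ b′ :* z in d :* (X :* X :* X :+ X :* ((b :* b :+ c₁₂) :* (y :* y) :+ a :* (y :* z) :+ (b′ :* b′ :+ c₁₃) :* (z :* z))
                :+ ((b :* c₁₂ :+ c₂₂) :* (y :* y :* y) :+ (b :* a :+ b′ :* c₁₂ :+ c₃₂) :* (y :* y :* z) :+ (b :* c₁₃ :+ b′ :* a :+ c₂₃) :* (y :* (z :* z)) :+ (b′ :* c₁₃ :+ c₃₃) :* (z :* z :* z)))))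
           _ d (i * d₁₂) (i * d₁₃) b (i * d₂₂) (i * d₂₃) b′ (i * d₃₂) (i * d₃₃) a x y z ⟩
    d * N (x + b * y + b′ * z) y z ∎

  private
    product-cong : ∀ {x x′ y y′ z z′} → x ≈ x′ → y ≈ y′ → z ≈ z′ → x * y * z ≈ x′ * y′ * z′
    product-cong x y z = *-cong (*-cong x y) z

    N-cong : ∀ {x x′ y y′ z z′} → x ≈ x′ → y ≈ y′ → z ≈ z′ → N x y z ≈ N x′ y′ z′
    N-cong x y z = +-cong (+-cong (product-cong x x x) (*-cong x (+-cong (+-cong (*-congˡ (*-cong y y)) (*-congˡ (*-cong y z))) (*-congˡ (*-cong z z)))))
      (+-cong (+-cong (+-cong (*-congˡ (product-cong y y y)) (*-congˡ (product-cong y y z))) (*-congˡ (*-cong y (*-cong z z)))) (*-congˡ (product-cong z z z)))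

    zero-sum : ∀ {x u v y z} → x + u * y + v * z ≈ 0# → y ≈ 0# → z ≈ 0# → x ≈ 0#
    zero-sum {x} {u} {v} {y} {z} eq y≈0 z≈0 = begin
      x                     ≈⟨ solve 3 (λ x u v → x := x :+ u :* con false :+ v :* con false) _ x u v ⟩
      x + u * 0# + v * 0#   ≈⟨ +-cong (+-congˡ (*-congˡ (sym y≈0))) (*-congˡ (sym z≈0)) ⟩
      x + u * y + v * z     ≈⟨ eq ⟩
      0#                    ∎

  N-anisotropic : ∀ x y z → ¬ (x ≈ 0# × y ≈ 0# × z ≈ 0#) → N x y z ≉ 0#
  N-anisotropic x y z ≉0 N≈0 = anisotropic (x + b * y + b′ * z) y z (λ (x′≈0 , y≈0 , z≈0) → ≉0 (zero-sum x′≈0 y≈0 z≈0 , y≈0 , z≈0)) (begin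
    ⟦ c ⟧ (x + b * y + b′ * z) y z                     ≈⟨ depressed _ y z ⟩
    d * N (x + b * y + b′ * z + b * y + b′ * z) y z
      ≈⟨ *-congˡ (N-cong (solve 5 (λ x u v y z → x :+ u :* y :+ v :* z :+ u :* y :+ v :* z := x) _ x b b′ y z) refl refl) ⟩
    d * N x y z                                        ≈⟨ trans (*-congˡ N≈0) (zeroʳ d) ⟩
    0#                                                 ∎)

  e≉0 : e ≉ 0#
  e≉0 e≈0 = N-anisotropic 0# 1# 0# (λ (_ , 1≈0 , _) → 1≉0 1≈0) (trans
    (solve 7 (λ α a β e e₁ e₂ e₃ → let x = con false ; y = con true ; z = con false in
       x :* x :* x :+ x :* (α :* (y :* y) :+ a :* (y :* z) :+ β :* (z :* z)) :+ (e :* (y :* y :* y) :+ e₁ :* (y :* y :* z) :+ e₂ :* (y :* (z :* z)) :+ e₃ :* (z :* z :* z)) := e)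
       _ α a β₀ e e₁ e₂ e₃) e≈0)

  -- N (x , y , z) = n (x , y + λ₀ z , z), where the binary cubic part of n is depressed as well.
  λ₀ β p r : F
  λ₀ = inv e * e₁
  β = β₀ + a * λ₀ + α * (λ₀ * λ₀)
  p = λ₀ * λ₀ + inv e * e₂
  r = λ₀ * (inv e * e₂) + inv e * e₃

  n : F → F → F → F
  n x y z = x * x * x + x * (α * (y * y) + a * (y * z) + β * (z * z)) + e * (y * y * y + p * (y * (z * z)) + r * (z * z * z))

  n-depressed : ∀ x y z → N x y z ≈ n x (y + λ₀ * z) z
  n-depressed x y z = begin
    N x y z ≈⟨ +-congˡ (+-cong (+-cong (+-congˡ (*-congʳ (unscale-e e₁))) (*-congʳ (unscale-e e₂))) (*-congʳ (unscale-e e₃))) ⟩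
    x * x * x + x * (α * (y * y) + a * (y * z) + β₀ * (z * z)) + (e * (y * y * y) + e * λ₀ * (y * y * z) + e * (inv e * e₂) * (y * (z * z)) + e * (inv e * e₃) * (z * z * z))
      ≈⟨ solve 10 (λ x y z α a β e l f g →
           x :* x :* x :+ x :* (α :* (y :* y) :+ a :* (y :* z) :+ β :* (z :* z)) :+ (e :* (y :* y :* y) :+ e :* l :* (y :* y :* z) :+ e :* f :* (y :* (z :* z)) :+ e :* g :* (z :* z :* z))
           := (let Y = y :+ l :* z in x :* x :* x :+ x :* (α :* (Y :* Y) :+ a :* (Y :* z) :+ (β :+ a :* l :+ α :* (l :* l)) :* (z :* z))
                :+ e :* (Y :* Y :* Y :+ (l :* l :+ f) :* (Y :* (z :* z)) :+ (l :* f :+ g) :* (z :* z :* z))))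
           _ x y z α a β₀ e λ₀ (inv e * e₂) (inv e * e₃) ⟩
    n x (y + λ₀ * z) z ∎
    where
    unscale-e : ∀ x → x ≈ e * (inv e * x)
    unscale-e x = trans (sym (*-identityˡ x)) (trans (*-congʳ (sym (inv-right e≉0))) (*-assoc e (inv e) x))

  n-anisotropic : ∀ x y z → ¬ (x ≈ 0# × y ≈ 0# × z ≈ 0#) → n x y z ≉ 0#
  n-anisotropic x y z ≉0 n≈0 = N-anisotropic x (y + λ₀ * z) z
    (λ (x≈0 , y′≈0 , z≈0) → ≉0 (x≈0 , zero-sum (trans (trans (+-congˡ (zeroˡ 0#)) (+-identityʳ _)) y′≈0) z≈0 refl , z≈0)) (begin
    N x (y + λ₀ * z) z          ≈⟨ n-depressed x _ z ⟩
    n x (y + λ₀ * z + λ₀ * z) z ≈⟨ n-cong (solve 3 (λ y l z → y :+ l :* z :+ l :* z := y) _ y λ₀ z) ⟩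
    n x y z                     ≈⟨ n≈0 ⟩
    0#                          ∎)
    where
    n-cong : ∀ {y y′} → y ≈ y′ → n x y z ≈ n x y′ z
    n-cong y = +-cong (+-congˡ (*-congˡ (+-congʳ (+-cong (*-congˡ (*-cong y y)) (*-congˡ (*-congʳ y))))))
      (*-congˡ (+-congʳ (+-cong (product-cong y y y) (*-congˡ (*-congʳ y)))))

  irreducible : Rootless R p r
  irreducible y eq = n-anisotropic 0# y 1# (λ (_ , _ , 1≈0) → 1≉0 1≈0) (trans
    (solve 7 (λ α a β e p r y → let 𝟘 = con false ; 𝟙 = con true in
      𝟘 :* 𝟘 :* 𝟘 :+ 𝟘 :* (α :* (y :* y) :+ a :* (y :* 𝟙) :+ β :* (𝟙 :* 𝟙)) :+ e :* (y :* y :* y :+ p :* (y :* (𝟙 :* 𝟙)) :+ r :* (𝟙 :* 𝟙 :* 𝟙))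
      := e :* (y :* y :* y :+ p :* y :+ r)) _ α a β e p r y) (trans (*-congˡ eq) (zeroʳ e)))

  extension : CubicExtension 𝔽 p r
  extension = Adjunction.cubicExtension 𝔽 2≈0 p r irreducible

-- Anisotropic cubic forms as norm forms

record Factored {q : ℕ} (𝔽 : FiniteField q) (h : ℕ) (q≡2^h : q ≡ 2 ℕ.^ h) (2≤q : 2 ≤ q)
  (2≈0 : TwoIsZero (FiniteField.ring 𝔽))
  (c : Cubic (CommutativeRing.Carrier (FiniteField.ring 𝔽))) : Set₁ where
  private
    module F = Field 𝔽
    open F using (F)
    open CubicForm F.R
  field
    p r : F
    irreducible : ∀ x → x F.* x F.* x F.+ p F.* x F.+ r F.≉ F.0#
    ext : CubicExtension 𝔽 p r
  open Conjugates 𝔽 h q≡2^h 2≤q 2≈0 p r irreducible ext hiding (module F)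
  field
    d : F
    d≉0 : d F.≉ F.0#
    X₁ X₂ X₃ Y₁ Y₂ Y₃ : K
    σX₁ : σ X₁ ≈ X₂
    σX₂ : σ X₂ ≈ X₃
    σX₃ : σ X₃ ≈ X₁
    σY₁ : σ Y₁ ≈ Y₂
    σY₂ : σ Y₂ ≈ Y₃
    σY₃ : σ Y₃ ≈ Y₁

  ℓ : K → K → F → F → F → K
  ℓ X Y x y z = ι x + X * ι y + Y * ι z

  -- The determinant of the matrix with rows 1, Xᵢ, Yᵢ; it is nonzero exactly when 1, X₁, Y₁ form a
  -- basis over the base field.
  determinant : K
  determinant = (X₂ * Y₃ + X₃ * Y₂) + (X₃ * Y₁ + X₁ * Y₃) + (X₁ * Y₂ + X₂ * Y₁)

  field
    determinant≉0 : determinant ≉ 0#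
    norm-form : ∀ x y z → ι (⟦ c ⟧ x y z) ≈ ι d * (ℓ X₁ Y₁ x y z * ℓ X₂ Y₂ x y z * ℓ X₃ Y₃ x y z)

module NormForm {q : ℕ} (𝔽 : FiniteField q) (h : ℕ) (q≡2^h : q ≡ 2 ℕ.^ h) (4≤h : 4 ≤ h) (2≤q : 2 ≤ q)
  (2≈0 : TwoIsZero (FiniteField.ring 𝔽)) where
  private
    module F = Field 𝔽
    open CubicForm F.R

  module _ where
    open F
    open CharTwo R 2≈0
    open Relation.Binary.Reasoning.Setoid setoid

    m≈0⇒α≈0 : ∀ c (an : Anisotropic c) → Cubic.m c ≈ 0# → Depression.α 𝔽 2≈0 c an ≈ 0#
    m≈0⇒α≈0 c an m≈0 = DepressedForm.a≈0⇒α≈0 𝔽 h q≡2^h 4≤h 2≤q 2≈0 α a β e p r n-anisotropic irreducible extension (trans (*-congˡ m≈0) (zeroʳ i))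
      where open Depression 𝔽 2≈0 c an

    -- If m = 0 then N has no y²-term in its quadratic part; in the basis (1 , 1 , 0), (1 , 0 , 0), (0 , 0 , 1)
    -- the same is true, forcing 1 / (1 + e) to be idempotent.
    m≉0 : ∀ c → Anisotropic c → Cubic.m c ≉ 0#
    m≉0 c an m≈0 = e≉0 (begin
      e                   ≈⟨ solve 1 (λ e → e := (con true :+ e) :+ con true) _ e ⟩
      (1# + e) + 1#       ≈⟨ +-congʳ 1+e≈1 ⟩
      1# + 1#             ≈⟨ 2≈0 ⟩
      0#                  ∎)
      where
      open Depression 𝔽 2≈0 c an
      a≈0 : a ≈ 0#
      a≈0 = trans (*-congˡ m≈0) (zeroʳ i)
      c′ : Cubic F
      c′ = cubic (1# + e) 1# (e₂ + β₀) 1# 1# β₀ e₁ 0# e₃ 0#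
      c′-N : ∀ x y z → N (x + y) x z ≈ ⟦ c′ ⟧ x y z
      c′-N x y z = begin
        N (x + y) x z ≈⟨ +-congʳ (+-congˡ (*-congˡ (+-congʳ (+-cong (*-congʳ (m≈0⇒α≈0 c an m≈0)) (*-congʳ a≈0))))) ⟩
        (x + y) * (x + y) * (x + y) + (x + y) * (0# * (x * x) + 0# * (x * z) + β₀ * (z * z)) + (e * (x * x * x) + e₁ * (x * x * z) + e₂ * (x * (z * z)) + e₃ * (z * z * z))
          ≈⟨ solve 8 (λ x y z β e e₁ e₂ e₃ → let 𝟘 = con false ; 𝟙 = con true in
               (x :+ y) :* (x :+ y) :* (x :+ y) :+ (x :+ y) :* (𝟘 :* (x :* x) :+ 𝟘 :* (x :* z) :+ β :* (z :* z))
                 :+ (e :* (x :* x :* x) :+ e₁ :* (x :* x :* z) :+ e₂ :* (x :* (z :* z)) :+ e₃ :* (z :* z :* z))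
               := x :* ((𝟙 :+ e) :* (x :* x) :+ 𝟙 :* (y :* y) :+ (e₂ :+ β) :* (z :* z)) :+ y :* (𝟙 :* (x :* x) :+ 𝟙 :* (y :* y) :+ β :* (z :* z))
                 :+ z :* (e₁ :* (x :* x) :+ 𝟘 :* (y :* y) :+ e₃ :* (z :* z)) :+ 𝟘 :* (x :* (y :* z))) _ x y z β₀ e e₁ e₂ e₃ ⟩
        ⟦ c′ ⟧ x y z ∎
      an′ : Anisotropic c′
      an′ x y z ≉0 eq = N-anisotropic (x + y) x z
        (λ (x+y≈0 , x≈0 , z≈0) → ≉0 (x≈0 , trans (sym (+-identityˡ y)) (trans (+-congʳ (sym x≈0)) x+y≈0) , z≈0))
        (trans (c′-N x y z) eq)
      j = inv (1# + e)
      1+e≉0 : 1# + e ≉ 0#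
      1+e≉0 = Depression.d≉0 𝔽 2≈0 c′ an′
      j≈1 : j ≈ 1#
      j≈1 = begin
        j          ≈⟨ solve 1 (λ j → j := (j :+ con true) :+ con true) _ j ⟩
        j + 1# + 1# ≈⟨ +-congʳ (*-zero-cancelˡ (inv-nonzero 1+e≉0) (trans
            (solve 1 (λ j → j :* (j :+ con true) := j :* con true :* (j :* con true) :+ j :* con true) _ j)
            (m≈0⇒α≈0 c′ an′ refl))) ⟩
        0# + 1#    ≈⟨ +-identityˡ 1# ⟩
        1#         ∎
      1+e≈1 : 1# + e ≈ 1#
      1+e≈1 = trans (sym (*-identityʳ _)) (trans (*-congˡ (sym j≈1)) (inv-right 1+e≉0))

  module Factorisation (c : Cubic F.F) (anisotropic : Anisotropic c)
    (ext : CubicExtension 𝔽 (Depression.p 𝔽 2≈0 c anisotropic) (Depression.r 𝔽 2≈0 c anisotropic)) where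
    open Depression 𝔽 2≈0 c anisotropic using (d; d≉0)
    private
      module D = Depression 𝔽 2≈0 c anisotropic

    open Conjugates 𝔽 h q≡2^h 2≤q 2≈0 D.p D.r D.irreducible ext hiding (module F)

    private
      a≉0 : D.a F.≉ F.0#
      a≉0 = F.*-nonzero (F.inv-nonzero d≉0) (m≉0 c anisotropic)

    open DepressedForm.Split 𝔽 h q≡2^h 4≤h 2≤q 2≈0 D.α D.a D.β D.e D.p D.r D.n-anisotropic D.irreducible ext a≉0 using (τ; factor; splits; τ≉0)
    open Relation.Binary.Reasoning.Setoid setoid

    -- The coefficients of y and z in `factor` after undoing the substitutions X = x + b y + b′ z
    -- and Y = y + λ₀ z.
    β₂ β₃ : K → K
    β₂ ζ = ι D.b + ι τ * ζ
    β₃ ζ = ι D.b′ + ι τ * ζ * ι D.λ₀ + ι τ * (ζ * ζ)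

    ℓ : K → F.F → F.F → F.F → K
    ℓ ζ x y z = ι x + β₂ ζ * ι y + β₃ ζ * ι z

    norm-form : ∀ x y z → ι (⟦ c ⟧ x y z) ≈ ι d * (ℓ η₁ x y z * ℓ η₂ x y z * ℓ η₃ x y z)
    norm-form x y z = begin
      ι (⟦ c ⟧ x y z) ≈⟨ ι-cong (F.trans (D.depressed x y z) (F.*-congˡ (D.n-depressed _ y z))) ⟩
      ι (d F.* D.n X Y z) ≈⟨ trans (ι-* _ _) (*-congˡ (splits X Y z)) ⟩
      ι d * (factor η₁ (ι X) (ι Y) (ι z) * factor η₂ (ι X) (ι Y) (ι z) * factor η₃ (ι X) (ι Y) (ι z))
        ≈⟨ *-congˡ (*-cong (*-cong (linear η₁) (linear η₂)) (linear η₃)) ⟩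
      ι d * (ℓ η₁ x y z * ℓ η₂ x y z * ℓ η₃ x y z) ∎
      where
      X = x F.+ D.b F.* y F.+ D.b′ F.* z
      Y = y F.+ D.λ₀ F.* z
      linear : ∀ ζ → factor ζ (ι X) (ι Y) (ι z) ≈ ℓ ζ x y z
      linear ζ = begin
        ι X + ι τ * ζ * ι Y + ι τ * (ζ * ζ) * ι z
          ≈⟨ +-congʳ (+-cong (trans (ι-+ _ _) (+-cong (trans (ι-+ _ _) (+-congˡ (ι-* _ _))) (ι-* _ _))) (*-congˡ (trans (ι-+ _ _) (+-congˡ (ι-* _ _))))) ⟩
        (ι x + ι D.b * ι y + ι D.b′ * ι z) + ι τ * ζ * (ι y + ι D.λ₀ * ι z) + ι τ * (ζ * ζ) * ι z
          ≈⟨ solve 8 (λ x y z b b′ l t ζ → (x :+ b :* y :+ b′ :* z) :+ t :* ζ :* (y :+ l :* z) :+ t :* (ζ :* ζ) :* z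
               := x :+ (b :+ t :* ζ) :* y :+ (b′ :+ t :* ζ :* l :+ t :* (ζ :* ζ)) :* z) _ (ι x) (ι y) (ι z) (ι D.b) (ι D.b′) (ι D.λ₀) (ι τ) ζ ⟩
        ℓ ζ x y z ∎

    σ-β₂ : ∀ {ζ ζ′} → σ ζ ≈ ζ′ → σ (β₂ ζ) ≈ β₂ ζ′
    σ-β₂ eq = trans (σ-+ _ _) (+-cong (σ-ι _) (trans (σ-* _ _) (*-cong (σ-ι _) eq)))

    σ-β₃ : ∀ {ζ ζ′} → σ ζ ≈ ζ′ → σ (β₃ ζ) ≈ β₃ ζ′
    σ-β₃ eq = trans (σ-+ _ _) (+-cong (trans (σ-+ _ _) (+-cong (σ-ι _) (trans (σ-* _ _) (*-cong (trans (σ-* _ _) (*-cong (σ-ι _) eq)) (σ-ι _)))))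
      (trans (σ-* _ _) (*-cong (σ-ι _) (trans (σ-* _ _) (*-cong eq eq)))))

    determinant : K
    determinant = (β₂ η₂ * β₃ η₃ + β₂ η₃ * β₃ η₂) + (β₂ η₃ * β₃ η₁ + β₂ η₁ * β₃ η₃) + (β₂ η₁ * β₃ η₂ + β₂ η₂ * β₃ η₁)

    -- The terms with b, b′ and λ₀ are column operations, so the determinant is τ² times the
    -- Vandermonde determinant of the roots. The differences of the roots are again the roots, which
    -- makes it τ² η₁ η₂ η₃.
    determinant≉0 : determinant ≉ 0#
    determinant≉0 eq = *-nonzero (*-nonzero ιτ≉0 ιτ≉0) (*-nonzero (*-nonzero η₁≉0 η₂≉0) η₃≉0) (trans
      (solve 6 (λ t b b′ l a c → let e = a :+ c ; f = λ ζ → b :+ t :* ζ ; g = λ ζ → b′ :+ t :* ζ :* l :+ t :* (ζ :* ζ) in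
        t :* t :* (a :* c :* e) := (f c :* g e :+ f e :* g c) :+ (f e :* g a :+ f a :* g e) :+ (f a :* g c :+ f c :* g a))
        _ (ι τ) (ι D.b) (ι D.b′) (ι D.λ₀) η₁ η₂) eq)
      where
      ιτ≉0 : ι τ ≉ 0#
      ιτ≉0 = ι-nonzero τ≉0

    factored-form : Factored 𝔽 h q≡2^h 2≤q 2≈0 c
    factored-form = record
      { p = D.p ; r = D.r ; irreducible = D.irreducible ; ext = ext ; d = d ; d≉0 = d≉0
      ; X₁ = β₂ η₁ ; X₂ = β₂ η₂ ; X₃ = β₂ η₃ ; Y₁ = β₃ η₁ ; Y₂ = β₃ η₂ ; Y₃ = β₃ η₃
      ; σX₁ = σ-β₂ refl ; σX₂ = σ-β₂ σ-η₂ ; σX₃ = σ-β₂ σ-η₃ ; σY₁ = σ-β₃ refl ; σY₂ = σ-β₃ σ-η₂ ; σY₃ = σ-β₃ σ-η₃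
      ; determinant≉0 = determinant≉0 ; norm-form = norm-form
      }

-- The similitude onto the Kantor ovoid

module KantorOvoid {q : ℕ} (𝔽 : FiniteField q) (h : ℕ) (q≡2^h : q ≡ 2 ℕ.^ h) (2≤q : 2 ≤ q) (5≤q : 5 ≤ q)
  (f₁ f₂ f₃ : Geometry.Poly2 (FiniteField.ring 𝔽))
  (degree-2 : Geometry.HasDegree2 (FiniteField.ring 𝔽) f₃)
  (ovoid : Geometry.IsOvoid (FiniteField.ring 𝔽) (Geometry.O7 (FiniteField.ring 𝔽) f₁ f₂ f₃))
  (factored : Factored 𝔽 h q≡2^h 2≤q (EvenOvoid.2≈0 𝔽 5≤q f₁ f₂ f₃ degree-2 ovoid) (EvenOvoid.c 𝔽 5≤q f₁ f₂ f₃ degree-2 ovoid)) where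
  private
    module F = Field 𝔽
    module E = EvenOvoid 𝔽 5≤q f₁ f₂ f₃ degree-2 ovoid
    module O = Ovoid 𝔽 f₁ f₂ f₃ ovoid
    open F using (F)
    open CubicForm F.R
    open Geometry F.R using (V8; _≈v_; Qform; Poly2; eval; O7)
    open O using (lin; quad)

    module Real where
      open F
      open CharTwo R E.2≈0
      open Relation.Binary.Reasoning.Setoid setoid
      open Poly2

      eval-split : ∀ f x y z → eval f x y z ≈ lin f x y z + quad f x y z
      eval-split f x y z = solve 9 (λ a b c d e f g h i → a :+ b :+ c :+ d :+ e :+ f :+ g :+ h :+ i := (a :+ b :+ c) :+ (d :+ e :+ f :+ g :+ h :+ i))
        _ _ _ _ _ _ _ _ _ _

      eval+lin : ∀ f x y z → eval f x y z + lin f x y z ≈ quad f x y z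
      eval+lin f x y z = trans (+-congʳ (eval-split f x y z)) (solve 2 (λ l q → (l :+ q) :+ l := q) _ (lin f x y z) (quad f x y z))

      last-coordinate : ∀ x y z → - (z * eval f₁ x y z) - y * eval f₂ x y z - x * eval f₃ x y z ≈ ⟦ E.c ⟧ x y z
      last-coordinate x y z = begin
        - (z * eval f₁ x y z) - y * eval f₂ x y z - x * eval f₃ x y z
          ≈⟨ solve 6 (λ x y z a b c → :- (z :* a) :- y :* b :- x :* c := x :* c :+ y :* b :+ z :* a) _ x y z _ _ _ ⟩
        x * eval f₃ x y z + y * eval f₂ x y z + z * eval f₁ x y z
          ≈⟨ +-cong (+-cong (*-congˡ (eval-split f₃ x y z)) (*-congˡ (eval-split f₂ x y z))) (*-congˡ (eval-split f₁ x y z)) ⟩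
        O.self x y z                   ≈⟨ E.self≈s+c x y z ⟩
        E.s x y z + ⟦ E.c ⟧ x y z      ≈⟨ +-congʳ (E.s≈0 x y z) ⟩
        0# + ⟦ E.c ⟧ x y z             ≈⟨ +-identityˡ _ ⟩
        ⟦ E.c ⟧ x y z                  ∎

      pairing : ∀ x y z u v w → x * (u + lin f₃ x y z) + y * (v + lin f₂ x y z) + z * (w + lin f₁ x y z) ≈ x * u + y * v + z * w
      pairing x y z u v w = begin
        x * (u + lin f₃ x y z) + y * (v + lin f₂ x y z) + z * (w + lin f₁ x y z)
          ≈⟨ solve 9 (λ x y z u v w a b c → x :* (u :+ a) :+ y :* (v :+ b) :+ z :* (w :+ c) := (x :* u :+ y :* v :+ z :* w) :+ (x :* a :+ y :* b :+ z :* c))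
               _ x y z u v w _ _ _ ⟩
        (x * u + y * v + z * w) + E.s x y z ≈⟨ +-congˡ (E.s≈0 x y z) ⟩
        (x * u + y * v + z * w) + 0#        ≈⟨ +-identityʳ _ ⟩
        x * u + y * v + z * w               ∎

      lin-cong : ∀ f {x x′ y y′ z z′} → x ≈ x′ → y ≈ y′ → z ≈ z′ → lin f x y z ≈ lin f x′ y′ z′
      lin-cong f x y z = +-cong (+-cong (*-congˡ x) (*-congˡ y)) (*-congˡ z)

      lin-+ : ∀ f u v x y z x′ y′ z′ → (u + v) + lin f (x + x′) (y + y′) (z + z′) ≈ (u + lin f x y z) + (v + lin f x′ y′ z′)
      lin-+ f u v x y z x′ y′ z′ = solve 11 (λ a b c u v x y z x′ y′ z′ → (u :+ v) :+ (a :* (x :+ x′) :+ b :* (y :+ y′) :+ c :* (z :+ z′))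
        := (u :+ (a :* x :+ b :* y :+ c :* z)) :+ (v :+ (a :* x′ :+ b :* y′ :+ c :* z′))) _ (cX f) (cY f) (cZ f) u v x y z x′ y′ z′

      lin-* : ∀ f k u x y z → k * u + lin f (k * x) (k * y) (k * z) ≈ k * (u + lin f x y z)
      lin-* f k u x y z = solve 8 (λ a b c k u x y z → k :* u :+ (a :* (k :* x) :+ b :* (k :* y) :+ c :* (k :* z)) := k :* (u :+ (a :* x :+ b :* y :+ c :* z)))
        _ (cX f) (cY f) (cZ f) k u x y z

      lin-cancel : ∀ {u v l l′} → u + l ≈ v + l′ → l ≈ l′ → u ≈ v
      lin-cancel {u} {v} {l} {l′} eq l≈l′ = begin
        u            ≈⟨ solve 2 (λ u l → u := (u :+ l) :+ l) _ u l ⟩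
        (u + l) + l  ≈⟨ +-cong eq l≈l′ ⟩
        (v + l′) + l′ ≈⟨ solve 2 (λ u l → (u :+ l) :+ l := u) _ v l′ ⟩
        v            ∎

      add-twice : ∀ u l → (u + l) + l ≈ u
      add-twice = solve 2 (λ u l → (u :+ l) :+ l := u) _

      lin-0 : ∀ f → 0# + lin f 0# 0# 0# ≈ 0#
      lin-0 f = solve 3 (λ a b c → con false :+ (a :* con false :+ b :* con false :+ c :* con false) := con false) _ (cX f) (cY f) (cZ f)

      -- The linear coefficient of c along v + t eᵢ is its i-th partial derivative at v.
      gradient₁ : ∀ x y z → E.Line.c₁ x y z 1# 0# 0# ≈ quad f₃ x y z
      gradient₁ x y z = trans (solve 7 (λ x y z a b c m → let 𝟘 = con false ; 𝟙 = con true in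
        (𝟙 :* a :+ 𝟘 :* b :+ 𝟘 :* c) :+ m :* (𝟙 :* (y :* z) :+ x :* (𝟘 :* z) :+ x :* (y :* 𝟘)) := a :+ m :* (y :* z)) _ x y z _ _ _ _) (sym (E.quad₃ x y z))
      gradient₂ : ∀ x y z → E.Line.c₁ x y z 0# 1# 0# ≈ quad f₂ x y z
      gradient₂ x y z = trans (solve 7 (λ x y z a b c m → let 𝟘 = con false ; 𝟙 = con true in
        (𝟘 :* a :+ 𝟙 :* b :+ 𝟘 :* c) :+ m :* (𝟘 :* (y :* z) :+ x :* (𝟙 :* z) :+ x :* (y :* 𝟘)) := b :+ m :* (x :* z)) _ x y z _ _ _ _) (sym (E.quad₂ x y z))
      gradient₃ : ∀ x y z → E.Line.c₁ x y z 0# 0# 1# ≈ quad f₁ x y z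
      gradient₃ x y z = trans (solve 7 (λ x y z a b c m → let 𝟘 = con false ; 𝟙 = con true in
        (𝟘 :* a :+ 𝟘 :* b :+ 𝟙 :* c) :+ m :* (𝟘 :* (y :* z) :+ x :* (𝟘 :* z) :+ x :* (y :* 𝟙)) := c :+ m :* (x :* y)) _ x y z _ _ _ _) (sym (E.quad₁ x y z))

      -- Needed to separate the terms in s and s² along a line: s + s² has at most two roots, and
      -- the field is larger.
      not-all-idempotent : ¬ (∀ s → s + s * s ≈ 0#)
      not-all-idempotent idem = leading (vanishing⇒zero (ℕ.≤-trans (ℕ.m≤m+n 3 2) 5≤q) (0# ∷ 1# ∷ 1# ∷ [])
          λ s → trans (solve 1 (λ s → con false :+ s :* (con true :+ s :* (con true :+ s :* con false)) := s :+ s :* s) _ s) (idem s))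
        where
        leading : ¬ All (_≈ 0#) (0# ∷ 1# ∷ 1# ∷ [])
        leading (_ ∷ 1≈0 ∷ _) = 1≉0 1≈0

    open Real
    open Factored factored
    open Conjugates 𝔽 h q≡2^h 2≤q E.2≈0 p r irreducible ext hiding (module F)
    open Relation.Binary.Reasoning.Setoid setoid

    ℓ₁ ℓ₂ ℓ₃ : F → F → F → K
    ℓ₁ = ℓ X₁ Y₁
    ℓ₂ = ℓ X₂ Y₂
    ℓ₃ = ℓ X₃ Y₃

    σ³ : ∀ t → σ (σ (σ t)) ≈ t
    σ³ t = begin
      ((t ^ q) ^ q) ^ q      ≈⟨ trans (^-congˡ q (^-assocʳ t q q)) (^-assocʳ t (q ℕ.* q) q) ⟩
      t ^ (q ℕ.* q ℕ.* q)    ≡⟨ ≡.cong (t ^_) (≡.trans (ℕ.*-assoc q q q) (≡.cong (λ k → q ℕ.* (q ℕ.* k)) (≡.sym (ℕ.*-identityʳ q)))) ⟩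
      t ^ (q ℕ.^ 3)          ≈⟨ fermat t ⟩
      t                      ∎

    ℓ-line : ∀ X Y s x y z x′ y′ z′ → ℓ X Y (x F.+ s F.* x′) (y F.+ s F.* y′) (z F.+ s F.* z′) ≈ ℓ X Y x y z + ι s * ℓ X Y x′ y′ z′
    ℓ-line X Y s x y z x′ y′ z′ = trans (+-cong (+-cong (hom-line x x′) (*-congˡ (hom-line y y′))) (*-congˡ (hom-line z z′)))
      (solve 9 (λ s x y z x′ y′ z′ a b → (x :+ s :* x′) :+ a :* (y :+ s :* y′) :+ b :* (z :+ s :* z′)
        := (x :+ a :* y :+ b :* z) :+ s :* (x′ :+ a :* y′ :+ b :* z′)) _ (ι s) (ι x) (ι y) (ι z) (ι x′) (ι y′) (ι z′) X Y)
      where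
      hom-line : ∀ u v → ι (u F.+ s F.* v) ≈ ι u + ι s * ι v
      hom-line u v = trans (ι-+ _ _) (+-congˡ (ι-* _ _))

    -- Both sides of the norm-form identity are cubic polynomials along a line; compare the linear terms.
    module _ (x y z x′ y′ z′ : F) where
      private
        l₁ l₂ l₃ m₁ m₂ m₃ S₁ S₂ A B : K
        l₁ = ℓ₁ x y z
        l₂ = ℓ₂ x y z
        l₃ = ℓ₃ x y z
        m₁ = ℓ₁ x′ y′ z′
        m₂ = ℓ₂ x′ y′ z′
        m₃ = ℓ₃ x′ y′ z′
        S₁ = m₁ * (l₂ * l₃) + m₂ * (l₃ * l₁) + m₃ * (l₁ * l₂)
        S₂ = l₁ * (m₂ * m₃) + l₂ * (m₃ * m₁) + l₃ * (m₁ * m₂)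
        A = ι (E.Line.c₁ x y z x′ y′ z′) + ι d * S₁
        B = ι (E.Line.c₂ x y z x′ y′ z′) + ι d * S₂

        sA+s²B : ∀ s → ι s * A + ι s * ι s * B ≈ 0#
        sA+s²B s = begin
          ι s * A + ι s * ι s * B
            ≈⟨ solve 10 (λ s a b d l₁ l₂ l₃ m₁ m₂ m₃ →
                 let S₁ = m₁ :* (l₂ :* l₃) :+ m₂ :* (l₃ :* l₁) :+ m₃ :* (l₁ :* l₂) ; S₂ = l₁ :* (m₂ :* m₃) :+ l₂ :* (m₃ :* m₁) :+ l₃ :* (m₁ :* m₂) in
                 s :* (a :+ d :* S₁) :+ s :* s :* (b :+ d :* S₂)
                 := (d :* (l₁ :* l₂ :* l₃) :+ s :* a :+ s :* s :* b :+ s :* s :* s :* (d :* (m₁ :* m₂ :* m₃)))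
                    :+ d :* ((l₁ :+ s :* m₁) :* (l₂ :+ s :* m₂) :* (l₃ :+ s :* m₃)))
                 _ (ι s) (ι (E.Line.c₁ x y z x′ y′ z′)) (ι (E.Line.c₂ x y z x′ y′ z′)) (ι d) l₁ l₂ l₃ m₁ m₂ m₃ ⟩
          (ι d * (l₁ * l₂ * l₃) + ι s * ι (E.Line.c₁ x y z x′ y′ z′) + ι s * ι s * ι (E.Line.c₂ x y z x′ y′ z′) + ι s * ι s * ι s * (ι d * (m₁ * m₂ * m₃)))
            + ι d * ((l₁ + ι s * m₁) * (l₂ + ι s * m₂) * (l₃ + ι s * m₃))
            ≈⟨ ≈⇒+≈0 (begin
                 ι d * (l₁ * l₂ * l₃) + ι s * ι (E.Line.c₁ x y z x′ y′ z′) + ι s * ι s * ι (E.Line.c₂ x y z x′ y′ z′) + ι s * ι s * ι s * (ι d * (m₁ * m₂ * m₃))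
                   ≈⟨ +-cong (+-congʳ (+-congʳ (norm-form x y z))) (*-congˡ (norm-form x′ y′ z′)) ⟨
                 ι (⟦ E.c ⟧ x y z) + ι s * ι (E.Line.c₁ x y z x′ y′ z′) + ι s * ι s * ι (E.Line.c₂ x y z x′ y′ z′) + ι s * ι s * ι s * ι (⟦ E.c ⟧ x′ y′ z′)
                   ≈⟨ trans (ι-+ _ _) (+-cong (trans (ι-+ _ _) (+-cong (trans (ι-+ _ _) (+-congˡ (ι-* _ _))) (trans (ι-* _ _) (*-congʳ (ι-* _ _)))))
                        (trans (ι-* _ _) (*-congʳ (trans (ι-* _ _) (*-congʳ (ι-* _ _)))))) ⟨
                 ι (⟦ E.c ⟧ x y z F.+ s F.* E.Line.c₁ x y z x′ y′ z′ F.+ s F.* s F.* E.Line.c₂ x y z x′ y′ z′ F.+ s F.* s F.* s F.* ⟦ E.c ⟧ x′ y′ z′)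
                   ≈⟨ ι-cong (E.Line.c-line x y z x′ y′ z′ s) ⟨
                 ι (⟦ E.c ⟧ (x F.+ s F.* x′) (y F.+ s F.* y′) (z F.+ s F.* z′)) ≈⟨ norm-form _ _ _ ⟩
                 _ ≈⟨ *-congˡ (*-cong (*-cong (ℓ-line X₁ Y₁ s x y z x′ y′ z′) (ℓ-line X₂ Y₂ s x y z x′ y′ z′)) (ℓ-line X₃ Y₃ s x y z x′ y′ z′)) ⟩
                 ι d * ((l₁ + ι s * m₁) * (l₂ + ι s * m₂) * (l₃ + ι s * m₃)) ∎) ⟩
          0# ∎

        B≈A : B ≈ A
        B≈A = sym (+≈0⇒≈ (trans (solve 2 (λ a b → a :+ b := con true :* a :+ con true :* con true :* b) _ A B)
          (trans (+-cong (*-congʳ (sym ι-1)) (*-congʳ (*-cong (sym ι-1) (sym ι-1)))) (sA+s²B F.1#))))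

      norm-derivative : ι (E.Line.c₁ x y z x′ y′ z′) ≈ ι d * S₁
      norm-derivative = +≈0⇒≈ (decidable-stable (A ≟ 0#) λ A≉0 → not-all-idempotent λ s →
        ι-zero (trans (trans (ι-+ _ _) (+-congˡ (ι-* _ _))) (*-zero-cancelˡ A≉0 (begin
          A * (ι s + ι s * ι s)       ≈⟨ solve 2 (λ a s → a :* (s :+ s :* s) := s :* a :+ s :* s :* a) _ A (ι s) ⟩
          ι s * A + ι s * ι s * A     ≈⟨ +-congˡ (*-congˡ B≈A) ⟨
          ι s * A + ι s * ι s * B     ≈⟨ sA+s²B s ⟩
          0#                          ∎))))

    D⁻ i : K
    D⁻ = inv determinant
    i = ι (F.inv d)

    σ-+′ : ∀ {s t s′ t′} → σ s ≈ s′ → σ t ≈ t′ → σ (s + t) ≈ s′ + t′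
    σ-+′ s t = trans (σ-+ _ _) (+-cong s t)
    σ-*′ : ∀ {s t s′ t′} → σ s ≈ s′ → σ t ≈ t′ → σ (s * t) ≈ s′ * t′
    σ-*′ s t = trans (σ-* _ _) (*-cong s t)

    DD⁻ : determinant * D⁻ ≈ 1#
    DD⁻ = inv-right determinant≉0

    id≈1 : i * ι d ≈ 1#
    id≈1 = trans (*-comm _ _) (trans (sym (ι-* _ _)) (trans (ι-cong (F.inv-right d≉0)) ι-1))

    σD⁻ : σ D⁻ ≈ D⁻
    σD⁻ = inv-unique (begin
      determinant * σ D⁻       ≈⟨ *-congʳ σD ⟨
      σ determinant * σ D⁻     ≈⟨ σ-* _ _ ⟨
      σ (determinant * D⁻)     ≈⟨ σ-cong (trans DD⁻ (sym ι-1)) ⟩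
      σ (ι F.1#)               ≈⟨ trans (σ-ι F.1#) ι-1 ⟩
      1#                       ∎)
      where
      σD : σ determinant ≈ determinant
      σD = trans (σ-+′ (σ-+′ (σ-+′ (σ-*′ σX₂ σY₃) (σ-*′ σX₃ σY₂)) (σ-+′ (σ-*′ σX₃ σY₁) (σ-*′ σX₁ σY₃))) (σ-+′ (σ-*′ σX₁ σY₂) (σ-*′ σX₂ σY₁)))
        (solve 6 (λ a b c x y z → (c :* x :+ a :* z) :+ (a :* y :+ b :* x) :+ (b :* z :+ c :* y) := (b :* z :+ c :* y) :+ (c :* x :+ a :* z) :+ (a :* y :+ b :* x))
          _ X₁ X₂ X₃ Y₁ Y₂ Y₃)

    -- The adjugate of the matrix of conjugates of the basis 1, X₁, Y₁, giving the basis dual for the trace.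
    dual : K → K → K → K → F → F → F → K
    dual x x′ y y′ u v w = i * D⁻ * (ι u * (x * y′ + x′ * y) + ι v * (y + y′) + ι w * (x + x′))

    dual₁ dual₂ dual₃ : F → F → F → K
    dual₁ = dual X₂ X₃ Y₂ Y₃
    dual₂ = dual X₃ X₁ Y₃ Y₁
    dual₃ = dual X₁ X₂ Y₁ Y₂

    σ-dual : ∀ {x x′ y y′ X X′ Y Y′} → σ x ≈ X → σ x′ ≈ X′ → σ y ≈ Y → σ y′ ≈ Y′ → ∀ u v w → σ (dual x x′ y y′ u v w) ≈ dual X X′ Y Y′ u v w
    σ-dual x x′ y y′ u v w = σ-*′ (σ-*′ (σ-ι _) σD⁻) (σ-+′ (σ-+′ (σ-*′ (σ-ι u) (σ-+′ (σ-*′ x y′) (σ-*′ x′ y))) (σ-*′ (σ-ι v) (σ-+′ y y′))) (σ-*′ (σ-ι w) (σ-+′ x x′)))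

    σ-dual₁ : ∀ u v w → σ (dual₁ u v w) ≈ dual₂ u v w
    σ-dual₁ = σ-dual σX₂ σX₃ σY₂ σY₃
    σ-dual₂ : ∀ u v w → σ (dual₂ u v w) ≈ dual₃ u v w
    σ-dual₂ = σ-dual σX₃ σX₁ σY₃ σY₁

    σ-ℓ : ∀ {X X′ Y Y′} → σ X ≈ X′ → σ Y ≈ Y′ → ∀ x y z → σ (ℓ X Y x y z) ≈ ℓ X′ Y′ x y z
    σ-ℓ X Y x y z = σ-+′ (σ-+′ (σ-ι x) (σ-*′ X (σ-ι y))) (σ-*′ Y (σ-ι z))

    σ-ℓ₁ : ∀ x y z → σ (ℓ₁ x y z) ≈ ℓ₂ x y z
    σ-ℓ₁ = σ-ℓ σX₁ σY₁
    σ-ℓ₂ : ∀ x y z → σ (ℓ₂ x y z) ≈ ℓ₃ x y z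
    σ-ℓ₂ = σ-ℓ σX₂ σY₂

    module W = Kantor.WithHom F.R RK hom q

    pow≈^ : ∀ t k → Kantor.pow F.R RK t k ≈ t ^ k
    pow≈^ t zero    = refl
    pow≈^ t (suc k) = *-congˡ (pow≈^ t k)

    pow-q : ∀ t → Kantor.pow F.R RK t q ≈ σ t
    pow-q t = pow≈^ t q

    pow-q² : ∀ t → Kantor.pow F.R RK t (q ℕ.* q) ≈ σ (σ t)
    pow-q² t = trans (pow≈^ t (q ℕ.* q)) (sym (^-assocʳ t q q))

    Tr≈ : ∀ {t t′ t″} → σ t ≈ t′ → σ t′ ≈ t″ → W.Tr t ≈ t + t′ + t″
    Tr≈ {t} eq eq′ = +-cong (+-congˡ (trans (pow-q t) eq)) (trans (pow-q² t) (trans (σ-cong eq) eq′))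

    trace-form : ∀ x y z u v w → W.Tr (ℓ₁ x y z * dual₁ u v w) ≈ i * (ι x * ι u + ι y * ι v + ι z * ι w)
    trace-form x y z u v w = begin
      W.Tr (ℓ₁ x y z * dual₁ u v w)
        ≈⟨ Tr≈ (σ-*′ (σ-ℓ₁ x y z) (σ-dual₁ u v w)) (σ-*′ (σ-ℓ₂ x y z) (σ-dual₂ u v w)) ⟩
      ℓ₁ x y z * dual₁ u v w + ℓ₂ x y z * dual₂ u v w + ℓ₃ x y z * dual₃ u v w
        ≈⟨ solve 13 (λ k x y z u v w a b c r s t →
             (x :+ a :* y :+ r :* z) :* (k :* (u :* (b :* t :+ c :* s) :+ v :* (s :+ t) :+ w :* (b :+ c)))
             :+ (x :+ b :* y :+ s :* z) :* (k :* (u :* (c :* r :+ a :* t) :+ v :* (t :+ r) :+ w :* (c :+ a)))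
             :+ (x :+ c :* y :+ t :* z) :* (k :* (u :* (a :* s :+ b :* r) :+ v :* (r :+ s) :+ w :* (a :+ b)))
             := k :* ((b :* t :+ c :* s) :+ (c :* r :+ a :* t) :+ (a :* s :+ b :* r)) :* (x :* u :+ y :* v :+ z :* w))
             _ (i * D⁻) (ι x) (ι y) (ι z) (ι u) (ι v) (ι w) X₁ X₂ X₃ Y₁ Y₂ Y₃ ⟩
      i * D⁻ * determinant * (ι x * ι u + ι y * ι v + ι z * ι w)
        ≈⟨ *-congʳ (trans (*-assoc _ _ _) (trans (*-congˡ (trans (*-comm _ _) DD⁻)) (*-identityʳ i))) ⟩
      i * (ι x * ι u + ι y * ι v + ι z * ι w) ∎

    -- Cramer's rule for unknowns s₁, s₂, s₃ with the matrix of conjugates; the factor `i` in `dual`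
    -- cancels ι d.
    dual-of-traces : ∀ {u v w} s₁ s₂ s₃ → ι u ≈ ι d * (s₁ + s₂ + s₃) → ι v ≈ ι d * (X₁ * s₁ + X₂ * s₂ + X₃ * s₃) →
      ι w ≈ ι d * (Y₁ * s₁ + Y₂ * s₂ + Y₃ * s₃) → dual₁ u v w ≈ s₁
    dual-of-traces {u} {v} {w} s₁ s₂ s₃ eu ev ew = begin
      dual₁ u v w ≈⟨ *-congˡ (+-cong (+-cong (*-congʳ eu) (*-congʳ ev)) (*-congʳ ew)) ⟩
      i * D⁻ * (ι d * (s₁ + s₂ + s₃) * (X₂ * Y₃ + X₃ * Y₂) + ι d * (X₁ * s₁ + X₂ * s₂ + X₃ * s₃) * (Y₂ + Y₃) + ι d * (Y₁ * s₁ + Y₂ * s₂ + Y₃ * s₃) * (X₂ + X₃))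
        ≈⟨ solve 12 (λ i e d p q n a b c r s t →
             i :* e :* (d :* (p :+ q :+ n) :* (b :* t :+ c :* s) :+ d :* (a :* p :+ b :* q :+ c :* n) :* (s :+ t) :+ d :* (r :* p :+ s :* q :+ t :* n) :* (b :+ c))
             := i :* d :* (((b :* t :+ c :* s) :+ (c :* r :+ a :* t) :+ (a :* s :+ b :* r)) :* e) :* p)
             _ i D⁻ (ι d) s₁ s₂ s₃ X₁ X₂ X₃ Y₁ Y₂ Y₃ ⟩
      i * ι d * (determinant * D⁻) * s₁ ≈⟨ *-congʳ (trans (*-cong id≈1 DD⁻) (*-identityˡ 1#)) ⟩
      1# * s₁ ≈⟨ *-identityˡ s₁ ⟩
      s₁ ∎

    -- The coordinates are d times the traces of t, X₁ t and Y₁ t. They are fixed by σ and therefore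
    -- come from the base field.
    dual-surjective : ∀ t → ∃ λ u → ∃ λ v → ∃ λ w → dual₁ u v w ≈ t
    dual-surjective t =
      let u , eu = fixed⇒ι _ (fixed refl refl (σ³ t))
          v , ev = fixed⇒ι _ (fixed (σ-*′ σX₁ refl) (σ-*′ σX₂ refl) (σ-*′ σX₃ (σ³ t)))
          w , ew = fixed⇒ι _ (fixed (σ-*′ σY₁ refl) (σ-*′ σY₂ refl) (σ-*′ σY₃ (σ³ t)))
      in u , v , w , dual-of-traces t (σ t) (σ (σ t)) (sym eu) (sym ev) (sym ew)
      where
      fixed : ∀ {a b c} → σ a ≈ b → σ b ≈ c → σ c ≈ a → σ (ι d * (a + b + c)) ≈ ι d * (a + b + c)
      fixed ab bc ca = trans (σ-*′ (σ-ι d) (σ-+′ (σ-+′ ab bc) ca)) (*-congˡ (solve 3 (λ a b c → b :+ c :+ a := a :+ b :+ c) _ _ _ _))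

    -- By `trace-form`, the traces of δ against the images of the unit vectors under ℓ₁ recover the
    -- three coordinates of δ up to the common factor `i`.
    dual-injective : ∀ {u v w u′ v′ w′} → dual₁ u v w ≈ dual₁ u′ v′ w′ → u F.≈ u′ × v F.≈ v′ × w F.≈ w′
    dual-injective {u} {v} {w} {u′} {v′} {w′} eq = coordinate F.1# F.0# F.0# (first u v w) (first u′ v′ w′) ,
        coordinate F.0# F.1# F.0# (second u v w) (second u′ v′ w′) , coordinate F.0# F.0# F.1# (third u v w) (third u′ v′ w′)
      where
      i≉0 : i ≉ 0#
      i≉0 = ι-nonzero (F.inv-nonzero d≉0)
      coordinate : ∀ x y z {k k′} → ι x * ι u + ι y * ι v + ι z * ι w ≈ ι k → ι x * ι u′ + ι y * ι v′ + ι z * ι w′ ≈ ι k′ → k F.≈ k′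
      coordinate x y z e e′ = ι-injective (trans (sym e) (trans (*-cancelˡ-nonzero i≉0 (trans (sym (trace-form x y z u v w))
        (trans (Tr-cong (*-congˡ eq)) (trace-form x y z u′ v′ w′)))) e′))
        where
        Tr-cong : ∀ {s t} → s ≈ t → W.Tr s ≈ W.Tr t
        Tr-cong {s} {t} s≈t = trans (Tr≈ refl refl) (trans (+-cong (+-cong s≈t (σ-cong s≈t)) (σ-cong (σ-cong s≈t))) (sym (Tr≈ refl refl)))
      first : ∀ u v w → ι F.1# * ι u + ι F.0# * ι v + ι F.0# * ι w ≈ ι u
      first u v w = trans (+-cong (+-cong (*-congʳ ι-1) (*-congʳ ι-0)) (*-congʳ ι-0)) (solve 3 (λ u v w → con true :* u :+ con false :* v :+ con false :* w := u) _ _ _ _)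
      second : ∀ u v w → ι F.0# * ι u + ι F.1# * ι v + ι F.0# * ι w ≈ ι v
      second u v w = trans (+-cong (+-cong (*-congʳ ι-0) (*-congʳ ι-1)) (*-congʳ ι-0)) (solve 3 (λ u v w → con false :* u :+ con true :* v :+ con false :* w := v) _ _ _ _)
      third : ∀ u v w → ι F.0# * ι u + ι F.0# * ι v + ι F.1# * ι w ≈ ι w
      third u v w = trans (+-cong (+-cong (*-congʳ ι-0) (*-congʳ ι-0)) (*-congʳ ι-1)) (solve 3 (λ u v w → con false :* u :+ con false :* v :+ con true :* w := w) _ _ _ _)

    -- The coordinates of t in the basis 1, X₁, Y₁ are its traces against the dual basis, that is,
    -- against the adjugate divided by the determinant.
    ℓ-surjective : ∀ t → ∃ λ x → ∃ λ y → ∃ λ z → ℓ₁ x y z ≈ t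
    ℓ-surjective t =
      let x , ex = fixed⇒ι _ (fixed (σ-+′ (σ-*′ σX₂ σY₃) (σ-*′ σX₃ σY₂)) (σ-+′ (σ-*′ σX₃ σY₁) (σ-*′ σX₁ σY₃)) (σ-+′ (σ-*′ σX₁ σY₂) (σ-*′ σX₂ σY₁)))
          y , ey = fixed⇒ι _ (fixed (σ-+′ σY₂ σY₃) (σ-+′ σY₃ σY₁) (σ-+′ σY₁ σY₂))
          z , ez = fixed⇒ι _ (fixed (σ-+′ σX₂ σX₃) (σ-+′ σX₃ σX₁) (σ-+′ σX₁ σX₂))
      in x , y , z , (begin
        ι x + X₁ * ι y + Y₁ * ι z ≈⟨ +-cong (+-cong ex (*-congˡ ey)) (*-congˡ ez) ⟨
        _ ≈⟨ solve 10 (λ e p q n a b c r s t →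
               e :* (p :* (b :* t :+ c :* s) :+ q :* (c :* r :+ a :* t) :+ n :* (a :* s :+ b :* r))
               :+ a :* (e :* (p :* (s :+ t) :+ q :* (t :+ r) :+ n :* (r :+ s))) :+ r :* (e :* (p :* (b :+ c) :+ q :* (c :+ a) :+ n :* (a :+ b)))
               := ((b :* t :+ c :* s) :+ (c :* r :+ a :* t) :+ (a :* s :+ b :* r)) :* e :* p)
               _ D⁻ t (σ t) (σ (σ t)) X₁ X₂ X₃ Y₁ Y₂ Y₃ ⟩
        determinant * D⁻ * t ≈⟨ trans (*-congʳ DD⁻) (*-identityˡ t) ⟩
        t ∎)
      where
      fixed : ∀ {a b c} → σ a ≈ b → σ b ≈ c → σ c ≈ a → σ (D⁻ * (t * a + σ t * b + σ (σ t) * c)) ≈ D⁻ * (t * a + σ t * b + σ (σ t) * c)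
      fixed ab bc ca = trans (σ-*′ σD⁻ (σ-+′ (σ-+′ (σ-*′ refl ab) (σ-*′ refl bc)) (σ-*′ (σ³ t) ca)))
        (*-congˡ (solve 3 (λ a b c → b :+ c :+ a := a :+ b :+ c) _ _ _ _))

    ℓ-cong : ∀ {x x′ y y′ z z′} → x F.≈ x′ → y F.≈ y′ → z F.≈ z′ → ℓ₁ x y z ≈ ℓ₁ x′ y′ z′
    ℓ-cong x y z = +-cong (+-cong (ι-cong x) (*-congˡ (ι-cong y))) (*-congˡ (ι-cong z))

    ℓ-+ : ∀ x y z x′ y′ z′ → ℓ₁ (x F.+ x′) (y F.+ y′) (z F.+ z′) ≈ ℓ₁ x y z + ℓ₁ x′ y′ z′
    ℓ-+ x y z x′ y′ z′ = trans (+-cong (+-cong (ι-+ _ _) (*-congˡ (ι-+ _ _))) (*-congˡ (ι-+ _ _)))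
      (solve 8 (λ x y z x′ y′ z′ a b → (x :+ x′) :+ a :* (y :+ y′) :+ b :* (z :+ z′) := (x :+ a :* y :+ b :* z) :+ (x′ :+ a :* y′ :+ b :* z′))
        _ (ι x) (ι y) (ι z) (ι x′) (ι y′) (ι z′) X₁ Y₁)

    ℓ-· : ∀ k x y z → ℓ₁ (k F.* x) (k F.* y) (k F.* z) ≈ ι k * ℓ₁ x y z
    ℓ-· k x y z = trans (+-cong (+-cong (ι-* _ _) (*-congˡ (ι-* _ _))) (*-congˡ (ι-* _ _)))
      (solve 6 (λ k x y z a b → k :* x :+ a :* (k :* y) :+ b :* (k :* z) := k :* (x :+ a :* y :+ b :* z)) _ (ι k) (ι x) (ι y) (ι z) X₁ Y₁)

    -- A zero of one linear factor is a zero of the norm form c, which has no nontrivial ones.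
    ℓ-zero : ∀ x y z → ℓ₁ x y z ≈ 0# → x F.≈ F.0# × y F.≈ F.0# × z F.≈ F.0#
    ℓ-zero x y z ℓ≈0 = by-cases (x F.≟ F.0#) (y F.≟ F.0#) (z F.≟ F.0#)
      where
      c≈0 : ⟦ E.c ⟧ x y z F.≈ F.0#
      c≈0 = ι-zero (trans (norm-form x y z) (trans (*-congˡ (trans (*-congʳ (trans (*-congʳ ℓ≈0) (zeroˡ _))) (zeroˡ _))) (zeroʳ _)))
      by-cases : Dec (x F.≈ F.0#) → Dec (y F.≈ F.0#) → Dec (z F.≈ F.0#) → x F.≈ F.0# × y F.≈ F.0# × z F.≈ F.0#
      by-cases (yes x≈0) (yes y≈0) (yes z≈0) = x≈0 , y≈0 , z≈0
      by-cases (no x≉0) _ _ = contradiction c≈0 (E.c-anisotropic x y z λ (x≈0 , _) → x≉0 x≈0)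
      by-cases _ (no y≉0) _ = contradiction c≈0 (E.c-anisotropic x y z λ (_ , y≈0 , _) → y≉0 y≈0)
      by-cases _ _ (no z≉0) = contradiction c≈0 (E.c-anisotropic x y z λ (_ , _ , z≈0) → z≉0 z≈0)

    ℓ-injective : ∀ {x y z x′ y′ z′} → ℓ₁ x y z ≈ ℓ₁ x′ y′ z′ → x F.≈ x′ × y F.≈ y′ × z F.≈ z′
    ℓ-injective {x} {y} {z} {x′} {y′} {z′} eq =
      let x+ , y+ , z+ = ℓ-zero _ _ _ (trans (ℓ-+ x y z x′ y′ z′) (≈⇒+≈0 eq)) in equate x+ , equate y+ , equate z+
      where
      equate : ∀ {u v} → u F.+ v F.≈ F.0# → u F.≈ v
      equate eq = ι-injective (+≈0⇒≈ (trans (sym (ι-+ _ _)) (trans (ι-cong eq) ι-0)))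

    dual-cong : ∀ {u u′ v v′ w w′} → u F.≈ u′ → v F.≈ v′ → w F.≈ w′ → dual₁ u v w ≈ dual₁ u′ v′ w′
    dual-cong u v w = *-congˡ (+-cong (+-cong (*-congʳ (ι-cong u)) (*-congʳ (ι-cong v))) (*-congʳ (ι-cong w)))

    dual-+ : ∀ u v w u′ v′ w′ → dual₁ (u F.+ u′) (v F.+ v′) (w F.+ w′) ≈ dual₁ u v w + dual₁ u′ v′ w′
    dual-+ u v w u′ v′ w′ = trans (*-congˡ (+-cong (+-cong (*-congʳ (ι-+ _ _)) (*-congʳ (ι-+ _ _))) (*-congʳ (ι-+ _ _))))
      (solve 10 (λ k u v w u′ v′ w′ a b c → k :* ((u :+ u′) :* a :+ (v :+ v′) :* b :+ (w :+ w′) :* c) := k :* (u :* a :+ v :* b :+ w :* c) :+ k :* (u′ :* a :+ v′ :* b :+ w′ :* c))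
        _ (i * D⁻) (ι u) (ι v) (ι w) (ι u′) (ι v′) (ι w′) _ _ _)

    dual-· : ∀ k u v w → dual₁ (k F.* u) (k F.* v) (k F.* w) ≈ ι k * dual₁ u v w
    dual-· k u v w = trans (*-congˡ (+-cong (+-cong (*-congʳ (ι-* _ _)) (*-congʳ (ι-* _ _))) (*-congʳ (ι-* _ _))))
      (solve 8 (λ j k u v w a b c → j :* (k :* u :* a :+ k :* v :* b :+ k :* w :* c) := k :* (j :* (u :* a :+ v :* b :+ w :* c)))
        _ (i * D⁻) (ι k) (ι u) (ι v) (ι w) _ _ _)

    -- The linear parts of f₁, f₂, f₃ form an alternating matrix, so adding them to the last coordinates is an isometry.
    u₁ u₂ u₃ : V8 → F
    u₁ v = v (# 6) F.+ lin f₃ (v (# 1)) (v (# 2)) (v (# 3))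
    u₂ v = v (# 5) F.+ lin f₂ (v (# 1)) (v (# 2)) (v (# 3))
    u₃ v = v (# 4) F.+ lin f₁ (v (# 1)) (v (# 2)) (v (# 3))

    -- The trace pairing of the two middle components carries the factor 1 / d, so the last
    -- coordinate is scaled by 1 / d as well.
    φ : V8 → W.VK
    φ v = v (# 0) , ℓ₁ (v (# 1)) (v (# 2)) (v (# 3)) , dual₁ (u₁ v) (u₂ v) (u₃ v) , F.inv d F.* v (# 7)

    φ-sim : ∀ v → W.QK (φ v) ≈ ι (F.inv d F.* Qform v)
    φ-sim v = begin
      ι (v (# 0) F.* (F.inv d F.* v (# 7))) + W.Tr (ℓ₁ (v (# 1)) (v (# 2)) (v (# 3)) * dual₁ (u₁ v) (u₂ v) (u₃ v))
        ≈⟨ +-cong (trans (ι-* _ _) (*-congˡ (ι-* _ _))) (trace-form (v (# 1)) (v (# 2)) (v (# 3)) (u₁ v) (u₂ v) (u₃ v)) ⟩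
      ι (v (# 0)) * (i * ι (v (# 7))) + i * (ι (v (# 1)) * ι (u₁ v) + ι (v (# 2)) * ι (u₂ v) + ι (v (# 3)) * ι (u₃ v))
        ≈⟨ +-congˡ (*-congˡ (trans (ι-+ _ _) (+-cong (trans (ι-+ _ _) (+-cong (ι-* _ _) (ι-* _ _))) (ι-* _ _)))) ⟨
      ι (v (# 0)) * (i * ι (v (# 7))) + i * ι (v (# 1) F.* u₁ v F.+ v (# 2) F.* u₂ v F.+ v (# 3) F.* u₃ v)
        ≈⟨ +-congˡ (*-congˡ (ι-cong (pairing (v (# 1)) (v (# 2)) (v (# 3)) (v (# 6)) (v (# 5)) (v (# 4))))) ⟩
      ι (v (# 0)) * (i * ι (v (# 7))) + i * ι (v (# 1) F.* v (# 6) F.+ v (# 2) F.* v (# 5) F.+ v (# 3) F.* v (# 4))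
        ≈⟨ +-congˡ (*-congˡ (hom-sum (v (# 1) F.* v (# 6)) (v (# 2) F.* v (# 5)) (v (# 3) F.* v (# 4)))) ⟩
      ι (v (# 0)) * (i * ι (v (# 7))) + i * (ι (v (# 1) F.* v (# 6)) + ι (v (# 2) F.* v (# 5)) + ι (v (# 3) F.* v (# 4)))
        ≈⟨ solve 6 (λ i a z b c d → a :* (i :* z) :+ i :* (b :+ c :+ d) := i :* (a :* z :+ b :+ c :+ d)) _ i (ι (v (# 0))) (ι (v (# 7))) _ _ _ ⟩
      i * (ι (v (# 0)) * ι (v (# 7)) + ι (v (# 1) F.* v (# 6)) + ι (v (# 2) F.* v (# 5)) + ι (v (# 3) F.* v (# 4)))
        ≈⟨ trans (ι-* _ _) (*-congˡ (trans (ι-+ _ _) (+-congʳ (trans (ι-+ _ _) (+-congʳ (trans (ι-+ _ _) (+-congʳ (ι-* _ _)))))))) ⟨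
      ι (F.inv d F.* Qform v) ∎
      where
      hom-sum : ∀ a b c → ι (a F.+ b F.+ c) ≈ ι a + ι b + ι c
      hom-sum a b c = trans (ι-+ _ _) (+-congʳ (ι-+ _ _))

    i≉0 : F.inv d F.≉ F.0#
    i≉0 = F.inv-nonzero d≉0

    φ-injective : ∀ {u v} → φ u W.≈k φ v → u ≈v v
    φ-injective {u} {v} (e₀ , eγ , eδ , e₇) = by-coordinate
      where
      γ-eqs = ℓ-injective eγ
      ≈₁ = proj₁ γ-eqs
      ≈₂ = proj₁ (proj₂ γ-eqs)
      ≈₃ = proj₂ (proj₂ γ-eqs)
      δ-eqs = dual-injective eδ
      by-coordinate : u ≈v v
      by-coordinate Fin.zero = e₀
      by-coordinate (Fin.suc Fin.zero) = ≈₁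
      by-coordinate (Fin.suc (Fin.suc Fin.zero)) = ≈₂
      by-coordinate (Fin.suc (Fin.suc (Fin.suc Fin.zero))) = ≈₃
      by-coordinate (Fin.suc (Fin.suc (Fin.suc (Fin.suc Fin.zero)))) = lin-cancel (proj₂ (proj₂ δ-eqs)) (lin-cong f₁ ≈₁ ≈₂ ≈₃)
      by-coordinate (Fin.suc (Fin.suc (Fin.suc (Fin.suc (Fin.suc Fin.zero))))) = lin-cancel (proj₁ (proj₂ δ-eqs)) (lin-cong f₂ ≈₁ ≈₂ ≈₃)
      by-coordinate (Fin.suc (Fin.suc (Fin.suc (Fin.suc (Fin.suc (Fin.suc Fin.zero)))))) = lin-cancel (proj₁ δ-eqs) (lin-cong f₃ ≈₁ ≈₂ ≈₃)
      by-coordinate (Fin.suc (Fin.suc (Fin.suc (Fin.suc (Fin.suc (Fin.suc (Fin.suc Fin.zero))))))) = F.*-cancelˡ-nonzero i≉0 e₇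

    φ-surjective : ∀ w → ∃ λ v → φ v W.≈k w
    φ-surjective (a , γ , δ , z) =
      let x₁ , x₂ , x₃ , eγ = ℓ-surjective γ
          y₁ , y₂ , y₃ , eδ = dual-surjective δ
          l = λ f → lin f x₁ x₂ x₃
      in lookup (a ∷ x₁ ∷ x₂ ∷ x₃ ∷ y₃ F.+ l f₁ ∷ y₂ F.+ l f₂ ∷ y₁ F.+ l f₃ ∷ d F.* z ∷ []) ,
         F.refl , eγ , trans (dual-cong (add-twice y₁ (l f₃)) (add-twice y₂ (l f₂)) (add-twice y₃ (l f₁))) eδ ,
         F.trans (F.sym (F.*-assoc _ _ _)) (F.trans (F.*-congʳ (F.trans (F.*-comm _ _) (F.inv-right d≉0))) (F.*-identityˡ z))

    similitude : W.Similitude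
    similitude = record
      { φ = φ
      ; φ-cong = λ e → e (# 0) , ℓ-cong (e (# 1)) (e (# 2)) (e (# 3)) ,
          dual-cong (F.+-cong (e (# 6)) (lin-cong f₃ (e (# 1)) (e (# 2)) (e (# 3)))) (F.+-cong (e (# 5)) (lin-cong f₂ (e (# 1)) (e (# 2)) (e (# 3))))
            (F.+-cong (e (# 4)) (lin-cong f₁ (e (# 1)) (e (# 2)) (e (# 3)))) , F.*-congˡ (e (# 7))
      ; φ-+ = λ u v → F.refl , ℓ-+ _ _ _ _ _ _ ,
          trans (dual-cong (lin-+ f₃ (u (# 6)) (v (# 6)) _ _ _ _ _ _) (lin-+ f₂ (u (# 5)) (v (# 5)) _ _ _ _ _ _) (lin-+ f₁ (u (# 4)) (v (# 4)) _ _ _ _ _ _))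
            (dual-+ (u₁ u) (u₂ u) (u₃ u) (u₁ v) (u₂ v) (u₃ v)) , F.distribˡ _ _ _
      ; φ-· = λ k v → F.refl , ℓ-· k _ _ _ ,
          trans (dual-cong (lin-* f₃ k (v (# 6)) _ _ _) (lin-* f₂ k (v (# 5)) _ _ _) (lin-* f₁ k (v (# 4)) _ _ _)) (dual-· k (u₁ v) (u₂ v) (u₃ v)) ,
          F.trans (F.sym (F.*-assoc _ _ _)) (F.trans (F.*-congʳ (F.*-comm _ _)) (F.*-assoc _ _ _))
      ; φ-inj = φ-injective
      ; φ-surj = φ-surjective
      ; λ₀ = F.inv d
      ; λ₀≉0 = i≉0
      ; φ-sim = φ-sim
      }

    -- By the product rule the gradient of d ℓ₁ ℓ₂ ℓ₃ is d times the sum of (1 , X₁ , Y₁) ℓ₂ ℓ₃ and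
    -- its conjugates. Its dual coordinate is thus ℓ₂ ℓ₃, which is t^(q+q²) for t = ℓ₁.
    dual-gradient : ∀ x y z → dual₁ (quad f₃ x y z) (quad f₂ x y z) (quad f₁ x y z) ≈ ℓ₂ x y z * ℓ₃ x y z
    dual-gradient x y z = dual-of-traces (l₂ * l₃) (l₃ * l₁) (l₁ * l₂)
      (trans (ι-cong (F.sym (gradient₁ x y z))) (trans (norm-derivative x y z F.1# F.0# F.0#) (*-congˡ (+-cong (+-cong
        (trans (*-congʳ (unit₁ X₁ Y₁)) (*-identityˡ _)) (trans (*-congʳ (unit₁ X₂ Y₂)) (*-identityˡ _))) (trans (*-congʳ (unit₁ X₃ Y₃)) (*-identityˡ _))))))
      (trans (ι-cong (F.sym (gradient₂ x y z))) (trans (norm-derivative x y z F.0# F.1# F.0#) (*-congˡ (+-cong (+-cong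
        (*-congʳ (unit₂ X₁ Y₁)) (*-congʳ (unit₂ X₂ Y₂))) (*-congʳ (unit₂ X₃ Y₃))))))
      (trans (ι-cong (F.sym (gradient₃ x y z))) (trans (norm-derivative x y z F.0# F.0# F.1#) (*-congˡ (+-cong (+-cong
        (*-congʳ (unit₃ X₁ Y₁)) (*-congʳ (unit₃ X₂ Y₂))) (*-congʳ (unit₃ X₃ Y₃))))))
      where
      l₁ = ℓ₁ x y z
      l₂ = ℓ₂ x y z
      l₃ = ℓ₃ x y z
      unit₁ : ∀ X Y → ℓ X Y F.1# F.0# F.0# ≈ 1#
      unit₁ X Y = trans (+-cong (+-cong ι-1 (*-congˡ ι-0)) (*-congˡ ι-0)) (solve 2 (λ a b → con true :+ a :* con false :+ b :* con false := con true) _ X Y)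
      unit₂ : ∀ X Y → ℓ X Y F.0# F.1# F.0# ≈ X
      unit₂ X Y = trans (+-cong (+-cong ι-0 (*-congˡ ι-1)) (*-congˡ ι-0)) (solve 2 (λ a b → con false :+ a :* con true :+ b :* con false := a) _ X Y)
      unit₃ : ∀ X Y → ℓ X Y F.0# F.0# F.1# ≈ Y
      unit₃ X Y = trans (+-cong (+-cong ι-0 (*-congˡ ι-0)) (*-congˡ ι-1)) (solve 2 (λ a b → con false :+ a :* con false :+ b :* con true := b) _ X Y)

    tqq≈ : ∀ x y z → W.tqq (ℓ₁ x y z) ≈ ℓ₂ x y z * ℓ₃ x y z
    tqq≈ x y z = *-cong (trans (pow-q _) (σ-ℓ₁ x y z)) (trans (pow-q² _) (trans (σ-cong (σ-ℓ₁ x y z)) (σ-ℓ₂ x y z)))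

    Nm≈ : ∀ x y z → ι (F.inv d F.* ⟦ E.c ⟧ x y z) ≈ W.Nm (ℓ₁ x y z)
    Nm≈ x y z = begin
      ι (F.inv d F.* ⟦ E.c ⟧ x y z)                        ≈⟨ trans (ι-* _ _) (*-congˡ (norm-form x y z)) ⟩
      i * (ι d * (ℓ₁ x y z * ℓ₂ x y z * ℓ₃ x y z))   ≈⟨ trans (sym (*-assoc _ _ _)) (trans (*-congʳ id≈1) (*-identityˡ _)) ⟩
      ℓ₁ x y z * ℓ₂ x y z * ℓ₃ x y z                 ≈⟨ *-assoc _ _ _ ⟩
      ℓ₁ x y z * (ℓ₂ x y z * ℓ₃ x y z)               ≈⟨ *-congˡ (tqq≈ x y z) ⟨
      ℓ₁ x y z * W.tqq (ℓ₁ x y z)                      ≈⟨ *-assoc _ _ _ ⟨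
      W.Nm (ℓ₁ x y z)                                    ∎

    O : (F × F × F) ⊎ ⊤ → V8
    O = O7 f₁ f₂ f₃

    -- In characteristic 2 the linear part added by `u₁`, `u₂`, `u₃` cancels the one inside fᵢ, and
    -- only the gradient of c remains.
    δ-image : ∀ x y z → dual₁ (u₁ (O (inj₁ (x , y , z)))) (u₂ (O (inj₁ (x , y , z)))) (u₃ (O (inj₁ (x , y , z)))) ≈ W.tqq (ℓ₁ x y z)
    δ-image x y z = trans (dual-cong (eval+lin f₃ x y z) (eval+lin f₂ x y z) (eval+lin f₁ x y z)) (trans (dual-gradient x y z) (sym (tqq≈ x y z)))

    times-1 : ∀ {t} → t ≈ ι F.1# * t
    times-1 = trans (sym (*-identityˡ _)) (*-congʳ (sym ι-1))

    point-image : ∀ {x y z w} → w F.≈ F.inv d F.* ⟦ E.c ⟧ x y z → ∀ {a γ δ} → a F.≈ F.1# → γ ≈ ℓ₁ x y z → δ ≈ W.tqq (ℓ₁ x y z) →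
      φ (O (inj₁ (x , y , z))) W.∼k (a , γ , δ , w)
    point-image {x} {y} {z} eq a γ δ = F.1# , F.1≉0 , F.trans (F.sym (F.*-identityˡ _)) (F.*-congˡ (F.sym a)) ,
      trans (sym γ) times-1 , trans (δ-image x y z) (trans (sym δ) times-1) ,
      F.trans (F.*-congˡ (last-coordinate x y z)) (F.trans (F.sym eq) (F.sym (F.*-identityˡ _)))

    -- The image of the last unit vector has last coordinate 1 / d, hence the scalar `F.inv d`.
    infinity-image : ∀ {a γ δ w} → a F.≈ F.0# → γ ≈ 0# → δ ≈ 0# → w F.≈ F.1# → φ (O (inj₂ tt)) W.∼k (a , γ , δ , w)
    infinity-image {a} {γ} {δ} a≈0 γ≈0 δ≈0 w≈1 = F.inv d , i≉0 , F.sym (F.trans (F.*-congˡ a≈0) (F.zeroʳ _)) ,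
      trans ℓ-0 (sym (trans (*-congˡ γ≈0) (zeroʳ i))) ,
      trans (dual-cong (lin-0 f₃) (lin-0 f₂) (lin-0 f₁)) (trans dual-0 (sym (trans (*-congˡ δ≈0) (zeroʳ i)))) , F.*-congˡ (F.sym w≈1)
      where
      ℓ-0 : ℓ₁ F.0# F.0# F.0# ≈ 0#
      ℓ-0 = trans (+-cong (+-cong ι-0 (*-congˡ ι-0)) (*-congˡ ι-0)) (solve 2 (λ a b → con false :+ a :* con false :+ b :* con false := con false) _ X₁ Y₁)
      dual-0 : dual₁ F.0# F.0# F.0# ≈ 0#
      dual-0 = trans (*-congˡ (+-cong (+-cong (*-congʳ ι-0) (*-congʳ ι-0)) (*-congʳ ι-0)))
        (solve 4 (λ k a b c → k :* (con false :* a :+ con false :* b :+ con false :* c) := con false) _ (i * D⁻) _ _ _)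

    tqq-cong : ∀ {s t} → s ≈ t → W.tqq s ≈ W.tqq t
    tqq-cong eq = *-cong (trans (pow-q _) (trans (σ-cong eq) (sym (pow-q _)))) (trans (pow-q² _) (trans (σ-cong (σ-cong eq)) (sym (pow-q² _))))

    maps-onto : W.MapsOntoKantor similitude O
    maps-onto = into , onto
      where
      into : ∀ j → ∃ λ w → W.KantorRep w × (φ (O j) W.∼k w)
      into (inj₁ (x , y , z)) = (F.1# , ℓ₁ x y z , W.tqq (ℓ₁ x y z) , F.inv d F.* ⟦ E.c ⟧ x y z) ,
        inj₁ (ℓ₁ x y z , F.refl , refl , refl , Nm≈ x y z) , point-image F.refl F.refl refl refl
      into (inj₂ tt) = (F.0# , 0# , 0# , F.1#) , inj₂ (F.refl , refl , refl , F.refl) , infinity-image F.refl refl refl F.refl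
      onto : ∀ w → W.KantorRep w → Σ ((F × F × F) ⊎ ⊤) λ j → φ (O j) W.∼k w
      onto (a , γ , δ , w) (inj₁ (t , a≈1 , γ≈t , δ≈ , w≈)) =
        let x , y , z , eq = ℓ-surjective t in inj₁ (x , y , z) ,
          point-image (ι-injective (trans w≈ (trans (trans (*-assoc _ _ _) (trans (*-cong (sym eq) (tqq-cong (sym eq))) (sym (*-assoc _ _ _)))) (sym (Nm≈ x y z)))))
            a≈1 (trans γ≈t (sym eq)) (trans δ≈ (tqq-cong (sym eq)))
      onto (a , γ , δ , w) (inj₂ (a≈0 , γ≈0 , δ≈0 , w≈1)) = inj₂ tt , infinity-image a≈0 γ≈0 δ≈0 w≈1

  isKantorOvoid : IsKantorOvoid q 𝔽 (O7 f₁ f₂ f₃)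
  isKantorOvoid = 𝕂 , hom , similitude , maps-onto

-- From characteristic 2 to q = 2^h, and the conclusion

module Parity {q : ℕ} (𝔽 : FiniteField q) where
  open Field 𝔽
  open Sum +-commutativeMonoid
  open Algebra.Properties.Monoid.Mult +-monoid using (×-congˡ) renaming (_×_ to _⋅_)

  private
    -- Translation by 1 permutes F.
    q⋅1≈0 : 1# + 1# ≈ 0# → q ⋅ 1# ≈ 0#
    q⋅1≈0 2≈0 = trans (sym (∑-const 1#)) (trans (solve 2 (λ s t → t := (s :+ t) :+ s) _ (∑ λ x → x) _)
        (trans (+-congʳ (sym (∑-+ (λ x → x) (λ _ → 1#)))) (trans (+-congʳ (∑-reindex (λ eq → eq) (_+ 1#) (_+ 1#) +-congʳ +-congʳ involutive involutive)) (x+x≈0 _))))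
      where
      open CharTwo R 2≈0
      involutive : ∀ x → (x + 1#) + 1# ≈ x
      involutive x = trans (+-assoc x 1# 1#) (trans (+-congˡ 2≈0) (+-identityʳ x))

    even⋅1≈0 : 1# + 1# ≈ 0# → ∀ k → (k ℕ.* 2) ⋅ 1# ≈ 0#
    even⋅1≈0 2≈0 zero    = refl
    even⋅1≈0 2≈0 (suc k) = trans (sym (+-assoc 1# 1# _)) (trans (+-cong 2≈0 (even⋅1≈0 2≈0 k)) (+-identityˡ 0#))

  -- For odd q, pairing off ones gives q · 1 = 1, whereas the translation argument gives q · 1 = 0.
  2∣q : 1# + 1# ≈ 0# → 2 ∣ q
  2∣q 2≈0 = by-remainder (q % 2) (m%n<n q 2) (m≡m%n+[m/n]*n q 2)
    where
    by-remainder : ∀ r → r < 2 → q ≡ r ℕ.+ (q / 2) ℕ.* 2 → 2 ∣ q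
    by-remainder 0 _ q≡ = divides (q / 2) q≡
    by-remainder 1 _ q≡ = contradiction (trans (sym (trans (+-congˡ (even⋅1≈0 2≈0 (q / 2))) (+-identityʳ 1#)))
      (trans (×-congˡ (≡.sym q≡)) (q⋅1≈0 2≈0))) 1≉0
    by-remainder (suc (suc _)) (s≤s (s≤s ())) _

2∣p^k⇒2∣p : ∀ p k → 2 ∣ p ℕ.^ k → 2 ∣ p
2∣p^k⇒2∣p p zero 2∣1 with ∣1⇒≡1 2∣1
... | ()
2∣p^k⇒2∣p p (suc k) 2∣p^k with euclidsLemma p (p ℕ.^ k) prime[2] 2∣p^k
... | inj₁ 2∣p  = 2∣p
... | inj₂ 2∣p^k′ = 2∣p^k⇒2∣p p k 2∣p^k′

even-prime : ∀ {p} → Prime p → 2 ∣ p → p ≡ 2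
even-prime p-prime 2∣p with prime⇒irreducible p-prime 2∣p
... | inj₁ ()
... | inj₂ 2≡p = ≡.sym 2≡p

-- For h ≤ 3 both sides of the bound are numerals and the Boolean comparison evaluates to false. The
-- surviving case h ≥ 4 is the condition q ≥ 16 of the weighted sums.
bound⇒4≤h : ∀ h → BoundHolds (2 ℕ.^ h) → 4 ≤ h
bound⇒4≤h 0 bound = ⊥-elim (ℕ.<⇒<ᵇ bound)
bound⇒4≤h 1 bound = ⊥-elim (ℕ.<⇒<ᵇ bound)
bound⇒4≤h 2 bound = ⊥-elim (ℕ.<⇒<ᵇ bound)
bound⇒4≤h 3 bound = ⊥-elim (ℕ.<⇒<ᵇ bound)
bound⇒4≤h (suc (suc (suc (suc h)))) _ = s≤s (s≤s (s≤s (s≤s z≤n)))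

theorem4p1 : (q : ℕ) → IsPrimePower q → BoundHolds q →
    (𝔽 : FiniteField q) →
    (f₁ f₂ f₃ : Geometry.Poly2 (FiniteField.ring 𝔽)) →
    Geometry.HasDegree2 (FiniteField.ring 𝔽) f₁ →
    Geometry.HasDegree2 (FiniteField.ring 𝔽) f₂ →
    Geometry.HasDegree2 (FiniteField.ring 𝔽) f₃ →
    Geometry.IsOvoid (FiniteField.ring 𝔽) (Geometry.O7 (FiniteField.ring 𝔽) f₁ f₂ f₃) →
    (2 ∣ q) × IsKantorOvoid q 𝔽 (Geometry.O7 (FiniteField.ring 𝔽) f₁ f₂ f₃)
theorem4p1 q (p , k , p-prime , q≡p^) bound 𝔽 f₁ f₂ f₃ _ _ degree-2 ovoid =
  2∣q , KantorOvoid.isKantorOvoid 𝔽 (suc k) q≡2^ 2≤q 5≤q f₁ f₂ f₃ degree-2 ovoid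
    (NormForm.Factorisation.factored-form 𝔽 (suc k) q≡2^ 4≤h 2≤q E.2≈0 E.c E.c-anisotropic
      (Depression.extension 𝔽 E.2≈0 E.c E.c-anisotropic))
  where
  2∣q : 2 ∣ q
  2∣q = Parity.2∣q 𝔽 (Ovoid.even-characteristic 𝔽 f₁ f₂ f₃ ovoid degree-2)
  q≡2^ : q ≡ 2 ℕ.^ suc k
  q≡2^ = ≡.trans q≡p^ (≡.cong (ℕ._^ suc k) (even-prime p-prime (2∣p^k⇒2∣p p (suc k) (≡.subst (2 ∣_) q≡p^ 2∣q))))
  4≤h : 4 ≤ suc k
  4≤h = bound⇒4≤h (suc k) (≡.subst BoundHolds q≡2^ bound)
  16≤q : 16 ≤ q
  16≤q = ≡.subst (16 ≤_) (≡.sym q≡2^) (ℕ.^-monoʳ-≤ 2 4≤h)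
  2≤q : 2 ≤ q
  2≤q = ℕ.≤-trans (ℕ.m≤m+n 2 14) 16≤q
  5≤q : 5 ≤ q
  5≤q = ℕ.≤-trans (ℕ.m≤m+n 5 11) 16≤q
  module E = EvenOvoid 𝔽 5≤q f₁ f₂ f₃ degree-2 ovoid
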